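{- There is an effectively computable absolute constant $c > 0$ such that every solution of $$2^m + 6^n + 1 = A y^q$$ in positive integers $m, n, q$, an integer $y \ge 2$ and a nonzero rational number $A$ satisfies $q \le c\,\max\{1, h(A)\}$.
   Context: $h$ denotes the absolute logarithmic Weil height; for a nonzero rational $r/s$ in lowest terms, $h(r/s) = \max\{\log|r|, \log|s|\}$. -}

module Defs where

open import Data.Nat using (ℕ; _⊔_)
open import Data.Integer using (∣_∣)
open import Data.Rational using (ℚ; ↥_; ↧ₙ_)
open import Data.Nat.Logarithm using (⌊log₂_⌋)

-- Multiplicative (naive) height of a rational r/s in lowest terms: max(|r|, s).
-- The absolute logarithmic Weil height is h(A) = log (heightℕ A).
heightℕ : ℚ → ℕ
heightℕ A = ∣ ↥ A ∣ ⊔ ↧ₙ A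

-- Integer (base-2, floored) version of the logarithmic height: ⌊log₂ H(A)⌋.
-- max(1, h(A)) and max(1, log₂Height A) are within absolute constant factors
-- of each other, so "q ≤ c · max(1, h(A))" for some absolute c is equivalent
-- to "q ≤ c' · max(1, log₂Height A)" for some absolute c'.
log₂Height : ℚ → ℕ
log₂Height A = ⌊log₂ heightℕ A ⌋

{-# OPTIONS --safe #-}
-- Write A = a/b, N = 2^m + 6^n + 1, so that a y^q = b N.  If n ≤ m ≤ 4n, then a y^q is
-- 2-adically very close to b; otherwise one of the powers g^ν = 6^n, 2^m dominates and a y^q is
-- very close to b g^ν as a real number.  Suppose q is huge compared with h(A).  Choose u (a fixed
-- power of 2, respectively the u of Dirichlet's theorem for ν/q) so that β = y^u, respectively
-- y^u / g^w, is close to 1.  At the integers x with 0 ≤ u x - t q small, the number β^x is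
-- extremely close to the rational ζ = (b/a)^t y^(ux-tq) (times a small power of g), whose
-- height is much smaller than that of β^x.  By the pigeonhole principle there is a nonzero
-- polynomial P(x,z) = Σ p_{kl} binom(x,k) z^l with small integer coefficients such that P(x,β^x),
-- expanded in its Newton series, is tiny at all x in question.  Then P(x,ζ) is a rational number
-- that is too close to 0 for its height, hence P vanishes at all the points (x,ζ).  The zero
-- estimate, by elimination of one power of z after the other, shows that this is impossible.
-- Because P has a bounded number of powers of z, the crude elimination (degrees double at
-- every step) is affordable, and no multiplicative independence is needed.
module Submission where

open import Defs
open import Algebra.Structures using (IsCommutativeSemiring)
open import Data.Empty using (⊥; ⊥-elim)
open import Data.Fin using (Fin; toℕ; fromℕ<; finToFun; funToFin)
import Data.Fin.Properties as FP
open import Data.Integer using (ℤ; ∣_∣; 0ℤ; 1ℤ)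
  renaming (+_ to pos; _+_ to _+ᶻ_; _*_ to _*ᶻ_; _-_ to _-ᶻ_; -_ to -ᶻ_; _^_ to _^ᶻ_)
import Data.Integer.Divisibility.Signed as ℤ∣
import Data.Integer.Properties as ℤP
import Data.Integer.Tactic.RingSolver as ℤRS
open import Data.Nat hiding (_/_; _%_)
import Data.Nat.Divisibility as ℕ∣
open import Data.Nat.DivMod
  using ( m≡m%n+[m/n]*n; m%n<n; /-monoˡ-≤; m<n*o⇒m/o<n; [m+kn]%n≡m%n; m<n⇒m%n≡m
        ; m<n⇒m/n≡0; +-distrib-/-∣ˡ; +-distrib-/-∣ʳ; m*n/n≡m )
  renaming (_/_ to _div_; _%_ to _mod_)
open import Data.Nat.Logarithm using (⌊log₂_⌋; ⌊log₂⌋-mono-≤; ⌊log₂[2^n]⌋≡n)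
open import Data.Nat.Properties
open import Data.Nat.Tactic.RingSolver using (solve-∀)
open import Data.Product
open import Data.Rational using (ℚ; _/_; 0ℚ) renaming (_*_ to _*ℚ_)
import Data.Rational as ℚ
import Data.Rational.Properties as ℚP
import Data.Rational.Unnormalised as ℚᵘ
import Data.Rational.Unnormalised.Properties as ℚᵘP
open import Data.Sum using (_⊎_; inj₁; inj₂)
open import Function using (_∘_)
open import Relation.Binary.Definitions using (tri<; tri≈; tri>)
open import Relation.Binary.PropositionalEquality
open import Relation.Nullary using (¬_; yes; no)

-- Every case must supply closeness to a precision that is a fixed fraction of log N, hence of
-- `Λ q`, where `y ≤ 2 ^ Λ`. Once `q` exceeds `2 ^ 2990` times the height of `A`, that height may be
-- replaced by the larger `h ≈ q / (2 ^ 1330 u)`; then all costs are constant multiples of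
-- `P = h Λ u`, and numerical inequalities remain. The obstacle is that the constants depend on each
-- other in a circle. The zero estimate needs `R S > 2 ^ L K`, which makes `x / K` large;
-- `(1 + 1 / D) ^ x` stays below `2 ^ K` if `D` is of the order of `x / K`; the real case loses
-- `D ^ I` in the Newton series, which the pigeonhole step must make up for; and this asks for many
-- powers of `z`, that is, a large `L`. The circle closes because `log₂ D` comes out as `L` plus a
-- constant: the `I = 16 K` conditions cost about `16 (L + const) K ^ 2` bits, against the
-- `1000 L K ^ 2` bits of the `L K` coefficients.

-- Finite sums and Newton series.

module Sums {A : Set} {_⊕_ _⊗_ : A → A → A} {0# 1# : A}
  (isCSR : IsCommutativeSemiring _≡_ _⊕_ _⊗_ 0# 1#) where

  open IsCommutativeSemiring isCSR
    using (distribˡ; zeroʳ)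
    renaming (+-identityʳ to ⊕-identityʳ; +-identityˡ to ⊕-identityˡ; +-assoc to ⊕-assoc; +-comm to ⊕-comm; *-assoc to ⊗-assoc; *-comm to ⊗-comm)
  open ≡-Reasoning

  sum : ℕ → (ℕ → A) → A
  sum zero    f = 0#
  sum (suc n) f = sum n f ⊕ f n

  ⊕-swap : ∀ a b c d → (a ⊕ b) ⊕ (c ⊕ d) ≡ (a ⊕ c) ⊕ (b ⊕ d)
  ⊕-swap a b c d = begin
    (a ⊕ b) ⊕ (c ⊕ d) ≡⟨ ⊕-assoc a b (c ⊕ d) ⟩
    a ⊕ (b ⊕ (c ⊕ d)) ≡⟨ cong (a ⊕_) (trans (sym (⊕-assoc b c d)) (trans (cong (_⊕ d) (⊕-comm b c)) (⊕-assoc c b d))) ⟩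
    a ⊕ (c ⊕ (b ⊕ d)) ≡⟨ ⊕-assoc a c (b ⊕ d) ⟨
    (a ⊕ c) ⊕ (b ⊕ d) ∎

  ⊗-swapˡ : ∀ a b c → a ⊗ (b ⊗ c) ≡ b ⊗ (a ⊗ c)
  ⊗-swapˡ a b c = trans (sym (⊗-assoc a b c)) (trans (cong (_⊗ c) (⊗-comm a b)) (⊗-assoc b a c))

  sum-cong : ∀ n {f g} → (∀ i → i < n → f i ≡ g i) → sum n f ≡ sum n g
  sum-cong zero    eq = refl
  sum-cong (suc n) eq = cong₂ _⊕_ (sum-cong n (λ i i<n → eq i (m<n⇒m<1+n i<n))) (eq n (n<1+n n))

  sum-distrib-⊕ : ∀ n f g → sum n (λ i → f i ⊕ g i) ≡ sum n f ⊕ sum n g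
  sum-distrib-⊕ zero    f g = sym (⊕-identityˡ 0#)
  sum-distrib-⊕ (suc n) f g = trans (cong (_⊕ (f n ⊕ g n)) (sum-distrib-⊕ n f g)) (⊕-swap _ _ _ _)

  sum-distribˡ-⊗ : ∀ n c f → c ⊗ sum n f ≡ sum n (λ i → c ⊗ f i)
  sum-distribˡ-⊗ zero    c f = zeroʳ c
  sum-distribˡ-⊗ (suc n) c f = trans (distribˡ c _ _) (cong (_⊕ (c ⊗ f n)) (sum-distribˡ-⊗ n c f))

  sum-+ : ∀ m n f → sum (m + n) f ≡ sum m f ⊕ sum n (λ i → f (m + i))
  sum-+ m zero    f = trans (cong (λ k → sum k f) (+-identityʳ m)) (sym (⊕-identityʳ _))
  sum-+ m (suc n) f = begin
    sum (m + suc n) f                                   ≡⟨ cong (λ k → sum k f) (+-suc m n) ⟩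
    sum (m + n) f ⊕ f (m + n)                           ≡⟨ cong (_⊕ f (m + n)) (sum-+ m n f) ⟩
    (sum m f ⊕ sum n (λ i → f (m + i))) ⊕ f (m + n)     ≡⟨ ⊕-assoc _ _ _ ⟩
    sum m f ⊕ sum (suc n) (λ i → f (m + i))             ∎

  sum-* : ∀ L K f → sum (L * K) f ≡ sum L (λ l → sum K (λ k → f (l * K + k)))
  sum-* zero    K f = refl
  sum-* (suc L) K f = begin
    sum (K + L * K) f                                   ≡⟨ cong (λ k → sum k f) (+-comm K (L * K)) ⟩
    sum (L * K + K) f                                   ≡⟨ sum-+ (L * K) K f ⟩
    sum (L * K) f ⊕ sum K (λ k → f (L * K + k))         ≡⟨ cong (_⊕ sum K (λ k → f (L * K + k))) (sum-* L K f) ⟩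
    sum (suc L) (λ l → sum K (λ k → f (l * K + k)))     ∎

  -- newton w x h = Σᵢ (x choose i) w^(x-i) h i, presented by its recursion in x.
  newton : A → ℕ → (ℕ → A) → A
  newton w zero    h = h 0
  newton w (suc x) h = (w ⊗ newton w x h) ⊕ newton w x (h ∘ suc)

  newton-cong : ∀ w x {h h′} → (∀ i → h i ≡ h′ i) → newton w x h ≡ newton w x h′
  newton-cong w zero    eq = eq 0
  newton-cong w (suc x) eq = cong₂ _⊕_ (cong (w ⊗_) (newton-cong w x eq)) (newton-cong w x (eq ∘ suc))

  newton-⊕ : ∀ w x h h′ → newton w x (λ i → h i ⊕ h′ i) ≡ newton w x h ⊕ newton w x h′
  newton-⊕ w zero    h h′ = refl
  newton-⊕ w (suc x) h h′ = begin
    (w ⊗ newton w x (λ i → h i ⊕ h′ i)) ⊕ newton w x (λ i → h (suc i) ⊕ h′ (suc i))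
      ≡⟨ cong₂ _⊕_ (trans (cong (w ⊗_) (newton-⊕ w x h h′)) (distribˡ w _ _)) (newton-⊕ w x (h ∘ suc) (h′ ∘ suc)) ⟩
    ((w ⊗ newton w x h) ⊕ (w ⊗ newton w x h′)) ⊕ (newton w x (h ∘ suc) ⊕ newton w x (h′ ∘ suc))
      ≡⟨ ⊕-swap _ _ _ _ ⟩
    newton w (suc x) h ⊕ newton w (suc x) h′ ∎

  newton-⊗ : ∀ w x c h → newton w x (λ i → c ⊗ h i) ≡ c ⊗ newton w x h
  newton-⊗ w zero    c h = refl
  newton-⊗ w (suc x) c h = begin
    (w ⊗ newton w x (λ i → c ⊗ h i)) ⊕ newton w x (λ i → c ⊗ h (suc i))
      ≡⟨ cong₂ _⊕_ (trans (cong (w ⊗_) (newton-⊗ w x c h)) (⊗-swapˡ w c _)) (newton-⊗ w x c (h ∘ suc)) ⟩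
    (c ⊗ (w ⊗ newton w x h)) ⊕ (c ⊗ newton w x (h ∘ suc))
      ≡⟨ distribˡ c _ _ ⟨
    c ⊗ newton w (suc x) h ∎

  newton-0 : ∀ w x → newton w x (λ _ → 0#) ≡ 0#
  newton-0 w zero    = refl
  newton-0 w (suc x) = trans (cong₂ _⊕_ (trans (cong (w ⊗_) (newton-0 w x)) (zeroʳ w)) (newton-0 w x)) (⊕-identityʳ 0#)

  newton-sum : ∀ w x n (p : ℕ → A) (h : ℕ → ℕ → A) →
    newton w x (λ i → sum n (λ j → p j ⊗ h j i)) ≡ sum n (λ j → p j ⊗ newton w x (h j))
  newton-sum w x zero    p h = newton-0 w x
  newton-sum w x (suc n) p h = trans (newton-⊕ w x _ _) (cong₂ _⊕_ (newton-sum w x n p h) (newton-⊗ w x (p n) (h n)))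

module Σℕ = Sums +-*-isCommutativeSemiring
module Σᶻ = Sums ℤP.+-*-isCommutativeSemiring

sum-mono : ∀ n {f g} → (∀ i → i < n → f i ≤ g i) → Σℕ.sum n f ≤ Σℕ.sum n g
sum-mono zero    f≤g = z≤n
sum-mono (suc n) f≤g = +-mono-≤ (sum-mono n (λ i i<n → f≤g i (m<n⇒m<1+n i<n))) (f≤g n (n<1+n n))

sum-const : ∀ n c → Σℕ.sum n (λ _ → c) ≡ n * c
sum-const zero    c = refl
sum-const (suc n) c = trans (cong (_+ c) (sum-const n c)) (+-comm (n * c) c)

sum-≤ : ∀ n {f} c → (∀ i → i < n → f i ≤ c) → Σℕ.sum n f ≤ n * c
sum-≤ n c f≤c = ≤-trans (sum-mono n f≤c) (≤-reflexive (sum-const n c))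

∣sum∣≤ : ∀ n f → ∣ Σᶻ.sum n f ∣ ≤ Σℕ.sum n (λ i → ∣ f i ∣)
∣sum∣≤ zero    f = z≤n
∣sum∣≤ (suc n) f = ≤-trans (ℤP.∣i+j∣≤∣i∣+∣j∣ (Σᶻ.sum n f) (f n)) (+-monoˡ-≤ _ (∣sum∣≤ n f))

sum-pos : ∀ n f → pos (Σℕ.sum n f) ≡ Σᶻ.sum n (λ i → pos (f i))
sum-pos zero    f = refl
sum-pos (suc n) f = trans (ℤP.pos-+ (Σℕ.sum n f) (f n)) (cong (_+ᶻ pos (f n)) (sum-pos n f))

newton-mono : ∀ w x {h h′} → (∀ i → h i ≤ h′ i) → Σℕ.newton w x h ≤ Σℕ.newton w x h′
newton-mono w zero    le = le 0
newton-mono w (suc x) le = +-mono-≤ (*-monoʳ-≤ w (newton-mono w x le)) (newton-mono w x (le ∘ suc))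

newton-pos : ∀ w x h → pos (Σℕ.newton w x h) ≡ Σᶻ.newton (pos w) x (λ i → pos (h i))
newton-pos w zero    h = refl
newton-pos w (suc x) h = trans (ℤP.pos-+ (w * Σℕ.newton w x h) _)
  (cong₂ _+ᶻ_ (trans (ℤP.pos-* w _) (cong (pos w *ᶻ_) (newton-pos w x h))) (newton-pos w x (h ∘ suc)))

∣newton∣≤ : ∀ w x h → ∣ Σᶻ.newton (pos w) x h ∣ ≤ Σℕ.newton w x (λ i → ∣ h i ∣)
∣newton∣≤ w zero    h = ≤-refl
∣newton∣≤ w (suc x) h = ≤-trans (ℤP.∣i+j∣≤∣i∣+∣j∣ (pos w *ᶻ _) _)
  (+-mono-≤ (≤-trans (≤-reflexive (ℤP.∣i*j∣≡∣i∣*∣j∣ (pos w) _)) (*-monoʳ-≤ w (∣newton∣≤ w x h))) (∣newton∣≤ w x (h ∘ suc)))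

-- Homogeneity of degree `x`. It lets bounds with denominators `D ^ i` on Newton coefficients be
-- summed within the naturals.
newton-scale : ∀ D w x h → D ^ x * Σℕ.newton w x h ≡ Σℕ.newton (D * w) x (λ i → D ^ i * h i)
newton-scale D w zero    h = refl
newton-scale D w (suc x) h = begin
  D * D ^ x * (w * N₀ + N₁)                      ≡⟨ lem D (D ^ x) w N₀ N₁ ⟩
  D * w * (D ^ x * N₀) + D * (D ^ x * N₁)        ≡⟨ cong₂ (λ a b → D * w * a + D * b) (newton-scale D w x h) (newton-scale D w x (h ∘ suc)) ⟩
  D * w * M₀ + D * Σℕ.newton (D * w) x (λ i → D ^ i * h (suc i))
    ≡⟨ cong ((D * w * M₀) +_) (Σℕ.newton-⊗ (D * w) x D _) ⟨
  D * w * M₀ + Σℕ.newton (D * w) x (λ i → D * (D ^ i * h (suc i)))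
    ≡⟨ cong ((D * w * M₀) +_) (Σℕ.newton-cong (D * w) x (λ i → sym (*-assoc D (D ^ i) _))) ⟩
  D * w * M₀ + Σℕ.newton (D * w) x (λ i → D ^ suc i * h (suc i)) ∎
  where
  open ≡-Reasoning
  N₀ = Σℕ.newton w x h
  N₁ = Σℕ.newton w x (h ∘ suc)
  M₀ = Σℕ.newton (D * w) x (λ i → D ^ i * h i)
  lem : ∀ D E w a b → D * E * (w * a + b) ≡ D * w * (E * a) + D * (E * b)
  lem = solve-∀

newton-pow : ∀ w d x → Σℕ.newton w x (d ^_) ≡ (w + d) ^ x
newton-pow w d zero    = refl
newton-pow w d (suc x) = trans (cong ((w * Σℕ.newton w x (d ^_)) +_) (Σℕ.newton-⊗ w x d (d ^_)))
  (trans (cong (λ a → w * a + d * a) (newton-pow w d x)) (sym (*-distribʳ-+ ((w + d) ^ x) w d)))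

-- Binomial coefficients and the Newton expansion of `bin x k * μ ^ x`.

bin : ℕ → ℕ → ℕ
bin n       zero    = 1
bin zero    (suc k) = 0
bin (suc n) (suc k) = bin n k + bin n (suc k)

n<k⇒bin≡0 : ∀ n k → n < k → bin n k ≡ 0
n<k⇒bin≡0 zero    (suc k) _         = refl
n<k⇒bin≡0 (suc n) (suc k) (s≤s n<k) = cong₂ _+_ (n<k⇒bin≡0 n k n<k) (n<k⇒bin≡0 n (suc k) (m<n⇒m<1+n n<k))

-- A subtraction-free form of `(k + 1) binom(n, k + 1) = (n - k) binom(n,
-- k)`, the recursion behind `fall-poly`.
bin-absorb : ∀ n k → suc k * bin n (suc k) + k * bin n k ≡ n * bin n k
bin-absorb zero    zero    = refl
bin-absorb zero    (suc k) = cong₂ _+_ (*-zeroʳ k) (*-zeroʳ k)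
bin-absorb (suc n) zero    = trans (lem n (bin n 1)) (cong suc (bin-absorb n 0))
  where
  lem : ∀ n a → 1 * (1 + a) + 0 ≡ suc (1 * a + 0 * 1)
  lem = solve-∀
bin-absorb (suc n) (suc k) = trans (lem k n a b c) (trans (cong₂ (λ s t → s + t + a + b) (bin-absorb n k) (bin-absorb n (suc k))) (lem2 n a b))
  where
  a = bin n k
  b = bin n (suc k)
  c = bin n (suc (suc k))
  lem : ∀ k n a b c → suc (suc k) * (b + c) + suc k * (a + b) ≡ (suc k * b + k * a) + (suc (suc k) * c + suc k * b) + a + b
  lem = solve-∀
  lem2 : ∀ n a b → n * a + n * b + a + b ≡ suc n * (a + b)
  lem2 = solve-∀

-- shape y d k is the coefficient sequence of x ↦ bin x k * y ^ k * (w + d) ^ (x ∸ k) in the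
-- expansion newton w, for every w.
shape : ℕ → ℕ → ℕ → ℕ → ℕ
shape y d k i = bin i k * y ^ k * d ^ (i ∸ k)

shape-suc-zero : ∀ y d i → shape y d 0 (suc i) ≡ d * shape y d 0 i
shape-suc-zero y d i = lem d (d ^ i)
  where
  lem : ∀ d e → 1 * 1 * (d * e) ≡ d * (1 * 1 * e)
  lem = solve-∀

shape-suc-suc : ∀ y d k i → shape y d (suc k) (suc i) ≡ y * shape y d k i + d * shape y d (suc k) i
shape-suc-suc y d k i with k <? i
... | yes k<i = trans (lem (bin i k) (bin i (suc k)) y (y ^ k) (d ^ (i ∸ k)))
      (trans (cong (λ e → y * shape y d k i + bin i (suc k) * (y * y ^ k) * e) step′)
        (lem2 (y * shape y d k i) (bin i (suc k)) (y * y ^ k) d (d ^ (i ∸ suc k))))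
  where
  step′ : d ^ (i ∸ k) ≡ d * d ^ (i ∸ suc k)
  step′ = cong (d ^_) (+-∸-assoc 1 k<i)
  lem : ∀ a b y z e → (a + b) * (y * z) * e ≡ y * (a * z * e) + b * (y * z) * e
  lem = solve-∀
  lem2 : ∀ s b z d e → s + b * z * (d * e) ≡ s + d * (b * z * e)
  lem2 = solve-∀
-- For `i ≤ k` the two exponents of `d` no longer differ by one, because `∸` truncates; the term
-- concerned vanishes with `bin i (suc k)`.
... | no k≮i rewrite n<k⇒bin≡0 i (suc k) (s≤s (≮⇒≥ k≮i)) = lem (bin i k) y (y ^ k) (d ^ (i ∸ k)) d (d ^ (i ∸ suc k))
  where
  lem : ∀ a y z e d f → (a + 0) * (y * z) * e ≡ y * (a * z * e) + d * (0 * (y * z) * f)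
  lem = solve-∀

-- Both sides obey the same recursion in `x`. With `y = w + d` this expands `bin x k * (w + d) ^ x`
-- at base `w`, and the factor `d ^ (i ∸ k)` makes the coefficients of high index small. The
-- parameter `y` is kept free so that `d` can be enlarged to `β * d` without touching the factor
-- `y ^ k`, as the real case requires.
newton-shape : ∀ w d y k x → Σℕ.newton w x (shape y d k) ≡ shape y (w + d) k x
newton-shape w d y zero    zero    = refl
newton-shape w d y (suc k) zero    = refl
newton-shape w d y zero    (suc x) = begin
  w * Σℕ.newton w x (shape y d 0) + Σℕ.newton w x (shape y d 0 ∘ suc)
    ≡⟨ cong ((w * Σℕ.newton w x (shape y d 0)) +_) (trans (Σℕ.newton-cong w x (shape-suc-zero y d)) (Σℕ.newton-⊗ w x d _)) ⟩
  w * Σℕ.newton w x (shape y d 0) + d * Σℕ.newton w x (shape y d 0)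
    ≡⟨ *-distribʳ-+ _ w d ⟨
  (w + d) * Σℕ.newton w x (shape y d 0)
    ≡⟨ cong ((w + d) *_) (newton-shape w d y 0 x) ⟩
  (w + d) * shape y (w + d) 0 x
    ≡⟨ shape-suc-zero y (w + d) x ⟨
  shape y (w + d) 0 (suc x) ∎
  where open ≡-Reasoning
newton-shape w d y (suc k) (suc x) = begin
  w * N + Σℕ.newton w x (shape y d (suc k) ∘ suc)
    ≡⟨ cong ((w * N) +_) (trans (Σℕ.newton-cong w x (shape-suc-suc y d k)) (Σℕ.newton-⊕ w x _ _)) ⟩
  w * N + (Σℕ.newton w x (λ i → y * shape y d k i) + Σℕ.newton w x (λ i → d * shape y d (suc k) i))
    ≡⟨ cong ((w * N) +_) (cong₂ _+_ (Σℕ.newton-⊗ w x y _) (Σℕ.newton-⊗ w x d _)) ⟩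
  w * N + (y * Σℕ.newton w x (shape y d k) + d * N)
    ≡⟨ lem w d y N (Σℕ.newton w x (shape y d k)) ⟩
  y * Σℕ.newton w x (shape y d k) + (w + d) * N
    ≡⟨ cong₂ (λ a b → y * a + (w + d) * b) (newton-shape w d y k x) (newton-shape w d y (suc k) x) ⟩
  y * shape y (w + d) k x + (w + d) * shape y (w + d) (suc k) x
    ≡⟨ shape-suc-suc y (w + d) k x ⟨
  shape y (w + d) (suc k) (suc x) ∎
  where
  open ≡-Reasoning
  N = Σℕ.newton w x (shape y d (suc k))
  lem : ∀ w d y n m → w * n + (y * m + d * n) ≡ y * m + (w + d) * n
  lem = solve-∀

shape-diag : ∀ y k x → shape y y k x ≡ bin x k * y ^ x
shape-diag y k x with k ≤? x
... | yes k≤x = trans (*-assoc (bin x k) _ _) (cong (bin x k *_) (trans (sym (^-distribˡ-+-* y k (x ∸ k))) (cong (y ^_) (m+[n∸m]≡n k≤x))))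
... | no k≰x rewrite n<k⇒bin≡0 x k (≰⇒> k≰x) = refl

-- Integer polynomials in Horner form and their roots.

*ᶻ-≢0 : ∀ {a b} → a ≢ 0ℤ → b ≢ 0ℤ → a *ᶻ b ≢ 0ℤ
*ᶻ-≢0 {a} a≢0 b≢0 ab≡0 with ℤP.i*j≡0⇒i≡0∨j≡0 a ab≡0
... | inj₁ a≡0 = a≢0 a≡0
... | inj₂ b≡0 = b≢0 b≡0

*ᶻ-cancel-≢0 : ∀ {a b} → a ≢ 0ℤ → a *ᶻ b ≡ 0ℤ → b ≡ 0ℤ
*ᶻ-cancel-≢0 {a} a≢0 ab≡0 with ℤP.i*j≡0⇒i≡0∨j≡0 a ab≡0
... | inj₁ a≡0 = ⊥-elim (a≢0 a≡0)
... | inj₂ b≡0 = b≡0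

^ᶻ-≢0 : ∀ {a} → a ≢ 0ℤ → ∀ n → a ^ᶻ n ≢ 0ℤ
^ᶻ-≢0 a≢0 zero    ()
^ᶻ-≢0 a≢0 (suc n) = *ᶻ-≢0 a≢0 (^ᶻ-≢0 a≢0 n)

-- Poly D c f: f is a polynomial of formal degree D (in Horner form) whose
-- coefficient of x^D is c.
Poly : ℕ → ℤ → (ℕ → ℤ) → Set
Poly zero    c f = ∀ x → f x ≡ c
Poly (suc D) c f = Σ (ℕ → ℤ) λ g → Poly D c g × Σ ℤ λ a → ∀ x → f x ≡ pos x *ᶻ g x +ᶻ a

poly-ext : ∀ D {c f g} → (∀ x → f x ≡ g x) → Poly D c f → Poly D c g
poly-ext zero    f≗g p               = λ x → trans (sym (f≗g x)) (p x)
poly-ext (suc D) f≗g (h , ph , a , e) = h , ph , a , λ x → trans (sym (f≗g x)) (e x)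

poly-lead : ∀ D {c c′ f} → c ≡ c′ → Poly D c f → Poly D c′ f
poly-lead D refl p = p

poly-+ : ∀ D {c c′ f f′} → Poly D c f → Poly D c′ f′ → Poly D (c +ᶻ c′) (λ x → f x +ᶻ f′ x)
poly-+ zero    p p′ x = cong₂ _+ᶻ_ (p x) (p′ x)
poly-+ (suc D) (g , pg , a , e) (g′ , pg′ , a′ , e′) =
  (λ x → g x +ᶻ g′ x) , poly-+ D pg pg′ , a +ᶻ a′ , λ x → trans (cong₂ _+ᶻ_ (e x) (e′ x)) (lem (pos x) (g x) (g′ x) a a′)
  where
  lem : ∀ x g g′ a a′ → (x *ᶻ g +ᶻ a) +ᶻ (x *ᶻ g′ +ᶻ a′) ≡ x *ᶻ (g +ᶻ g′) +ᶻ (a +ᶻ a′)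
  lem = ℤRS.solve-∀

poly-scale : ∀ D {c f} k → Poly D c f → Poly D (k *ᶻ c) (λ x → k *ᶻ f x)
poly-scale zero    k p x = cong (k *ᶻ_) (p x)
poly-scale (suc D) k (g , pg , a , e) =
  (λ x → k *ᶻ g x) , poly-scale D k pg , k *ᶻ a , λ x → trans (cong (k *ᶻ_) (e x)) (lem k (pos x) (g x) a)
  where
  lem : ∀ k x g a → k *ᶻ (x *ᶻ g +ᶻ a) ≡ x *ᶻ (k *ᶻ g) +ᶻ k *ᶻ a
  lem = ℤRS.solve-∀

-- A zero leading coefficient lets a polynomial of lower degree take part in a sum of formal degree
-- `suc D`.
poly-raise : ∀ D {c f} → Poly D c f → Poly (suc D) 0ℤ f
poly-raise zero    {c} p = (λ _ → 0ℤ) , (λ _ → refl) , c , λ x → trans (p x) (sym (trans (cong (_+ᶻ c) (ℤP.*-zeroʳ (pos x))) (ℤP.+-identityˡ c)))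
poly-raise (suc D) (g , pg , a , e) = g , poly-raise D pg , a , e

poly-raise-by : ∀ n D {c f} → Poly D c f → Poly (suc n + D) 0ℤ f
poly-raise-by zero    D p = poly-raise D p
poly-raise-by (suc n) D p = poly-raise (suc (n + D)) (poly-raise-by n D p)

poly-x* : ∀ D {c f} → Poly D c f → Poly (suc D) c (λ x → pos x *ᶻ f x)
poly-x* D {f = f} p = f , p , 0ℤ , λ x → sym (ℤP.+-identityʳ _)

poly-* : ∀ D E {c d f g} → Poly D c f → Poly E d g → Poly (D + E) (c *ᶻ d) (λ x → f x *ᶻ g x)
poly-* zero    E {c} {g = g} p q = poly-ext E (λ x → cong (_*ᶻ g x) (sym (p x))) (poly-scale E c q)
poly-* (suc D) E {c} {d} {f} {g} (h , ph , a , e) q =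
  poly-ext (suc D + E) (λ x → trans (lem (pos x) (h x) a (g x)) (cong (_*ᶻ g x) (sym (e x))))
    (poly-lead (suc D + E) (trans (cong (c *ᶻ d +ᶻ_) (ℤP.*-zeroʳ a)) (ℤP.+-identityʳ _))
      (poly-+ (suc D + E) (poly-x* (D + E) (poly-* D E ph q)) (poly-scale (suc D + E) a (poly-raise-by D E q))))
  where
  lem : ∀ x h a g → x *ᶻ (h *ᶻ g) +ᶻ a *ᶻ g ≡ (x *ᶻ h +ᶻ a) *ᶻ g
  lem = ℤRS.solve-∀

poly-shift : ∀ D {c f} → Poly D c f → Poly D c (f ∘ suc)
poly-shift zero    p x = p (suc x)
poly-shift (suc D) {c} {f} (g , pg , a , e) =
  poly-ext (suc D) (λ x → trans (lem (pos x) (g (suc x)) a) (sym (e (suc x))))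
    (poly-lead (suc D) (trans (ℤP.+-identityʳ _) (ℤP.+-identityʳ c))
      (poly-+ (suc D) (poly-+ (suc D) (poly-x* D (poly-shift D pg)) (poly-raise D (poly-shift D pg))) (const D a)))
  where
  lem : ∀ x g a → (x *ᶻ g +ᶻ g) +ᶻ a ≡ (1ℤ +ᶻ x) *ᶻ g +ᶻ a
  lem = ℤRS.solve-∀
  const : ∀ D a → Poly (suc D) 0ℤ (λ _ → a)
  const zero    a = poly-raise 0 {c = a} (λ _ → refl)
  const (suc D) a = poly-raise (suc D) (const D a)

poly-divide : ∀ D {c f} z → Poly (suc D) c f →
  Σ (ℕ → ℤ) λ g → Poly D c g × (∀ x → f x ≡ (pos x -ᶻ pos z) *ᶻ g x +ᶻ f z)
poly-divide zero    {c} z (g , pg , a , e) = g , pg , λ x →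
  trans (e x) (trans (lem (pos x) (pos z) (g x) a)
    (cong ((pos x -ᶻ pos z) *ᶻ g x +ᶻ_) (trans (cong (λ u → pos z *ᶻ u +ᶻ a) (trans (pg x) (sym (pg z)))) (sym (e z)))))
  where
  lem : ∀ x z g a → x *ᶻ g +ᶻ a ≡ (x -ᶻ z) *ᶻ g +ᶻ (z *ᶻ g +ᶻ a)
  lem = ℤRS.solve-∀
poly-divide (suc D) {c} z (g , pg , a , e) with poly-divide D z pg
... | h , ph , eq = (λ x → g x +ᶻ pos z *ᶻ h x)
  , poly-lead (suc D) (trans (cong (c +ᶻ_) (ℤP.*-zeroʳ (pos z))) (ℤP.+-identityʳ c))
      (poly-+ (suc D) pg (poly-scale (suc D) (pos z) (poly-raise D ph)))
  , λ x → trans (e x) (trans (cong (λ u → pos x *ᶻ u +ᶻ a) (eq x))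
      (trans (lem (pos x) (pos z) (h x) (g z) a)
        (cong₂ (λ u v → (pos x -ᶻ pos z) *ᶻ (u +ᶻ pos z *ᶻ h x) +ᶻ v) (sym (eq x)) (sym (e z)))))
  where
  lem : ∀ x z h g a → x *ᶻ ((x -ᶻ z) *ᶻ h +ᶻ g) +ᶻ a ≡ (x -ᶻ z) *ᶻ (((x -ᶻ z) *ᶻ h +ᶻ g) +ᶻ z *ᶻ h) +ᶻ (z *ᶻ g +ᶻ a)
  lem = ℤRS.solve-∀

-- Splitting off the last root lowers the formal degree and keeps the leading coefficient; as `z`
-- increases, the factors `z i - z (suc D)` at the remaining roots are nonzero.
poly-roots : ∀ D {c f} → Poly D c f → c ≢ 0ℤ → (z : ℕ → ℕ) → (∀ i j → i < j → z i < z j) →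
  ¬ (∀ i → i ≤ D → f (z i) ≡ 0ℤ)
poly-roots zero    p c≢0 z inc roots = c≢0 (trans (sym (p (z 0))) (roots 0 z≤n))
poly-roots (suc D) {f = f} p c≢0 z inc roots with poly-divide D (z (suc D)) p
... | g , pg , eq = poly-roots D pg c≢0 z inc λ i i≤D → let q = (pos (z i) -ᶻ pos (z (suc D))) *ᶻ g (z i) in
  *ᶻ-cancel-≢0 (λ d≡0 → <⇒≢ (inc i (suc D) (s≤s i≤D)) (ℤP.+-injective (ℤP.i-j≡0⇒i≡j _ _ d≡0)))
    (trans (sym (ℤP.+-identityʳ q)) (trans (cong (q +ᶻ_) (sym (roots (suc D) ≤-refl)))
      (trans (sym (eq (z i))) (roots i (m≤n⇒m≤1+n i≤D)))))

-- The zero estimate for exponential sums on blocks of consecutive integers.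

module Grid (X : ℕ → ℕ) (S : ℕ) (gap : ∀ t → X t + S ≤ X (suc t)) where

  X-mono : ∀ t d → X t + S ≤ X (suc d + t)
  X-mono t zero    = gap t
  X-mono t (suc d) = ≤-trans (X-mono t d) (m+n≤o⇒m≤o _ (gap (suc d + t)))

  X-< : ∀ {t t′} → t < t′ → X t + S ≤ X t′
  X-< {t} {t′} t<t′ = subst (λ k → X t + S ≤ X k) (m∸n+n≡m′ t<t′) (X-mono t (t′ ∸ suc t))
    where
    m∸n+n≡m′ : t < t′ → suc (t′ ∸ suc t) + t ≡ t′
    m∸n+n≡m′ lt = trans (sym (+-suc _ t)) (m∸n+n≡m lt)

  point : .{{_ : NonZero S}} → ℕ → ℕ
  point i = X (i div S) + i mod S

  point-< : .{{_ : NonZero S}} → ∀ i j → i < j → point i < point j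
  point-< i j i<j with m≤n⇒m<n∨m≡n (/-monoˡ-≤ S (<⇒≤ i<j))
  ... | inj₁ lt = <-≤-trans (+-monoʳ-< (X (i div S)) (m%n<n i S)) (≤-trans (X-< lt) (m≤m+n _ _))
  ... | inj₂ eq rewrite sym eq = +-monoʳ-< (X (i div S)) (+-cancelʳ-< (i div S * S) _ _
      (subst₂ _<_ (m≡m%n+[m/n]*n i S) (trans (m≡m%n+[m/n]*n j S) (cong (λ k → j mod S + k * S) (sym eq))) i<j))

-- The zero function is a separate alternative because the elimination multiplies leading
-- coefficients and has to know that they are nonzero.
Degree≤ : ℕ → (ℕ → ℤ) → Set
Degree≤ D f = (∀ x → f x ≡ 0ℤ) ⊎ (Σ ℕ λ d → d ≤ D × Σ ℤ λ c → c ≢ 0ℤ × Poly d c f)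

Degree≤-grid : ∀ {D f} R S (X : ℕ → ℕ) → (∀ t → X t + S ≤ X (suc t)) → D < R * S → Degree≤ D f →
  (∀ t s → t < R → s < S → f (X t + s) ≡ 0ℤ) → ∀ x → f x ≡ 0ℤ
Degree≤-grid R S X gap D<RS (inj₁ z) vanish = z
Degree≤-grid {D} R zero X gap D<RS (inj₂ _) vanish = ⊥-elim (n≮0 (subst (D <_) (*-zeroʳ R) D<RS))
Degree≤-grid R S@(suc _) X gap D<RS (inj₂ (d , d≤D , c , c≢0 , p)) vanish =
  ⊥-elim (poly-roots d p c≢0 point point-< λ i i≤d →
    vanish (i div S) (i mod S) (m<n*o⇒m/o<n (≤-<-trans (≤-trans i≤d d≤D) D<RS)) (m%n<n i S))
  where open Grid X S gap

-- Elimination: from Σ_{l≤n} P_l(x) μ_l^s ω_l and its shift s ↦ s+1 one cancels the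
-- last summand; the other coefficients become the polynomials eliminate P μ n l, of twice
-- the degree, whose leading coefficients survive because the μ_l are distinct.
eliminate : (ℕ → ℕ → ℤ) → (ℕ → ℤ) → ℕ → ℕ → ℕ → ℤ
eliminate P μ n l x = μ n *ᶻ P n (suc x) *ᶻ P l x -ᶻ μ l *ᶻ P n x *ᶻ P l (suc x)

module _ (μ : ℕ → ℤ) (ω : ℕ → ℕ → ℤ) (X : ℕ → ℕ) where

  expSum : (ℕ → ℕ → ℤ) → ℕ → ℕ → ℕ → ℤ
  expSum P n t s = Σᶻ.sum n (λ l → P l (X t + s) *ᶻ (μ l ^ᶻ s) *ᶻ ω t l)

  private
    P₁ : (ℕ → ℕ → ℤ) → ℕ → ℕ → ℕ → ℤ
    P₁ P n t s = μ n *ᶻ P n (suc (X t + s))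

  expSum-eliminate : ∀ P n m t s →
    expSum (eliminate P μ n) m t s ≡
    P₁ P n t s *ᶻ expSum P m t s +ᶻ (-ᶻ P n (X t + s)) *ᶻ expSum P m t (suc s)
  expSum-eliminate P n m t s = begin
    expSum (eliminate P μ n) m t s
      ≡⟨ Σᶻ.sum-cong m (λ l _ → trans (lem (μ n) (P n (suc x)) (P l x) (μ l) (P n x) (P l (suc x)) (μ l ^ᶻ s) (ω t l))
           (cong (λ y → P₁ P n t s *ᶻ (P l x *ᶻ (μ l ^ᶻ s) *ᶻ ω t l) +ᶻ (-ᶻ P n x) *ᶻ (P l y *ᶻ (μ l ^ᶻ suc s) *ᶻ ω t l)) (sym (+-suc (X t) s)))) ⟩
    Σᶻ.sum m (λ l → P₁ P n t s *ᶻ (P l x *ᶻ (μ l ^ᶻ s) *ᶻ ω t l) +ᶻ (-ᶻ P n x) *ᶻ (P l (X t + suc s) *ᶻ (μ l ^ᶻ suc s) *ᶻ ω t l))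
      ≡⟨ Σᶻ.sum-distrib-⊕ m (λ l → P₁ P n t s *ᶻ f l) (λ l → (-ᶻ P n x) *ᶻ g l) ⟩
    Σᶻ.sum m (λ l → P₁ P n t s *ᶻ f l) +ᶻ Σᶻ.sum m (λ l → (-ᶻ P n x) *ᶻ g l)
      ≡⟨ cong₂ _+ᶻ_ (Σᶻ.sum-distribˡ-⊗ m (P₁ P n t s) f) (Σᶻ.sum-distribˡ-⊗ m (-ᶻ P n x) g) ⟨
    P₁ P n t s *ᶻ expSum P m t s +ᶻ (-ᶻ P n x) *ᶻ expSum P m t (suc s) ∎
    where
    open ≡-Reasoning
    x = X t + s
    f g : ℕ → ℤ
    f l = P l x *ᶻ (μ l ^ᶻ s) *ᶻ ω t l
    g l = P l (X t + suc s) *ᶻ (μ l ^ᶻ suc s) *ᶻ ω t l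
    lem : ∀ m a b u c d e w → (m *ᶻ a *ᶻ b -ᶻ u *ᶻ c *ᶻ d) *ᶻ e *ᶻ w ≡
          m *ᶻ a *ᶻ (b *ᶻ e *ᶻ w) +ᶻ (-ᶻ c) *ᶻ (d *ᶻ (u *ᶻ e) *ᶻ w)
    lem = ℤRS.solve-∀

  eliminate-vanish : ∀ P n t s → expSum P (suc n) t s ≡ 0ℤ → expSum P (suc n) t (suc s) ≡ 0ℤ →
    expSum (eliminate P μ n) n t s ≡ 0ℤ
  eliminate-vanish P n t s e₀ e₁ = begin
    A                                                       ≡⟨ ℤP.+-identityʳ A ⟨
    A +ᶻ 0ℤ                                                 ≡⟨ cong (A +ᶻ_) (lem (μ n) (P n (suc x)) (P n x) (μ n ^ᶻ s) (ω t n)) ⟨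
    expSum (eliminate P μ n) (suc n) t s                    ≡⟨ expSum-eliminate P n (suc n) t s ⟩
    P₁ P n t s *ᶻ expSum P (suc n) t s +ᶻ (-ᶻ P n x) *ᶻ expSum P (suc n) t (suc s)
      ≡⟨ cong₂ (λ a b → P₁ P n t s *ᶻ a +ᶻ (-ᶻ P n x) *ᶻ b) e₀ e₁ ⟩
    P₁ P n t s *ᶻ 0ℤ +ᶻ (-ᶻ P n x) *ᶻ 0ℤ                     ≡⟨ cong₂ _+ᶻ_ (ℤP.*-zeroʳ (P₁ P n t s)) (ℤP.*-zeroʳ (-ᶻ P n x)) ⟩
    0ℤ ∎
    where
    open ≡-Reasoning
    x = X t + s
    A = expSum (eliminate P μ n) n t s
    lem : ∀ m a b e w → (m *ᶻ a *ᶻ b -ᶻ m *ᶻ b *ᶻ a) *ᶻ e *ᶻ w ≡ 0ℤ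
    lem = ℤRS.solve-∀

  eliminate-poly : ∀ P n l {d e c c′} → Poly d c (P n) → Poly e c′ (P l) →
    Poly (d + e) ((μ n -ᶻ μ l) *ᶻ (c *ᶻ c′)) (eliminate P μ n l)
  eliminate-poly P n l {d} {e} {c} {c′} p q =
    poly-ext (d + e) (λ x → lem₂ (μ n) (μ l) (P n (suc x)) (P l x) (P n x) (P l (suc x)))
      (poly-lead (d + e) (lem (μ n) (μ l) c c′)
        (poly-+ (d + e) (poly-scale (d + e) (μ n) (poly-* d e (poly-shift d p) q))
                        (poly-scale (d + e) (-ᶻ μ l) (poly-* d e p (poly-shift e q)))))
    where
    lem : ∀ m u c c′ → m *ᶻ (c *ᶻ c′) +ᶻ (-ᶻ u) *ᶻ (c *ᶻ c′) ≡ (m -ᶻ u) *ᶻ (c *ᶻ c′)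
    lem = ℤRS.solve-∀
    lem₂ : ∀ m u a b c d → m *ᶻ (a *ᶻ b) +ᶻ (-ᶻ u) *ᶻ (c *ᶻ d) ≡ m *ᶻ a *ᶻ b -ᶻ u *ᶻ c *ᶻ d
    lem₂ = ℤRS.solve-∀

  module _ (μ≢0 : ∀ l → μ l ≢ 0ℤ) (ω≢0 : ∀ t l → ω t l ≢ 0ℤ) (R S : ℕ) where

    -- Each elimination consumes one value of `s` and doubles the degree, whence the ranges `S + n`
    -- and the factor `2 ^ n`. By induction all eliminated coefficients vanish. If the last
    -- coefficient is nonzero, the leading coefficients then force the other ones to be zero, and a
    -- single term remains: a polynomial with `R * S` distinct zeros. The weights `ω t l` of
    -- different blocks `t` need no relation, since elimination takes place inside a block.
    expSum-zero : ∀ n (μ≢ : ∀ l l′ → l < l′ → l′ < n → μ l ≢ μ l′) (D : ℕ) (P : ℕ → ℕ → ℤ) →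
      (∀ l → l < n → Degree≤ D (P l)) →
      (∀ t → X t + (S + n) ≤ X (suc t)) →
      2 ^ n * D < R * S →
      (∀ t s → t < R → s < S + n → expSum P n t s ≡ 0ℤ) →
      ∀ l → l < n → ∀ x → P l x ≡ 0ℤ
    expSum-zero (suc n) μ≢ D P deg gap D<RS vanish l (s≤s l≤n) with deg n (n<1+n n)
    ... | inj₁ Pn≡0 = go (m≤n⇒m<n∨m≡n l≤n)
      where
      drop : ∀ t s → expSum P (suc n) t s ≡ expSum P n t s
      drop t s = trans (cong (λ u → expSum P n t s +ᶻ u *ᶻ (μ n ^ᶻ s) *ᶻ ω t n) (Pn≡0 _)) (ℤP.+-identityʳ _)
      go : l < n ⊎ l ≡ n → ∀ x → P l x ≡ 0ℤ
      go (inj₂ refl) = Pn≡0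
      go (inj₁ l<n)  = expSum-zero n (λ i j i<j j<n → μ≢ i j i<j (m<n⇒m<1+n j<n)) D P
        (λ i i<n → deg i (m<n⇒m<1+n i<n))
        (λ t → ≤-trans (+-monoʳ-≤ (X t) (+-monoʳ-≤ S (n≤1+n n))) (gap t))
        (≤-<-trans (*-monoˡ-≤ D (^-monoʳ-≤ 2 (n≤1+n n))) D<RS)
        (λ t s t<R s< → trans (sym (drop t s)) (vanish t s t<R (<-≤-trans s< (+-monoʳ-≤ S (n≤1+n n)))))
        l l<n
    ... | inj₂ (d , d≤D , c , c≢0 , p) = ⊥-elim (Pn≢0 (Degree≤-grid R S X
        (λ t → ≤-trans (+-monoʳ-≤ (X t) (m≤m+n S (suc n))) (gap t))
        (≤-<-trans (m≤m*n′ D) D<RS) (deg n (n<1+n n)) last-vanish))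
      where
      m≤m*n′ : ∀ D → D ≤ 2 ^ suc n * D
      m≤m*n′ D = m≤n*m D (2 ^ suc n) {{m^n≢0 2 (suc n)}}
      Pn≢0 : ¬ (∀ x → P n x ≡ 0ℤ)
      Pn≢0 z = poly-roots d p c≢0 (λ i → i) (λ i j lt → lt) (λ i _ → z i)
      elim-deg : ∀ i → i < n → Degree≤ (2 * D) (eliminate P μ n i)
      elim-deg i i<n with deg i (m<n⇒m<1+n i<n)
      ... | inj₁ z = inj₁ λ x → trans (cong₂ (λ a b → μ n *ᶻ P n (suc x) *ᶻ a -ᶻ μ i *ᶻ P n x *ᶻ b) (z x) (z (suc x))) (lem (μ n *ᶻ P n (suc x)) (μ i *ᶻ P n x))
        where
        lem : ∀ a b → a *ᶻ 0ℤ -ᶻ b *ᶻ 0ℤ ≡ 0ℤ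
        lem = ℤRS.solve-∀
      ... | inj₂ (e , e≤D , c′ , c′≢0 , q) = inj₂ (d + e , ≤-trans (+-mono-≤ d≤D e≤D) (≤-reflexive (cong (D +_) (sym (+-identityʳ D)))) , _ ,
        *ᶻ-≢0 (λ eq → μ≢ i n i<n (n<1+n n) (sym (ℤP.i-j≡0⇒i≡j _ _ eq))) (*ᶻ-≢0 c≢0 c′≢0) , eliminate-poly P n i p q)
      elim-zero : ∀ i → i < n → ∀ x → eliminate P μ n i x ≡ 0ℤ
      elim-zero = expSum-zero n (λ i j i<j j<n → μ≢ i j i<j (m<n⇒m<1+n j<n)) (2 * D) (eliminate P μ n) elim-deg
        (λ t → ≤-trans (+-monoʳ-≤ (X t) (+-monoʳ-≤ S (n≤1+n n))) (gap t))
        (subst (_< R * S) (lem (2 ^ n) D) D<RS)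
        (λ t s t<R s< → eliminate-vanish P n t s (vanish t s t<R (<-≤-trans s< (+-monoʳ-≤ S (n≤1+n n))))
          (vanish t (suc s) t<R (subst (suc s <_) (sym (+-suc S n)) (s≤s s<))))
        where
        lem : ∀ a D → 2 * a * D ≡ a * (2 * D)
        lem = solve-∀
      others-zero : ∀ i → i < n → ∀ x → P i x ≡ 0ℤ
      others-zero i i<n with deg i (m<n⇒m<1+n i<n)
      ... | inj₁ z = z
      ... | inj₂ (e , e≤D , c′ , c′≢0 , q) = ⊥-elim (poly-roots (d + e) (eliminate-poly P n i p q)
        (*ᶻ-≢0 (λ eq → μ≢ i n i<n (n<1+n n) (sym (ℤP.i-j≡0⇒i≡j _ _ eq))) (*ᶻ-≢0 c≢0 c′≢0))
        (λ i → i) (λ i j lt → lt) (λ k _ → elim-zero i i<n k))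
      sum-zero : ∀ m → m ≤ n → ∀ t s → expSum P m t s ≡ 0ℤ
      sum-zero zero    _   t s = refl
      sum-zero (suc m) m<n t s = cong₂ (λ a b → a +ᶻ b *ᶻ (μ m ^ᶻ s) *ᶻ ω t m) (sum-zero m (<⇒≤ m<n) t s) (others-zero m m<n (X t + s))
      last-vanish : ∀ t s → t < R → s < S → P n (X t + s) ≡ 0ℤ
      last-vanish t s t<R s<S = *ᶻ-cancel-≢0 {ω t n *ᶻ (μ n ^ᶻ s)} (*ᶻ-≢0 (ω≢0 t n) (^ᶻ-≢0 (μ≢0 n) s))
        (trans (lem (ω t n) (μ n ^ᶻ s) (P n (X t + s)))
          (trans (cong (_+ᶻ (P n (X t + s) *ᶻ (μ n ^ᶻ s) *ᶻ ω t n)) (sym (sum-zero n ≤-refl t s))) (vanish t s t<R (<-≤-trans s<S (m≤m+n S (suc n))))))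
        where
        lem : ∀ w u p → w *ᶻ u *ᶻ p ≡ 0ℤ +ᶻ p *ᶻ u *ᶻ w
        lem = ℤRS.solve-∀

-- Binomial polynomials and the auxiliary function.

-- These are the falling factorials, each being `x - k` times its predecessor; the factor `k !`
-- keeps the coefficients integral.
fall-poly : ∀ k → Poly k 1ℤ (λ x → pos (k ! * bin x k))
fall-poly zero    x = refl
fall-poly (suc k) =
  poly-ext (suc k) (λ x → sym (eq x))
    (poly-lead (suc k) (cong (1ℤ +ᶻ_) (ℤP.*-zeroʳ (-ᶻ pos k)))
      (poly-+ (suc k) (poly-x* k (fall-poly k)) (poly-scale (suc k) (-ᶻ pos k) (poly-raise k (fall-poly k)))))
  where
  eqℕ : ∀ x → suc k ! * bin x (suc k) + k * (k ! * bin x k) ≡ x * (k ! * bin x k)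
  eqℕ x = trans (lem₁ k (k !) (bin x (suc k)) (bin x k)) (trans (cong (k ! *_) (bin-absorb x k)) (lem₂ (k !) x (bin x k)))
    where
    lem₁ : ∀ k f a b → suc k * f * a + k * (f * b) ≡ f * (suc k * a + k * b)
    lem₁ = solve-∀
    lem₂ : ∀ f x b → f * (x * b) ≡ x * (f * b)
    lem₂ = solve-∀
  cancel : ∀ a b → a ≡ (a +ᶻ b) -ᶻ b
  cancel = ℤRS.solve-∀
  eq : ∀ x → pos (suc k ! * bin x (suc k)) ≡ pos x *ᶻ pos (k ! * bin x k) +ᶻ (-ᶻ pos k) *ᶻ pos (k ! * bin x k)
  eq x = begin
    pos f′                        ≡⟨ cancel (pos f′) (pos (k * f)) ⟩
    pos (f′ + k * f) -ᶻ pos (k * f) ≡⟨ cong₂ _-ᶻ_ (cong pos (eqℕ x)) (ℤP.pos-* k f) ⟩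
    pos (x * f) -ᶻ pos k *ᶻ pos f ≡⟨ cong₂ _+ᶻ_ (ℤP.pos-* x f) (ℤP.neg-distribˡ-* (pos k) (pos f)) ⟩
    pos x *ᶻ pos f +ᶻ (-ᶻ pos k) *ᶻ pos f ∎
    where
    open ≡-Reasoning
    f  = k ! * bin x k
    f′ = suc k ! * bin x (suc k)

binSum : ℕ → (ℕ → ℤ) → ℕ → ℤ
binSum K p x = Σᶻ.sum K (λ k → p k *ᶻ pos (bin x k))

binSum-suc : ∀ K p x → pos (suc K !) *ᶻ binSum (suc K) p x ≡
  pos (suc K) *ᶻ (pos (K !) *ᶻ binSum K p x) +ᶻ (pos (suc K) *ᶻ p K) *ᶻ pos (K ! * bin x K)
binSum-suc K p x = trans (cong₂ _*ᶻ_ (ℤP.pos-* (suc K) (K !)) refl)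
  (trans (lem (pos (suc K)) (pos (K !)) (binSum K p x) (p K) (pos (bin x K)))
    (cong (λ u → pos (suc K) *ᶻ (pos (K !) *ᶻ binSum K p x) +ᶻ (pos (suc K) *ᶻ p K) *ᶻ u) (sym (ℤP.pos-* (K !) (bin x K)))))
  where
  lem : ∀ s f B a b → (s *ᶻ f) *ᶻ (B +ᶻ a *ᶻ b) ≡ s *ᶻ (f *ᶻ B) +ᶻ (s *ᶻ a) *ᶻ (f *ᶻ b)
  lem = ℤRS.solve-∀

binSum-poly : ∀ K p → Poly K 0ℤ (λ x → pos (K !) *ᶻ binSum K p x)
binSum-poly zero    p x = refl
binSum-poly (suc K) p = poly-ext (suc K) (λ x → sym (binSum-suc K p x))
  (poly-+ (suc K) (poly-raise K (poly-scale K (pos (suc K)) (binSum-poly K p)))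
                  (poly-raise K (poly-scale K (pos (suc K) *ᶻ p K) (fall-poly K))))

-- The falling factorials are monic of distinct degrees, so the last nonzero `p k` survives in the
-- leading coefficient. This also serves to return from vanishing polynomials to vanishing
-- coefficients.
binSum-degree : ∀ K p → (∀ k → k < K → p k ≡ 0ℤ) ⊎
  (Σ ℕ λ d → d ≤ K × Σ ℤ λ c → c ≢ 0ℤ × Poly d c (λ x → pos (K !) *ᶻ binSum K p x))
binSum-degree zero    p = inj₁ λ _ ()
binSum-degree (suc K) p with p K ℤP.≟ 0ℤ
... | no pK≢0 = inj₂ (K , n≤1+n K , _ , lead≢0 ,
  poly-ext K (λ x → sym (binSum-suc K p x))
    (poly-+ K (poly-scale K (pos (suc K)) (binSum-poly K p)) (poly-scale K (pos (suc K) *ᶻ p K) (fall-poly K))))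
  where
  lead≢0 : pos (suc K) *ᶻ 0ℤ +ᶻ (pos (suc K) *ᶻ p K) *ᶻ 1ℤ ≢ 0ℤ
  lead≢0 e = *ᶻ-≢0 {pos (suc K)} (λ ()) pK≢0 (trans (sym (lem (pos (suc K)) (p K))) e)
    where
    lem : ∀ s a → s *ᶻ 0ℤ +ᶻ (s *ᶻ a) *ᶻ 1ℤ ≡ s *ᶻ a
    lem = ℤRS.solve-∀
... | yes pK≡0 with binSum-degree K p
...   | inj₁ z = inj₁ λ k k<1+K → go k (m≤n⇒m<n∨m≡n (s≤s⁻¹ k<1+K))
  where
  go : ∀ k → k < K ⊎ k ≡ K → p k ≡ 0ℤ
  go k (inj₁ lt)   = z k lt
  go k (inj₂ refl) = pK≡0
...   | inj₂ (d , d≤K , c , c≢0 , q) = inj₂ (d , m≤n⇒m≤1+n d≤K , _ , *ᶻ-≢0 {pos (suc K)} (λ ()) c≢0 ,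
  poly-ext d (λ x → sym (trans (binSum-suc K p x) (trans (cong (λ u → pos (suc K) *ᶻ (pos (K !) *ᶻ binSum K p x) +ᶻ (pos (suc K) *ᶻ u) *ᶻ pos (K ! * bin x K)) pK≡0) (lem (pos (suc K)) _ (pos (K ! * bin x K))))))
    (poly-scale d (pos (suc K)) q))
  where
  lem : ∀ s B f → s *ᶻ B +ᶻ (s *ᶻ 0ℤ) *ᶻ f ≡ s *ᶻ B
  lem = ℤRS.solve-∀

[l*K+k]mod : ∀ l {K k} .{{_ : NonZero K}} → k < K → (l * K + k) mod K ≡ k
[l*K+k]mod l {K} {k} k<K = trans (cong (_mod K) (+-comm (l * K) k)) (trans ([m+kn]%n≡m%n k l K) (m<n⇒m%n≡m k<K))

[l*K+k]div : ∀ l {K k} .{{_ : NonZero K}} → k < K → (l * K + k) div K ≡ l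
[l*K+k]div l {K} {k} k<K = trans (+-distrib-/-∣ˡ k (ℕ∣.divides l refl))
  (trans (cong₂ _+_ (m*n/n≡m l K) (m<n⇒m/n≡0 k<K)) (+-identityʳ l))

module _ (L K : ℕ) .{{_ : NonZero K}} (μ : ℕ → ℤ) (ω : ℕ → ℕ → ℤ) (X : ℕ → ℕ) where

  auxiliary : (ℕ → ℤ) → ℕ → ℕ → ℤ
  auxiliary p t s = Σᶻ.sum (L * K) (λ j → p j *ᶻ pos (bin (X t + s) (j mod K)) *ᶻ (μ (j div K) ^ᶻ s) *ᶻ ω t (j div K))

  private
    P : (ℕ → ℤ) → ℕ → ℕ → ℤ
    P p l x = pos (K !) *ᶻ binSum K (λ k → p (l * K + k)) x

    expSum-auxiliary : ∀ p t s → expSum μ ω X (P p) L t s ≡ pos (K !) *ᶻ auxiliary p t s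
    expSum-auxiliary p t s = begin
      expSum μ ω X (P p) L t s
        ≡⟨ Σᶻ.sum-cong L (λ l _ → inner l) ⟩
      Σᶻ.sum L (λ l → pos (K !) *ᶻ Σᶻ.sum K (λ k → term (l * K + k)))
        ≡⟨ Σᶻ.sum-distribˡ-⊗ L (pos (K !)) (λ l → Σᶻ.sum K (λ k → term (l * K + k))) ⟨
      pos (K !) *ᶻ Σᶻ.sum L (λ l → Σᶻ.sum K (λ k → term (l * K + k)))
        ≡⟨ cong (pos (K !) *ᶻ_) (Σᶻ.sum-* L K term) ⟨
      pos (K !) *ᶻ auxiliary p t s ∎
      where
      open ≡-Reasoning
      term : ℕ → ℤ
      term j = p j *ᶻ pos (bin (X t + s) (j mod K)) *ᶻ (μ (j div K) ^ᶻ s) *ᶻ ω t (j div K)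
      lem : ∀ f b m w → f *ᶻ b *ᶻ m *ᶻ w ≡ f *ᶻ ((m *ᶻ w) *ᶻ b)
      lem = ℤRS.solve-∀
      lem₂ : ∀ m w p b → (m *ᶻ w) *ᶻ (p *ᶻ b) ≡ p *ᶻ b *ᶻ m *ᶻ w
      lem₂ = ℤRS.solve-∀
      inner : ∀ l → P p l (X t + s) *ᶻ (μ l ^ᶻ s) *ᶻ ω t l ≡ pos (K !) *ᶻ Σᶻ.sum K (λ k → term (l * K + k))
      inner l = trans (lem (pos (K !)) (binSum K (λ k → p (l * K + k)) (X t + s)) (μ l ^ᶻ s) (ω t l))
        (cong (pos (K !) *ᶻ_) (trans (Σᶻ.sum-distribˡ-⊗ K ((μ l ^ᶻ s) *ᶻ ω t l) (λ k → p (l * K + k) *ᶻ pos (bin (X t + s) k)))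
          (Σᶻ.sum-cong K λ k k<K → trans (lem₂ (μ l ^ᶻ s) (ω t l) (p (l * K + k)) (pos (bin (X t + s) k)))
            (cong₂ (λ a b → p (l * K + k) *ᶻ pos (bin (X t + s) a) *ᶻ (μ b ^ᶻ s) *ᶻ ω t b)
              (sym ([l*K+k]mod l k<K)) (sym ([l*K+k]div l k<K))))))

  -- Multiplication by `K !` turns the auxiliary function into an exponential sum with integral
  -- polynomial coefficients, to which the zero estimate applies.
  auxiliary-zero : (∀ l → μ l ≢ 0ℤ) → (∀ t l → ω t l ≢ 0ℤ) →
    (∀ l l′ → l < l′ → l′ < L → μ l ≢ μ l′) → ∀ R S →
    (∀ t → X t + (S + L) ≤ X (suc t)) → 2 ^ L * K < R * S →
    ∀ p → (∀ t s → t < R → s < S + L → auxiliary p t s ≡ 0ℤ) →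
    ∀ j → j < L * K → p j ≡ 0ℤ
  auxiliary-zero μ≢0 ω≢0 μ≢ R S gap big p vanish j j<LK =
    subst (λ i → p i ≡ 0ℤ) (trans (+-comm (j div K * K) (j mod K)) (sym (m≡m%n+[m/n]*n j K)))
      (coeff (j div K) (m<n*o⇒m/o<n j<LK) (j mod K) (m%n<n j K))
    where
    degree : ∀ l → Degree≤ K (P p l)
    degree l with binSum-degree K (λ k → p (l * K + k))
    ... | inj₁ z = inj₁ λ x → trans (cong (pos (K !) *ᶻ_) (zero-sum K (λ k k<K → cong (_*ᶻ pos (bin x k)) (z k k<K)))) (ℤP.*-zeroʳ (pos (K !)))
      where
      zero-sum : ∀ n {f} → (∀ i → i < n → f i ≡ 0ℤ) → Σᶻ.sum n f ≡ 0ℤ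
      zero-sum zero    e = refl
      zero-sum (suc n) e = cong₂ _+ᶻ_ (zero-sum n (λ i i<n → e i (m<n⇒m<1+n i<n))) (e n (n<1+n n))
    ... | inj₂ q = inj₂ q
    all-zero : ∀ l → l < L → ∀ x → P p l x ≡ 0ℤ
    all-zero = expSum-zero μ ω X μ≢0 ω≢0 R S L μ≢ K (P p) (λ l _ → degree l) gap big
      (λ t s t<R s< → trans (expSum-auxiliary p t s) (trans (cong (pos (K !) *ᶻ_) (vanish t s t<R s<)) (ℤP.*-zeroʳ (pos (K !)))))
    coeff : ∀ l → l < L → ∀ k → k < K → p (l * K + k) ≡ 0ℤ
    coeff l l<L with binSum-degree K (λ k → p (l * K + k))
    ... | inj₁ z = z
    ... | inj₂ (d , _ , c , c≢0 , q) = ⊥-elim (poly-roots d q c≢0 (λ i → i) (λ _ _ lt → lt) (λ i _ → all-zero l l<L i))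

-- The pigeonhole principle for coefficient vectors.

extend : ∀ {n} → (Fin n → ℕ) → ℕ → ℕ
extend {n} f j with j <? n
... | yes j<n = f (fromℕ< j<n)
... | no  _   = 0

extend-toℕ : ∀ {n} (f : Fin n → ℕ) i → extend f (toℕ i) ≡ f i
extend-toℕ {n} f i with toℕ i <? n
... | yes lt = cong f (FP.fromℕ<-toℕ i lt)
... | no ¬lt = ⊥-elim (¬lt (FP.toℕ<n i))

funToFin-cong : ∀ {m k} {f g : Fin m → Fin k} → (∀ i → f i ≡ g i) → funToFin f ≡ funToFin g
funToFin-cong {zero}  e = refl
funToFin-cong {suc m} e = cong₂ Data.Fin.combine (e Fin.zero) (funToFin-cong (e ∘ Fin.suc))

module _ (n B I M : ℕ) (class : (ℕ → ℕ) → ℕ → ℕ)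
  (bound : ∀ p → (∀ j → j < n → p j < B) → ∀ i → i < I → class p i < M) where

  private
    family : Fin (B ^ n) → ℕ → ℕ
    family v = extend (toℕ ∘ finToFun {B} {n} v)

    family-< : ∀ v j → j < n → family v j < B
    family-< v j j<n = subst (λ k → family v k < B) (FP.toℕ-fromℕ< j<n)
      (subst (_< B) (sym (extend-toℕ (toℕ ∘ finToFun {B} {n} v) (fromℕ< j<n))) (FP.toℕ<n _))

    classFin : Fin (B ^ n) → Fin I → Fin M
    classFin v i = fromℕ< (bound (family v) (family-< v) (toℕ i) (FP.toℕ<n i))

  -- Two vectors are returned and not their difference because a class need not be additive: it is a
  -- remainder in the 2-adic case and a quotient in the real case.
  pigeonhole-family : M ^ I < B ^ n →
    Σ (ℕ → ℕ) λ p → Σ (ℕ → ℕ) λ p′ →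
      (∀ j → j < n → p j < B) × (∀ j → j < n → p′ j < B) ×
      (Σ ℕ λ j → j < n × p j ≢ p′ j) × (∀ i → i < I → class p i ≡ class p′ i)
  pigeonhole-family big with FP.pigeonhole big (funToFin ∘ classFin)
  ... | v , v′ , v<v′ , eq = family v , family v′ , family-< v , family-< v′ , differ , agree
    where
    agreeFin : ∀ i → class (family v) (toℕ i) ≡ class (family v′) (toℕ i)
    agreeFin i = trans (sym (FP.toℕ-fromℕ< _)) (trans (cong toℕ
      (trans (sym (FP.finToFun-funToFin (classFin v) i)) (trans (cong (λ c → finToFun {M} {I} c i) eq) (FP.finToFun-funToFin (classFin v′) i)))) (FP.toℕ-fromℕ< _))
    agree : ∀ i → i < I → class (family v) i ≡ class (family v′) i
    agree i i<I = subst (λ k → class (family v) k ≡ class (family v′) k) (FP.toℕ-fromℕ< i<I) (agreeFin (fromℕ< i<I))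
    differ : Σ ℕ λ j → j < n × family v j ≢ family v′ j
    differ with FP.all? (λ j → finToFun {B} {n} v j FP.≟ finToFun {B} {n} v′ j)
    ... | yes same = ⊥-elim (<⇒≢ v<v′ (cong toℕ (trans (sym (FP.funToFin-finToFin {n} {B} v)) (trans (funToFin-cong same) (FP.funToFin-finToFin {n} {B} v′)))))
    ... | no ¬same with FP.¬∀⟶∃¬ n _ (λ j → finToFun {B} {n} v j FP.≟ finToFun {B} {n} v′ j) ¬same
    ...   | j , ne = toℕ j , FP.toℕ<n j , λ e → ne (FP.toℕ-injective (trans (sym (extend-toℕ _ j)) (trans e (extend-toℕ _ j))))

-- Congruences and sizes of differences.

pos-^ : ∀ a n → pos a ^ᶻ n ≡ pos (a ^ n)
pos-^ a zero    = refl
pos-^ a (suc n) = trans (cong (pos a *ᶻ_) (pos-^ a n)) (sym (ℤP.pos-* a (a ^ n)))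

*-^ : ∀ a b n → (a * b) ^ n ≡ a ^ n * b ^ n
*-^ a b zero    = refl
*-^ a b (suc n) = trans (cong (a * b *_) (*-^ a b n)) (lem a b (a ^ n) (b ^ n))
  where
  lem : ∀ a b x y → a * b * (x * y) ≡ a * x * (b * y)
  lem = solve-∀

≢0⇒pos≢0 : ∀ {n} → n ≢ 0 → pos n ≢ 0ℤ
≢0⇒pos≢0 n≢0 refl = n≢0 refl

∣pos-pos∣≤⊔ : ∀ a b → ∣ pos a -ᶻ pos b ∣ ≤ a ⊔ b
∣pos-pos∣≤⊔ a b = subst (λ z → ∣ z ∣ ≤ a ⊔ b) (sym (ℤP.[+m]-[+n]≡m⊖n a b)) (ℤP.∣m⊝n∣≤m⊔n a b)

∣pos-pos∣≤ : ∀ {a b c} → a ≤ c → b ≤ c → ∣ pos a -ᶻ pos b ∣ ≤ c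
∣pos-pos∣≤ {a} {b} a≤c b≤c = ≤-trans (∣pos-pos∣≤⊔ a b) (⊔-lub a≤c b≤c)

∣i*pos∣ : ∀ i n → ∣ i *ᶻ pos n ∣ ≡ ∣ i ∣ * n
∣i*pos∣ i n = ℤP.∣i*j∣≡∣i∣*∣j∣ i (pos n)

mod-≡⇒∣ : ∀ a b m .{{_ : NonZero m}} → a mod m ≡ b mod m → pos m ℤ∣.∣ (pos a -ᶻ pos b)
mod-≡⇒∣ a b m eq = ℤ∣.divides (pos (a div m) -ᶻ pos (b div m)) (begin
  pos a -ᶻ pos b
    ≡⟨ cong₂ (λ u v → pos u -ᶻ pos v) (m≡m%n+[m/n]*n a m) (m≡m%n+[m/n]*n b m) ⟩
  pos (a mod m + a div m * m) -ᶻ pos (b mod m + b div m * m)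
    ≡⟨ cong₂ (λ u v → u -ᶻ v) (expand (a mod m) (a div m)) (expand (b mod m) (b div m)) ⟩
  (pos (a mod m) +ᶻ pos (a div m) *ᶻ pos m) -ᶻ (pos (b mod m) +ᶻ pos (b div m) *ᶻ pos m)
    ≡⟨ cong (λ r → (pos r +ᶻ pos (a div m) *ᶻ pos m) -ᶻ (pos (b mod m) +ᶻ pos (b div m) *ᶻ pos m)) eq ⟩
  (pos (b mod m) +ᶻ pos (a div m) *ᶻ pos m) -ᶻ (pos (b mod m) +ᶻ pos (b div m) *ᶻ pos m)
    ≡⟨ lem (pos (b mod m)) (pos (a div m)) (pos (b div m)) (pos m) ⟩
  (pos (a div m) -ᶻ pos (b div m)) *ᶻ pos m ∎)
  where
  open ≡-Reasoning
  expand : ∀ r q → pos (r + q * m) ≡ pos r +ᶻ pos q *ᶻ pos m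
  expand r q = trans (ℤP.pos-+ r (q * m)) (cong (pos r +ᶻ_) (ℤP.pos-* q m))
  lem : ∀ r u v m → (r +ᶻ u *ᶻ m) -ᶻ (r +ᶻ v *ᶻ m) ≡ (u -ᶻ v) *ᶻ m
  lem = ℤRS.solve-∀

div-≡⇒∣-∣≤ : ∀ a b m .{{_ : NonZero m}} → a div m ≡ b div m → ∣ pos a -ᶻ pos b ∣ ≤ m
div-≡⇒∣-∣≤ a b m eq = subst (λ z → ∣ z ∣ ≤ m) (sym (begin
  pos a -ᶻ pos b
    ≡⟨ cong₂ (λ u v → pos u -ᶻ pos v) (m≡m%n+[m/n]*n a m) (m≡m%n+[m/n]*n b m) ⟩
  pos (a mod m + a div m * m) -ᶻ pos (b mod m + b div m * m)
    ≡⟨ cong (λ q → pos (a mod m + q * m) -ᶻ pos (b mod m + b div m * m)) eq ⟩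
  pos (a mod m + b div m * m) -ᶻ pos (b mod m + b div m * m)
    ≡⟨ cong₂ (λ u v → u -ᶻ v) (ℤP.pos-+ (a mod m) _) (ℤP.pos-+ (b mod m) _) ⟩
  (pos (a mod m) +ᶻ pos (b div m * m)) -ᶻ (pos (b mod m) +ᶻ pos (b div m * m))
    ≡⟨ lem (pos (a mod m)) (pos (b mod m)) (pos (b div m * m)) ⟩
  pos (a mod m) -ᶻ pos (b mod m) ∎))
  (∣pos-pos∣≤ (<⇒≤ (m%n<n a m)) (<⇒≤ (m%n<n b m)))
  where
  open ≡-Reasoning
  lem : ∀ r s q → (r +ᶻ q) -ᶻ (s +ᶻ q) ≡ r -ᶻ s
  lem = ℤRS.solve-∀

sum-∣ : ∀ {m} n {f} → (∀ i → i < n → m ℤ∣.∣ f i) → m ℤ∣.∣ Σᶻ.sum n f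
sum-∣ zero    d = ℤ∣.divides 0ℤ refl
sum-∣ (suc n) d = ℤ∣.∣m∣n⇒∣m+n (sum-∣ n (λ i i<n → d i (m<n⇒m<1+n i<n))) (d n (n<1+n n))

newton-∣ : ∀ {m} w x {h} → (∀ i → m ℤ∣.∣ h i) → m ℤ∣.∣ Σᶻ.newton w x h
newton-∣ w zero    d = d 0
newton-∣ w (suc x) d = ℤ∣.∣m∣n⇒∣m+n (ℤ∣.∣n⇒∣m*n w (newton-∣ w x d)) (newton-∣ w x (d ∘ suc))

-- This plays the part of Liouville's inequality in the 2-adic case.
∣∧<⇒≡0 : ∀ {m z} → pos m ℤ∣.∣ z → ∣ z ∣ < m → z ≡ 0ℤ
∣∧<⇒≡0 {m} {z} m∣z z<m with ∣ z ∣ in eq | ℤ∣.∣⇒∣ᵤ m∣z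
... | zero  | _ = ℤP.∣i∣≡0⇒i≡0 eq
... | suc k | d = ⊥-elim (<⇒≱ z<m (ℕ∣.∣⇒≤ d))

-- The part of the argument common to both absolute values.

-- The points are (X t + s, ζ) with t < R and s < S + L; the l-th power of ζ is carried
-- as μ l ^ s * ω t l up to a factor independent of l, so that no denominators occur.  The index
-- j < L * K encodes the monomial binom(x, j mod K) z^(j div K).
module Core (L K : ℕ) .{{_ : NonZero K}} (w : ℕ) (d : ℕ → ℕ) (ω : ℕ → ℕ → ℕ) (X : ℕ → ℕ) (R S : ℕ)
  (w≢0 : w ≢ 0) (ω≢0 : ∀ t l → ω t l ≢ 0)
  (d≢ : ∀ l l′ → l < l′ → l′ < L → d l ≢ d l′)
  (gap : ∀ t → X t + (S + L) ≤ X (suc t)) (big : 2 ^ L * K < R * S) where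

  μ : ℕ → ℕ
  μ l = w + d l

  n : ℕ
  n = L * K

  coef : ℕ → ℕ → ℕ
  coef j = shape (μ (j div K)) (d (j div K)) (j mod K)

  coefSum : (ℕ → ℕ) → ℕ → ℕ
  coefSum P i = Σℕ.sum n (λ j → P j * coef j i)

  -- F is aux with ω t l replaced by its approximation μ l ^ X t.
  F : (ℕ → ℤ) → ℕ → ℤ
  F p x = Σᶻ.sum n (λ j → p j *ᶻ pos (bin x (j mod K) * μ (j div K) ^ x))

  c : (ℕ → ℤ) → ℕ → ℤ
  c p i = Σᶻ.sum n (λ j → p j *ᶻ pos (coef j i))

  F-newton : ∀ p x → F p x ≡ Σᶻ.newton (pos w) x (c p)
  F-newton p x = sym (trans (Σᶻ.newton-sum (pos w) x n p (λ j i → pos (coef j i)))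
    (Σᶻ.sum-cong n λ j _ → cong (p j *ᶻ_) (trans (sym (newton-pos w x (coef j)))
      (cong pos (trans (newton-shape w (d (j div K)) (μ (j div K)) (j mod K) x) (shape-diag (μ (j div K)) (j mod K) x))))))

  auxCoef : ℕ → ℕ → ℕ → ℕ
  auxCoef t s j = bin (X t + s) (j mod K) * μ (j div K) ^ s

  aux : (ℕ → ℤ) → ℕ → ℕ → ℤ
  aux p t s = Σᶻ.sum n (λ j → p j *ᶻ pos (auxCoef t s j * ω t (j div K)))

  auxiliary≡aux : ∀ p t s → auxiliary L K (pos ∘ μ) (λ t l → pos (ω t l)) X p t s ≡ aux p t s
  auxiliary≡aux p t s = Σᶻ.sum-cong n λ j _ → begin
    p j *ᶻ pos (b j) *ᶻ (pos (μ (j div K)) ^ᶻ s) *ᶻ pos (ω t (j div K))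
      ≡⟨ cong (λ u → p j *ᶻ pos (b j) *ᶻ u *ᶻ pos (ω t (j div K))) (pos-^ (μ (j div K)) s) ⟩
    p j *ᶻ pos (b j) *ᶻ pos (μ (j div K) ^ s) *ᶻ pos (ω t (j div K))
      ≡⟨ lem (p j) (pos (b j)) (pos (μ (j div K) ^ s)) (pos (ω t (j div K))) ⟩
    p j *ᶻ (pos (b j) *ᶻ pos (μ (j div K) ^ s) *ᶻ pos (ω t (j div K)))
      ≡⟨ cong (p j *ᶻ_) (trans (cong (_*ᶻ pos (ω t (j div K))) (sym (ℤP.pos-* (b j) _))) (sym (ℤP.pos-* (auxCoef t s j) _))) ⟩
    p j *ᶻ pos (auxCoef t s j * ω t (j div K)) ∎
    where
    open ≡-Reasoning
    b : ℕ → ℕ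
    b j = bin (X t + s) (j mod K)
    lem : ∀ p b m w → p *ᶻ b *ᶻ m *ᶻ w ≡ p *ᶻ (b *ᶻ m *ᶻ w)
    lem = ℤRS.solve-∀

  diff : (ℕ → ℕ) → (ℕ → ℕ) → ℕ → ℤ
  diff P P′ j = pos (P j) -ᶻ pos (P′ j)

  c-diff : ∀ P P′ i → c (diff P P′) i ≡ pos (coefSum P i) -ᶻ pos (coefSum P′ i)
  c-diff P P′ i = begin
    c (diff P P′) i
      ≡⟨ Σᶻ.sum-cong n (λ j _ → trans (lem (pos (P j)) (pos (P′ j)) (pos (coef j i)))
           (cong₂ (λ a b → a +ᶻ -ᶻ 1ℤ *ᶻ b) (sym (ℤP.pos-* (P j) (coef j i))) (sym (ℤP.pos-* (P′ j) (coef j i))))) ⟩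
    Σᶻ.sum n (λ j → pos (P j * coef j i) +ᶻ -ᶻ 1ℤ *ᶻ pos (P′ j * coef j i))
      ≡⟨ Σᶻ.sum-distrib-⊕ n (λ j → pos (P j * coef j i)) (λ j → -ᶻ 1ℤ *ᶻ pos (P′ j * coef j i)) ⟩
    Σᶻ.sum n (λ j → pos (P j * coef j i)) +ᶻ Σᶻ.sum n (λ j → -ᶻ 1ℤ *ᶻ pos (P′ j * coef j i))
      ≡⟨ cong₂ _+ᶻ_ (sym (sum-pos n (λ j → P j * coef j i)))
           (trans (sym (Σᶻ.sum-distribˡ-⊗ n (-ᶻ 1ℤ) (λ j → pos (P′ j * coef j i)))) (cong (-ᶻ 1ℤ *ᶻ_) (sym (sum-pos n (λ j → P′ j * coef j i))))) ⟩
    pos (coefSum P i) +ᶻ -ᶻ 1ℤ *ᶻ pos (coefSum P′ i)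
      ≡⟨ cong (pos (coefSum P i) +ᶻ_) (ℤP.-1*i≡-i (pos (coefSum P′ i))) ⟩
    pos (coefSum P i) -ᶻ pos (coefSum P′ i) ∎
    where
    open ≡-Reasoning
    lem : ∀ a b c → (a -ᶻ b) *ᶻ c ≡ a *ᶻ c +ᶻ -ᶻ 1ℤ *ᶻ (b *ᶻ c)
    lem = ℤRS.solve-∀

  aux-vanish⇒⊥ : ∀ P P′ → (Σ ℕ λ j → j < n × P j ≢ P′ j) →
    ¬ (∀ t s → t < R → s < S + L → aux (diff P P′) t s ≡ 0ℤ)
  aux-vanish⇒⊥ P P′ (j , j<n , ne) vanish = ne (ℤP.+-injective (ℤP.i-j≡0⇒i≡j _ _
    (auxiliary-zero L K (pos ∘ μ) (λ t l → pos (ω t l)) X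
      (λ l → ≢0⇒pos≢0 (λ e → w≢0 (m+n≡0⇒m≡0 w e)))
      (λ t l → ≢0⇒pos≢0 (ω≢0 t l))
      (λ l l′ l<l′ l′<L e → d≢ l l′ l<l′ l′<L (+-cancelˡ-≡ w _ _ (ℤP.+-injective e)))
      R S gap big (diff P P′)
      (λ t s t<R s< → trans (auxiliary≡aux (diff P P′) t s) (vanish t s t<R s<)) j j<n)))

  ∣aux∣≤ : ∀ p B t s → (∀ j → j < n → ∣ p j ∣ ≤ B) → ∀ A → (∀ j → j < n → auxCoef t s j * ω t (j div K) ≤ A) →
    ∣ aux p t s ∣ ≤ n * (B * A)
  ∣aux∣≤ p B t s pB A a≤A = ≤-trans (∣sum∣≤ n _) (sum-≤ n (B * A) λ j j<n →
    ≤-trans (≤-reflexive (∣i*pos∣ (p j) _)) (*-mono-≤ (pB j j<n) (a≤A j j<n)))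

  -- Replacing `W * ω t l` by `Ω * μ l ^ X t` turns the sum into a multiple of `F`, because `Ω` does
  -- not depend on `l`. The multiplier `W` clears denominators: it is 1 in the 2-adic case and
  -- `w ^ X t` in the real case.
  aux-compare : ∀ p t s (W Ω : ℕ) →
    pos W *ᶻ aux p t s ≡
    pos Ω *ᶻ F p (X t + s) +ᶻ Σᶻ.sum n (λ j → (p j *ᶻ pos (auxCoef t s j)) *ᶻ (pos (W * ω t (j div K)) -ᶻ pos (Ω * μ (j div K) ^ X t)))
  aux-compare p t s W Ω = begin
    pos W *ᶻ aux p t s
      ≡⟨ Σᶻ.sum-distribˡ-⊗ n (pos W) _ ⟩
    Σᶻ.sum n (λ j → pos W *ᶻ (p j *ᶻ pos (auxCoef t s j * ω t (j div K))))
      ≡⟨ Σᶻ.sum-cong n (λ j _ → term j) ⟩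
    Σᶻ.sum n (λ j → pos Ω *ᶻ (p j *ᶻ pos (bin (X t + s) (j mod K) * μ (j div K) ^ (X t + s))) +ᶻ err j)
      ≡⟨ Σᶻ.sum-distrib-⊕ n (λ j → pos Ω *ᶻ (p j *ᶻ pos (bin (X t + s) (j mod K) * μ (j div K) ^ (X t + s)))) err ⟩
    Σᶻ.sum n (λ j → pos Ω *ᶻ (p j *ᶻ pos (bin (X t + s) (j mod K) * μ (j div K) ^ (X t + s)))) +ᶻ Σᶻ.sum n err
      ≡⟨ cong (_+ᶻ Σᶻ.sum n err) (Σᶻ.sum-distribˡ-⊗ n (pos Ω) (λ j → p j *ᶻ pos (bin (X t + s) (j mod K) * μ (j div K) ^ (X t + s)))) ⟨
    pos Ω *ᶻ F p (X t + s) +ᶻ Σᶻ.sum n err ∎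
    where
    open ≡-Reasoning
    err : ℕ → ℤ
    err j = (p j *ᶻ pos (auxCoef t s j)) *ᶻ (pos (W * ω t (j div K)) -ᶻ pos (Ω * μ (j div K) ^ X t))
    lem : ∀ W p a w Ω m → W *ᶻ (p *ᶻ (a *ᶻ w)) ≡ Ω *ᶻ (p *ᶻ (a *ᶻ m)) +ᶻ (p *ᶻ a) *ᶻ (W *ᶻ w -ᶻ Ω *ᶻ m)
    lem = ℤRS.solve-∀
    term : ∀ j → pos W *ᶻ (p j *ᶻ pos (auxCoef t s j * ω t (j div K))) ≡
      pos Ω *ᶻ (p j *ᶻ pos (bin (X t + s) (j mod K) * μ (j div K) ^ (X t + s))) +ᶻ err j
    term j = begin
      pos W *ᶻ (p j *ᶻ pos (a * ω t l))
        ≡⟨ cong (λ u → pos W *ᶻ (p j *ᶻ u)) (ℤP.pos-* a (ω t l)) ⟩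
      pos W *ᶻ (p j *ᶻ (pos a *ᶻ pos (ω t l)))
        ≡⟨ lem (pos W) (p j) (pos a) (pos (ω t l)) (pos Ω) (pos m) ⟩
      pos Ω *ᶻ (p j *ᶻ (pos a *ᶻ pos m)) +ᶻ (p j *ᶻ pos a) *ᶻ (pos W *ᶻ pos (ω t l) -ᶻ pos Ω *ᶻ pos m)
        ≡⟨ cong₂ (λ u v → pos Ω *ᶻ (p j *ᶻ u) +ᶻ (p j *ᶻ pos a) *ᶻ v)
             (trans (sym (ℤP.pos-* a m)) (cong pos (trans (*-assoc b (μ l ^ s) m) (cong (b *_) (trans (*-comm (μ l ^ s) m) (sym (^-distribˡ-+-* (μ l) (X t) s)))))))
             (cong₂ _-ᶻ_ (sym (ℤP.pos-* W (ω t l))) (sym (ℤP.pos-* Ω m))) ⟩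
      pos Ω *ᶻ (p j *ᶻ pos (b * μ l ^ (X t + s))) +ᶻ err j ∎
      where
      l = j div K
      a = auxCoef t s j
      b = bin (X t + s) (j mod K)
      m = μ l ^ X t

-- The 2-adic contradiction.

module 2-adic (L K : ℕ) .{{_ : NonZero K}} (d : ℕ → ℕ) (ω : ℕ → ℕ → ℕ) (X : ℕ → ℕ) (R S : ℕ)
  (ω≢0 : ∀ t l → ω t l ≢ 0)
  (d≢ : ∀ l l′ → l < l′ → l′ < L → d l ≢ d l′)
  (gap : ∀ t → X t + (S + L) ≤ X (suc t)) (big : 2 ^ L * K < R * S)
  (M E B I A : ℕ) .{{_ : NonZero M}} (Ω : ℕ → ℕ)
  (M∣E : M ℕ∣.∣ E ^ (I ∸ K))
  (E∣d : ∀ l → l < L → E ℕ∣.∣ d l)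
  (close : ∀ t l → t < R → l < L → pos M ℤ∣.∣ (pos (ω t l) -ᶻ pos (Ω t * (1 + d l) ^ X t)))
  (count : M ^ I < B ^ (L * K))
  (auxCoef≤ : ∀ t s → t < R → s < S + L → ∀ l → l < L → ∀ k → k < K → bin (X t + s) k * (1 + d l) ^ s * ω t l ≤ A)
  (size : L * K * (B * A) < M) where

  open Core L K 1 d ω X R S (λ ()) ω≢0 d≢ gap big

  private
    div<L : ∀ {j} → j < n → j div K < L
    div<L = m<n*o⇒m/o<n

    ∣coef : ∀ j i → j < n → I ≤ i → pos M ℤ∣.∣ pos (coef j i)
    ∣coef j i j<n I≤i = ℤ∣.∣ᵤ⇒∣ (ℕ∣.∣n⇒∣m*n (bin i (j mod K) * μ (j div K) ^ (j mod K))
      (ℕ∣.∣-trans M∣E (ℕ∣.∣-trans (^-∣ (∸-mono I≤i (<⇒≤ (m%n<n j K)))) (∣-^ (i ∸ j mod K) (E∣d (j div K) (div<L j<n))))))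
      where
      ^-∣ : ∀ {a b} → a ≤ b → E ^ a ℕ∣.∣ E ^ b
      ^-∣ {a} {b} a≤b = subst (λ k → E ^ a ℕ∣.∣ E ^ k) (m∸n+n≡m a≤b)
        (subst (E ^ a ℕ∣.∣_) (sym (^-distribˡ-+-* E (b ∸ a) a)) (ℕ∣.n∣m*n (E ^ (b ∸ a))))
      ∣-^ : ∀ k {a b} → a ℕ∣.∣ b → a ^ k ℕ∣.∣ b ^ k
      ∣-^ zero    a∣b = ℕ∣.∣-refl
      ∣-^ (suc k) a∣b = ℕ∣.*-pres-∣ a∣b (∣-^ k a∣b)

  -- The Newton coefficients of index below `I` are divisible by `M` by the pigeonhole choice, the
  -- others because `d l` is divisible by `E`. Hence `M` divides `F` and, by `close`, also `aux`,
  -- which `size` bounds below `M`.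
  impossible : ⊥
  impossible with pigeonhole-family n B I M (λ P i → coefSum P i mod M) (λ P _ i _ → m%n<n (coefSum P i) M) count
  ... | P , P′ , P<B , P′<B , differ , same = aux-vanish⇒⊥ P P′ differ λ t s t<R s< →
    ∣∧<⇒≡0 (M∣aux t s t<R) (≤-<-trans (∣aux∣≤ p B t s (λ j j<n → ∣pos-pos∣≤ (<⇒≤ (P<B j j<n)) (<⇒≤ (P′<B j j<n))) A
      (λ j j<n → auxCoef≤ t s t<R s< (j div K) (div<L j<n) (j mod K) (m%n<n j K))) size)
    where
    p = diff P P′
    M∣c : ∀ i → pos M ℤ∣.∣ c p i
    M∣c i with i <? I
    ... | yes i<I = subst (pos M ℤ∣.∣_) (sym (c-diff P P′ i)) (mod-≡⇒∣ (coefSum P i) (coefSum P′ i) M (same i i<I))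
    ... | no i≮I = sum-∣ n λ j j<n → ℤ∣.∣n⇒∣m*n (p j) (∣coef j i j<n (≮⇒≥ i≮I))
    M∣aux : ∀ t s → t < R → pos M ℤ∣.∣ aux p t s
    M∣aux t s t<R = subst (pos M ℤ∣.∣_) (trans (sym (aux-compare p t s 1 (Ω t))) (ℤP.*-identityˡ _))
      (ℤ∣.∣m∣n⇒∣m+n (ℤ∣.∣n⇒∣m*n (pos (Ω t)) (subst (pos M ℤ∣.∣_) (sym (F-newton p (X t + s))) (newton-∣ (pos 1) (X t + s) M∣c)))
        (sum-∣ n λ j j<n → ℤ∣.∣n⇒∣m*n (p j *ᶻ pos (auxCoef t s j))
          (subst (λ z → pos M ℤ∣.∣ (pos z -ᶻ pos (Ω t * μ (j div K) ^ X t))) (sym (*-identityˡ _)) (close t (j div K) t<R (div<L j<n)))))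

-- The real contradiction.

shape-scale : ∀ y d b k i → shape y (b * d) k i ≡ shape y d k i * b ^ (i ∸ k)
shape-scale y d b k i = trans (cong (bin i k * y ^ k *_) (trans (*-^ b d (i ∸ k)) (*-comm (b ^ (i ∸ k)) _))) (sym (*-assoc (bin i k * y ^ k) _ _))

bin-≤ : ∀ n k → bin n k ≤ 2 ^ n
bin-≤ n       zero    = m^n>0 2 n
bin-≤ zero    (suc k) = z≤n
bin-≤ (suc n) (suc k) = ≤-trans (+-mono-≤ (bin-≤ n k) (bin-≤ n (suc k))) (≤-reflexive (cong (2 ^ n +_) (sym (+-identityʳ (2 ^ n)))))

-- J bounds (1 + 1/D)^x, G is the precision of the pigeonhole step for the Newton coefficients
-- i < I, β is the gain per index for the remaining ones, and 1/H is the relative error of ω.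
module Archimedean (L K : ℕ) .{{_ : NonZero K}} (w : ℕ) .{{_ : NonZero w}} (d : ℕ → ℕ) (ω : ℕ → ℕ → ℕ) (X : ℕ → ℕ) (R S : ℕ)
  (ω≢0 : ∀ t l → ω t l ≢ 0)
  (d≢ : ∀ l l′ → l < l′ → l′ < L → d l ≢ d l′)
  (gap : ∀ t → X t + (S + L) ≤ X (suc t)) (big : 2 ^ L * K < R * S)
  (D β B J I C G M Q H xmax : ℕ)
  .{{_ : NonZero D}} .{{_ : NonZero β}} .{{_ : NonZero G}} .{{_ : NonZero H}} .{{_ : NonZero Q}} (Ω : ℕ → ℕ)
  (d-small : ∀ l → l < L → D * (β * d l) ≤ w)
  (exp≤ : ∀ x → x ≤ xmax → (1 + D) ^ x ≤ J * D ^ x)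
  (X≤ : ∀ t s → t < R → s < S + L → X t + s ≤ xmax)
  (bin≤C : ∀ x k → x ≤ xmax → k < K → bin x k ≤ C)
  (close : ∀ t l → t < R → l < L → ∣ pos (w ^ X t * ω t l) -ᶻ pos (Ω t * (w + d l) ^ X t) ∣ * H ≤ Ω t * (w + d l) ^ X t)
  (Ω≤ : ∀ t s → t < R → s < S + L → Ω t * w ^ s ≤ Q)
  (class< : G * (L * K * (B * 2 ^ (I + K))) < M)
  (count : M ^ I < B ^ (L * K))
  (head-small : D ^ I * J * (4 * Q) ≤ G)
  (tail-small : L * K * (B * (C * 2 ^ K * J)) * (4 * Q) ≤ β ^ (I ∸ K))
  (error-small : L * K * (B * (C * J)) * (4 * Q) ≤ H) where

  open Core L K w d ω X R S (≢-nonZero⁻¹ w) ω≢0 d≢ gap big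

  private
    kk ll : ℕ → ℕ
    kk j = j mod K
    ll j = j div K

    div<L : ∀ {j} → j < n → j div K < L
    div<L = m<n*o⇒m/o<n

    βd≤w : ∀ {l} → l < L → β * d l ≤ w
    βd≤w {l} l<L = ≤-trans (m≤n*m (β * d l) D) (d-small l l<L)

    d≤w : ∀ {l} → l < L → d l ≤ w
    d≤w {l} l<L = ≤-trans (m≤n*m (d l) β) (βd≤w l<L)

    μ≤2w : ∀ {l} → l < L → μ l ≤ 2 * w
    μ≤2w {l} l<L = ≤-trans (+-monoʳ-≤ w (d≤w l<L)) (≤-reflexive (cong (w +_) (sym (+-identityʳ w))))

    μ^k≤ : ∀ {l} k → l < L → μ l ^ k ≤ 2 ^ k * w ^ k
    μ^k≤ k l<L = ≤-trans (^-monoˡ-≤ k (μ≤2w l<L)) (≤-reflexive (*-^ 2 w k))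

    coef≤ : ∀ j i → j < n → coef j i ≤ 2 ^ (i + K) * w ^ i
    coef≤ j i j<n with kk j ≤? i
    ... | no k≰i rewrite n<k⇒bin≡0 i (kk j) (≰⇒> k≰i) = z≤n
    ... | yes k≤i = begin
      bin i (kk j) * μ (ll j) ^ kk j * d (ll j) ^ (i ∸ kk j)
        ≤⟨ *-mono-≤ (*-mono-≤ (bin-≤ i (kk j)) (μ^k≤ (kk j) (div<L j<n))) (^-monoˡ-≤ (i ∸ kk j) (d≤w (div<L j<n))) ⟩
      2 ^ i * (2 ^ kk j * w ^ kk j) * w ^ (i ∸ kk j)
        ≡⟨ lem (2 ^ i) (2 ^ kk j) (w ^ kk j) (w ^ (i ∸ kk j)) ⟩
      2 ^ i * 2 ^ kk j * (w ^ kk j * w ^ (i ∸ kk j))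
        ≡⟨ cong₂ _*_ (sym (^-distribˡ-+-* 2 i (kk j))) (trans (sym (^-distribˡ-+-* w (kk j) (i ∸ kk j))) (cong (w ^_) (m+[n∸m]≡n k≤i))) ⟩
      2 ^ (i + kk j) * w ^ i
        ≤⟨ *-monoˡ-≤ (w ^ i) (^-monoʳ-≤ 2 (+-monoʳ-≤ i (<⇒≤ (m%n<n j K)))) ⟩
      2 ^ (i + K) * w ^ i ∎
      where
      open ≤-Reasoning
      lem : ∀ a b c e → a * (b * c) * e ≡ a * b * (c * e)
      lem = solve-∀

    w^≢0 : ∀ i → NonZero (w ^ i)
    w^≢0 i = m^n≢0 w i

    -- The numbers put into boxes are the normalised Newton coefficients `coefSum P i / w ^ i`, and
    -- the boxes have width `1 / G`.
    class : (ℕ → ℕ) → ℕ → ℕ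
    class P i = _div_ (G * coefSum P i) (w ^ i) {{w^≢0 i}}

    class-bound : ∀ P → (∀ j → j < n → P j < B) → ∀ i → i < I → class P i < M
    class-bound P P<B i i<I = m<n*o⇒m/o<n {G * coefSum P i} {M} {w ^ i} {{w^≢0 i}} (begin-strict
      G * coefSum P i
        ≤⟨ *-monoʳ-≤ G (sum-≤ n (B * (2 ^ (I + K) * w ^ i)) λ j j<n → *-mono-≤ (<⇒≤ (P<B j j<n))
             (≤-trans (coef≤ j i j<n) (*-monoˡ-≤ (w ^ i) (^-monoʳ-≤ 2 (+-monoˡ-≤ K (<⇒≤ i<I)))))) ⟩
      G * (n * (B * (2 ^ (I + K) * w ^ i)))
        ≡⟨ lem G n B (2 ^ (I + K)) (w ^ i) ⟩
      G * (n * (B * 2 ^ (I + K))) * w ^ i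
        <⟨ *-monoˡ-< (w ^ i) {{w^≢0 i}} class< ⟩
      M * w ^ i ∎)
      where
      open ≤-Reasoning
      lem : ∀ G n B t w → G * (n * (B * (t * w))) ≡ G * (n * (B * t)) * w
      lem = solve-∀

    T : ℕ
    T = β ^ (I ∸ K)

    instance
      T≢0 : NonZero T
      T≢0 = m^n≢0 β (I ∸ K)

      GT≢0 : NonZero (G * T)
      GT≢0 = m*n≢0 G T

    2GT≢0 : NonZero (2 * (G * T))
    2GT≢0 = m*n≢0 2 (G * T)

    tail-shape : ∀ j x → j < n → x ≤ xmax → shape (μ (ll j)) (w + β * d (ll j)) (kk j) x ≤ C * 2 ^ K * J * w ^ x
    tail-shape j x j<n x≤ with kk j ≤? x
    ... | no k≰x rewrite n<k⇒bin≡0 x (kk j) (≰⇒> k≰x) = z≤n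
    ... | yes k≤x = begin
      bin x k * μ (ll j) ^ k * (w + β * d (ll j)) ^ (x ∸ k)
        ≤⟨ *-mono-≤ (*-mono-≤ (bin≤C x k x≤ (m%n<n j K)) (≤-trans (μ^k≤ k (div<L j<n)) (*-monoˡ-≤ (w ^ k) (^-monoʳ-≤ 2 (<⇒≤ (m%n<n j K)))))) grow ⟩
      C * (2 ^ K * w ^ k) * (J * w ^ (x ∸ k))
        ≡⟨ lem C (2 ^ K) (w ^ k) J (w ^ (x ∸ k)) ⟩
      C * 2 ^ K * J * (w ^ k * w ^ (x ∸ k))
        ≡⟨ cong (C * 2 ^ K * J *_) (trans (sym (^-distribˡ-+-* w k (x ∸ k))) (cong (w ^_) (m+[n∸m]≡n k≤x))) ⟩
      C * 2 ^ K * J * w ^ x ∎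
      where
      open ≤-Reasoning
      k = kk j
      e = x ∸ k
      lem : ∀ C t a J b → C * (t * a) * (J * b) ≡ C * t * J * (a * b)
      lem = solve-∀
      lem₂ : ∀ D w b → D * (w + b) ≡ D * w + D * b
      lem₂ = solve-∀
      lem₃ : ∀ J D w → J * D * w ≡ D * (J * w)
      lem₃ = solve-∀
      base : D * (w + β * d (ll j)) ≤ (1 + D) * w
      base = ≤-trans (≤-reflexive (lem₂ D w (β * d (ll j)))) (≤-trans (+-monoʳ-≤ (D * w) (d-small (ll j) (div<L j<n))) (≤-reflexive (+-comm (D * w) w)))
      grow : (w + β * d (ll j)) ^ e ≤ J * w ^ e
      grow = *-cancelˡ-≤ (D ^ e) {{m^n≢0 D e}} (begin
        D ^ e * (w + β * d (ll j)) ^ e ≡⟨ *-^ D _ e ⟨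
        (D * (w + β * d (ll j))) ^ e   ≤⟨ ^-monoˡ-≤ e base ⟩
        ((1 + D) * w) ^ e              ≡⟨ *-^ (1 + D) w e ⟩
        (1 + D) ^ e * w ^ e            ≤⟨ *-monoˡ-≤ (w ^ e) (exp≤ e (≤-trans (m∸n≤m x k) x≤)) ⟩
        J * D ^ e * w ^ e              ≡⟨ lem₃ J (D ^ e) (w ^ e) ⟩
        D ^ e * (J * w ^ e) ∎)

    μ^x≤ : ∀ {l} x → l < L → x ≤ xmax → μ l ^ x ≤ J * w ^ x
    μ^x≤ {l} x l<L x≤ = *-cancelˡ-≤ (D ^ x) {{m^n≢0 D x}} (begin
        D ^ x * (w + d l) ^ x ≡⟨ *-^ D _ x ⟨
        (D * (w + d l)) ^ x   ≤⟨ ^-monoˡ-≤ x base ⟩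
        ((1 + D) * w) ^ x     ≡⟨ *-^ (1 + D) w x ⟩
        (1 + D) ^ x * w ^ x   ≤⟨ *-monoˡ-≤ (w ^ x) (exp≤ x x≤) ⟩
        J * D ^ x * w ^ x     ≡⟨ lem₃ J (D ^ x) (w ^ x) ⟩
        D ^ x * (J * w ^ x) ∎)
      where
      open ≤-Reasoning
      lem₃ : ∀ J D w → J * D * w ≡ D * (J * w)
      lem₃ = solve-∀
      lem₂ : ∀ D w b → D * (w + b) ≡ D * w + D * b
      lem₂ = solve-∀
      base : D * (w + d l) ≤ (1 + D) * w
      base = ≤-trans (≤-reflexive (lem₂ D w (d l))) (≤-trans (+-monoʳ-≤ (D * w)
        (≤-trans (*-monoʳ-≤ D (m≤n*m (d l) β)) (d-small l l<L))) (≤-reflexive (+-comm (D * w) w)))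

    module Estimate (p : ℕ → ℤ) (p≤B : ∀ j → j < n → ∣ p j ∣ ≤ B) (c-small : ∀ i → i < I → ∣ c p i ∣ * G ≤ w ^ i) where

      tailSum : ℕ → ℕ
      tailSum i = Σℕ.sum n (λ j → ∣ p j ∣ * shape (μ (ll j)) (β * d (ll j)) (kk j) i)

      -- Replacing `d` by `β * d` multiplies the coefficient by `β ^ (i ∸ k)`, which is at least
      -- `T`. The gain is thus extracted uniformly in `i`, and the enlarged series still has the
      -- closed form `newton-shape`, with base `w + β * d` close to `w`.
      c-tail : ∀ i → I ≤ i → ∣ c p i ∣ * T ≤ tailSum i
      c-tail i I≤i = begin
        ∣ c p i ∣ * T
          ≤⟨ *-monoˡ-≤ T (≤-trans (∣sum∣≤ n _) (≤-reflexive (Σℕ.sum-cong n λ j _ → ∣i*pos∣ (p j) (coef j i)))) ⟩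
        Σℕ.sum n (λ j → ∣ p j ∣ * coef j i) * T
          ≡⟨ trans (*-comm _ T) (Σℕ.sum-distribˡ-⊗ n T _) ⟩
        Σℕ.sum n (λ j → T * (∣ p j ∣ * coef j i))
          ≤⟨ sum-mono n (λ j j<n → begin
               T * (∣ p j ∣ * coef j i)
                 ≡⟨ trans (*-comm T _) (*-assoc ∣ p j ∣ _ T) ⟩
               ∣ p j ∣ * (coef j i * T)
                 ≤⟨ *-monoʳ-≤ ∣ p j ∣ (*-monoʳ-≤ (coef j i) (^-monoʳ-≤ β (∸-mono I≤i (<⇒≤ (m%n<n j K))))) ⟩
               ∣ p j ∣ * (coef j i * β ^ (i ∸ kk j))
                 ≡⟨ cong (∣ p j ∣ *_) (sym (shape-scale (μ (ll j)) (d (ll j)) β (kk j) i)) ⟩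
               ∣ p j ∣ * shape (μ (ll j)) (β * d (ll j)) (kk j) i ∎) ⟩
        tailSum i ∎
        where open ≤-Reasoning

      -- For `i < I` the estimate `w ^ i / G` is weakened to `D ^ I * (w / D) ^ i / G`. The head
      -- then sums to a multiple of `(w + w / D) ^ x`, at most `J * w ^ x`, where `w ^ i` itself
      -- would give `(2 * w) ^ x`. The price is the factor `D ^ I` in `head-small`. Adding head and
      -- tail gives one bound for all `i`, to which `newton-mono` applies.
      bound : ℕ → ℕ
      bound i = D ^ I * T * w ^ i + G * (D ^ i * tailSum i)

      c-bound : ∀ i → D ^ i * (G * T * ∣ c p i ∣) ≤ bound i
      c-bound i with i <? I
      ... | yes i<I = ≤-trans (begin
        D ^ i * (G * T * ∣ c p i ∣) ≡⟨ lem (D ^ i) G T ∣ c p i ∣ ⟩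
        D ^ i * T * (∣ c p i ∣ * G) ≤⟨ *-mono-≤ (*-monoˡ-≤ T (^-monoʳ-≤ D (<⇒≤ i<I))) (c-small i i<I) ⟩
        D ^ I * T * w ^ i ∎) (m≤m+n _ _)
        where
        open ≤-Reasoning
        lem : ∀ a G T c → a * (G * T * c) ≡ a * T * (c * G)
        lem = solve-∀
      ... | no i≮I = ≤-trans (begin
        D ^ i * (G * T * ∣ c p i ∣) ≡⟨ lem (D ^ i) G T ∣ c p i ∣ ⟩
        G * (D ^ i * (∣ c p i ∣ * T)) ≤⟨ *-monoʳ-≤ G (*-monoʳ-≤ (D ^ i) (c-tail i (≮⇒≥ i≮I))) ⟩
        G * (D ^ i * tailSum i) ∎) (m≤n+m _ _)
        where
        open ≤-Reasoning
        lem : ∀ a G T c → a * (G * T * c) ≡ G * (a * (c * T))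
        lem = solve-∀

      newton-tailSum : ∀ x → x ≤ xmax → Σℕ.newton w x tailSum ≤ n * (B * (C * 2 ^ K * J)) * w ^ x
      newton-tailSum x x≤ = begin
        Σℕ.newton w x tailSum
          ≡⟨ Σℕ.newton-sum w x n (λ j → ∣ p j ∣) (λ j → shape (μ (ll j)) (β * d (ll j)) (kk j)) ⟩
        Σℕ.sum n (λ j → ∣ p j ∣ * Σℕ.newton w x (shape (μ (ll j)) (β * d (ll j)) (kk j)))
          ≤⟨ sum-≤ n (B * (C * 2 ^ K * J * w ^ x)) (λ j j<n → *-mono-≤ (p≤B j j<n)
               (≤-trans (≤-reflexive (newton-shape w (β * d (ll j)) (μ (ll j)) (kk j) x)) (tail-shape j x j<n x≤))) ⟩
        n * (B * (C * 2 ^ K * J * w ^ x))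
          ≡⟨ lem n B (C * 2 ^ K * J) (w ^ x) ⟩
        n * (B * (C * 2 ^ K * J)) * w ^ x ∎
        where
        open ≤-Reasoning
        lem : ∀ n B c w → n * (B * (c * w)) ≡ n * (B * c) * w
        lem = solve-∀

      newton-bound : ∀ x → x ≤ xmax →
        Σℕ.newton (D * w) x bound ≤ D ^ x * (w ^ x * (D ^ I * T * J + G * (n * (B * (C * 2 ^ K * J)))))
      newton-bound x x≤ = begin
        Σℕ.newton (D * w) x bound
          ≡⟨ trans (Σℕ.newton-⊕ (D * w) x _ _) (cong₂ _+_ (Σℕ.newton-⊗ (D * w) x (D ^ I * T) (w ^_)) (Σℕ.newton-⊗ (D * w) x G (λ i → D ^ i * tailSum i))) ⟩
        D ^ I * T * Σℕ.newton (D * w) x (w ^_) + G * Σℕ.newton (D * w) x (λ i → D ^ i * tailSum i)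
          ≡⟨ cong₂ (λ a b → D ^ I * T * a + G * b) (newton-pow (D * w) w x) (sym (newton-scale D w x tailSum)) ⟩
        D ^ I * T * (D * w + w) ^ x + G * (D ^ x * Σℕ.newton w x tailSum)
          ≤⟨ +-mono-≤ (*-monoʳ-≤ (D ^ I * T) (begin
               (D * w + w) ^ x     ≡⟨ cong (_^ x) (+-comm (D * w) w) ⟩
               ((1 + D) * w) ^ x   ≡⟨ *-^ (1 + D) w x ⟩
               (1 + D) ^ x * w ^ x ≤⟨ *-monoˡ-≤ (w ^ x) (exp≤ x x≤) ⟩
               J * D ^ x * w ^ x ∎)) (*-monoʳ-≤ G (*-monoʳ-≤ (D ^ x) (newton-tailSum x x≤))) ⟩
        D ^ I * T * (J * D ^ x * w ^ x) + G * (D ^ x * (n * (B * (C * 2 ^ K * J)) * w ^ x))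
          ≡⟨ lem (D ^ I) T J (D ^ x) (w ^ x) G (n * (B * (C * 2 ^ K * J))) ⟩
        D ^ x * (w ^ x * (D ^ I * T * J + G * (n * (B * (C * 2 ^ K * J))))) ∎
        where
        open ≤-Reasoning
        lem : ∀ a T J e w G b → a * T * (J * e * w) + G * (e * (b * w)) ≡ e * (w * (a * T * J + G * b))
        lem = solve-∀

      F-small : ∀ x → x ≤ xmax → ∣ F p x ∣ * (2 * Q) ≤ w ^ x
      F-small x x≤ = *-cancelˡ-≤ (2 * (G * T)) {{2GT≢0}} (begin
        2 * (G * T) * (∣ F p x ∣ * (2 * Q))
          ≡⟨ lem₁ (G * T) ∣ F p x ∣ Q ⟩
        G * T * ∣ F p x ∣ * (4 * Q)
          ≤⟨ *-monoˡ-≤ (4 * Q) (*-cancelˡ-≤ (D ^ x) {{m^n≢0 D x}} main) ⟩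
        w ^ x * (D ^ I * T * J + G * b) * (4 * Q)
          ≡⟨ lem₂ (w ^ x) (D ^ I) T J G b (4 * Q) ⟩
        w ^ x * (T * (D ^ I * J * (4 * Q)) + G * (b * (4 * Q)))
          ≤⟨ *-monoʳ-≤ (w ^ x) (+-mono-≤ (*-monoʳ-≤ T head-small) (*-monoʳ-≤ G tail-small)) ⟩
        w ^ x * (T * G + G * T)
          ≡⟨ lem₃ (w ^ x) T G ⟩
        2 * (G * T) * w ^ x ∎)
        where
        open ≤-Reasoning
        b = n * (B * (C * 2 ^ K * J))
        lem₁ : ∀ g f q → 2 * g * (f * (2 * q)) ≡ g * f * (4 * q)
        lem₁ = solve-∀
        lem₂ : ∀ w a T J G b q → w * (a * T * J + G * b) * q ≡ w * (T * (a * J * q) + G * (b * q))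
        lem₂ = solve-∀
        lem₃ : ∀ w T G → w * (T * G + G * T) ≡ 2 * (G * T) * w
        lem₃ = solve-∀
        main : D ^ x * (G * T * ∣ F p x ∣) ≤ D ^ x * (w ^ x * (D ^ I * T * J + G * b))
        main = begin
          D ^ x * (G * T * ∣ F p x ∣)
            ≤⟨ *-monoʳ-≤ (D ^ x) (*-monoʳ-≤ (G * T) (≤-trans (≤-reflexive (cong ∣_∣ (F-newton p x))) (∣newton∣≤ w x (c p)))) ⟩
          D ^ x * (G * T * Σℕ.newton w x (λ i → ∣ c p i ∣))
            ≡⟨ cong (D ^ x *_) (Σℕ.newton-⊗ w x (G * T) (λ i → ∣ c p i ∣)) ⟨
          D ^ x * Σℕ.newton w x (λ i → G * T * ∣ c p i ∣)
            ≡⟨ newton-scale D w x _ ⟩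
          Σℕ.newton (D * w) x (λ i → D ^ i * (G * T * ∣ c p i ∣))
            ≤⟨ newton-mono (D * w) x c-bound ⟩
          Σℕ.newton (D * w) x bound
            ≤⟨ newton-bound x x≤ ⟩
          D ^ x * (w ^ x * (D ^ I * T * J + G * b)) ∎

      aux-zero : ∀ t s → t < R → s < S + L → aux p t s ≡ 0ℤ
      aux-zero t s t<R s< = ℤP.∣i∣≡0⇒i≡0 (n<1⇒n≡0 (*-cancelʳ-< (4 * Q) A 1 (begin-strict
        A * (4 * Q)
          -- The head and the tail of `F` contribute a quarter each, the error of `ω` a third
          -- quarter; so the integer `A` is at most 3/4.
          ≤⟨ *-cancelˡ-≤ (w ^ X t) {{w^≢0 (X t)}} scaled ⟩
        3 * Q
          <⟨ *-monoˡ-< Q {3} {4} ≤-refl ⟩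
        4 * Q
          ≡⟨ *-identityˡ (4 * Q) ⟨
        1 * (4 * Q) ∎)))
        where
        open ≤-Reasoning
        A = ∣ aux p t s ∣
        x = X t + s
        x≤ : x ≤ xmax
        x≤ = X≤ t s t<R s<
        f = ∣ F p x ∣
        err : ℕ → ℤ
        err j = (p j *ᶻ pos (auxCoef t s j)) *ᶻ (pos (w ^ X t * ω t (ll j)) -ᶻ pos (Ω t * μ (ll j) ^ X t))
        E = ∣ Σᶻ.sum n err ∣
        e₀ = n * (B * (C * J))
        err-term : ∀ j → j < n → H * ∣ err j ∣ ≤ B * (C * J) * (Ω t * w ^ x)
        err-term j j<n = begin
          H * ∣ err j ∣
            ≡⟨ cong (H *_) (trans (ℤP.∣i*j∣≡∣i∣*∣j∣ (p j *ᶻ pos (auxCoef t s j)) _) (cong (_* δ) (∣i*pos∣ (p j) (auxCoef t s j)))) ⟩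
          H * (∣ p j ∣ * auxCoef t s j * δ)
            ≡⟨ lem₁ H (∣ p j ∣ * auxCoef t s j) δ ⟩
          ∣ p j ∣ * auxCoef t s j * (δ * H)
            ≤⟨ *-monoʳ-≤ (∣ p j ∣ * auxCoef t s j) (close t (ll j) t<R (div<L j<n)) ⟩
          ∣ p j ∣ * (bin x (kk j) * μ (ll j) ^ s) * (Ω t * μ (ll j) ^ X t)
            ≡⟨ trans (lem₂ ∣ p j ∣ (bin x (kk j)) (μ (ll j) ^ s) (Ω t) (μ (ll j) ^ X t)) (cong (λ m → ∣ p j ∣ * (bin x (kk j) * (Ω t * m))) (sym (^-distribˡ-+-* (μ (ll j)) (X t) s))) ⟩
          ∣ p j ∣ * (bin x (kk j) * (Ω t * μ (ll j) ^ x))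
            ≤⟨ *-mono-≤ (p≤B j j<n) (*-mono-≤ (bin≤C x (kk j) x≤ (m%n<n j K)) (*-monoʳ-≤ (Ω t) (μ^x≤ x (div<L j<n) x≤))) ⟩
          B * (C * (Ω t * (J * w ^ x)))
            ≡⟨ lem₃ B C (Ω t) J (w ^ x) ⟩
          B * (C * J) * (Ω t * w ^ x) ∎
          where
          δ = ∣ pos (w ^ X t * ω t (ll j)) -ᶻ pos (Ω t * μ (ll j) ^ X t) ∣
          lem₁ : ∀ h a e → h * (a * e) ≡ a * (e * h)
          lem₁ = solve-∀
          lem₂ : ∀ p b m o k → p * (b * m) * (o * k) ≡ p * (b * (o * (k * m)))
          lem₂ = solve-∀
          lem₃ : ∀ B C o J w → B * (C * (o * (J * w))) ≡ B * (C * J) * (o * w)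
          lem₃ = solve-∀
        E-small : E * (4 * Q) ≤ Ω t * w ^ x
        E-small = *-cancelˡ-≤ H (begin
          H * (E * (4 * Q))
            ≡⟨ *-assoc H E (4 * Q) ⟨
          H * E * (4 * Q)
            ≤⟨ *-monoˡ-≤ (4 * Q) (≤-trans (*-monoʳ-≤ H (∣sum∣≤ n err))
                 (≤-trans (≤-reflexive (Σℕ.sum-distribˡ-⊗ n H (λ j → ∣ err j ∣))) (sum-≤ n _ err-term))) ⟩
          n * (B * (C * J) * (Ω t * w ^ x)) * (4 * Q)
            ≡⟨ lem n (B * (C * J)) (Ω t * w ^ x) (4 * Q) ⟩
          e₀ * (4 * Q) * (Ω t * w ^ x)
            ≤⟨ *-monoˡ-≤ (Ω t * w ^ x) error-small ⟩
          H * (Ω t * w ^ x) ∎)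
          where
          lem : ∀ n b o q → n * (b * o) * q ≡ n * b * q * o
          lem = solve-∀
        scaled : w ^ X t * (A * (4 * Q)) ≤ w ^ X t * (3 * Q)
        scaled = begin
          w ^ X t * (A * (4 * Q))
            ≡⟨ *-assoc (w ^ X t) A (4 * Q) ⟨
          w ^ X t * A * (4 * Q)
            ≡⟨ cong (_* (4 * Q)) (trans (sym (ℤP.∣i*j∣≡∣i∣*∣j∣ (pos (w ^ X t)) (aux p t s))) (cong ∣_∣ (aux-compare p t s (w ^ X t) (Ω t)))) ⟩
          ∣ pos (Ω t) *ᶻ F p x +ᶻ Σᶻ.sum n err ∣ * (4 * Q)
            ≤⟨ *-monoˡ-≤ (4 * Q) (≤-trans (ℤP.∣i+j∣≤∣i∣+∣j∣ (pos (Ω t) *ᶻ F p x) (Σᶻ.sum n err)) (+-monoˡ-≤ E (≤-reflexive (ℤP.∣i*j∣≡∣i∣*∣j∣ (pos (Ω t)) (F p x))))) ⟩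
          (Ω t * f + E) * (4 * Q)
            ≡⟨ lem (Ω t) f E Q ⟩
          2 * (Ω t * (f * (2 * Q))) + E * (4 * Q)
            ≤⟨ +-mono-≤ (*-monoʳ-≤ 2 (*-monoʳ-≤ (Ω t) (F-small x x≤))) E-small ⟩
          2 * (Ω t * w ^ x) + Ω t * w ^ x
            ≡⟨ trans (+-comm (2 * (Ω t * w ^ x)) _) (cong (λ u → 3 * (Ω t * u)) (^-distribˡ-+-* w (X t) s)) ⟩
          3 * (Ω t * (w ^ X t * w ^ s))
            ≡⟨ lem₂ (Ω t) (w ^ X t) (w ^ s) ⟩
          w ^ X t * (3 * (Ω t * w ^ s))
            ≤⟨ *-monoʳ-≤ (w ^ X t) (*-monoʳ-≤ 3 (Ω≤ t s t<R s<)) ⟩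
          w ^ X t * (3 * Q) ∎
          where
          lem : ∀ o f e q → (o * f + e) * (4 * q) ≡ 2 * (o * (f * (2 * q))) + e * (4 * q)
          lem = solve-∀
          lem₂ : ∀ o u v → 3 * (o * (u * v)) ≡ u * (3 * (o * v))
          lem₂ = solve-∀

    c-small : ∀ P P′ i → class P i ≡ class P′ i → ∣ c (diff P P′) i ∣ * G ≤ w ^ i
    c-small P P′ i same = subst (_≤ w ^ i) eq (div-≡⇒∣-∣≤ (G * a) (G * b) (w ^ i) {{w^≢0 i}} same)
      where
      a = coefSum P i
      b = coefSum P′ i
      lem : ∀ g a b → g *ᶻ (a -ᶻ b) ≡ g *ᶻ a -ᶻ g *ᶻ b
      lem = ℤRS.solve-∀
      scale : ∀ a b → ∣ pos (G * a) -ᶻ pos (G * b) ∣ ≡ ∣ pos a -ᶻ pos b ∣ * G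
      scale a b = trans (cong ∣_∣ (trans (cong₂ _-ᶻ_ (ℤP.pos-* G a) (ℤP.pos-* G b)) (sym (lem (pos G) (pos a) (pos b)))))
        (trans (ℤP.∣i*j∣≡∣i∣*∣j∣ (pos G) (pos a -ᶻ pos b)) (*-comm G _))
      eq : ∣ pos (G * a) -ᶻ pos (G * b) ∣ ≡ ∣ c (diff P P′) i ∣ * G
      eq = trans (scale a b) (cong (λ z → ∣ z ∣ * G) (sym (c-diff P P′ i)))

    Coincidence : Set
    Coincidence = Σ (ℕ → ℕ) λ P → Σ (ℕ → ℕ) λ P′ →
      (∀ j → j < n → P j < B) × (∀ j → j < n → P′ j < B) ×
      (Σ ℕ λ j → j < n × P j ≢ P′ j) × (∀ i → i < I → class P i ≡ class P′ i)

    no-coincidence : ¬ Coincidence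
    no-coincidence (P , P′ , P<B , P′<B , differ , same) = aux-vanish⇒⊥ P P′ differ
      (Estimate.aux-zero (diff P P′) (λ j j<n → ∣pos-pos∣≤ (<⇒≤ (P<B j j<n)) (<⇒≤ (P′<B j j<n)))
        (λ i i<I → c-small P P′ i (same i i<I)))

  impossible : ⊥
  impossible = no-coincidence (pigeonhole-family n B I M class class-bound count)

-- Bernoulli's inequality and homogeneous monomials.

^-cancelʳ-≤ : ∀ {a b} n .{{_ : NonZero n}} → a ^ n ≤ b ^ n → a ≤ b
^-cancelʳ-≤ {a} {b} n aⁿ≤bⁿ with a ≤? b
... | yes a≤b = a≤b
... | no a≰b  = ⊥-elim (<⇒≱ (^-monoˡ-< n (≰⇒> a≰b)) aⁿ≤bⁿ)

-- Bernoulli's inequality for `(1 + d / w) ^ T`, cleared of denominators.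
bernoulli : ∀ w d T → w ^ T * (w + T * d) ≤ w * (w + d) ^ T
bernoulli w d zero    = ≤-reflexive (lem w d)
  where
  lem : ∀ w d → 1 * (w + 0 * d) ≡ w * 1
  lem = solve-∀
bernoulli w d (suc T) = begin
  w * w ^ T * (w + suc T * d)                      ≤⟨ m≤m+n _ (w ^ T * (T * d * d)) ⟩
  w * w ^ T * (w + suc T * d) + w ^ T * (T * d * d) ≡⟨ lem w d T (w ^ T) ⟩
  (w + d) * (w ^ T * (w + T * d))                  ≤⟨ *-monoʳ-≤ (w + d) (bernoulli w d T) ⟩
  (w + d) * (w * (w + d) ^ T)                      ≡⟨ lem₂ w (w + d) ((w + d) ^ T) ⟩
  w * ((w + d) * (w + d) ^ T) ∎
  where
  open ≤-Reasoning
  lem : ∀ w d T x → w * x * (w + suc T * d) + x * (T * d * d) ≡ (w + d) * (x * (w + T * d))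
  lem = solve-∀
  lem₂ : ∀ w y z → y * (w * z) ≡ w * (y * z)
  lem₂ = solve-∀

-- By Bernoulli, `1 + T (b - a) / a` is at most `(b / a) ^ T`, hence at most 2.
≤2^T⇒close : ∀ a b T .{{_ : NonZero a}} → a ≤ b → b ^ T ≤ 2 * a ^ T → T * (b ∸ a) ≤ a
≤2^T⇒close a b T a≤b bT≤ = +-cancelˡ-≤ a _ _ (*-cancelˡ-≤ (a ^ T) {{m^n≢0 a T}} (begin
  a ^ T * (a + T * (b ∸ a)) ≤⟨ bernoulli a (b ∸ a) T ⟩
  a * (a + (b ∸ a)) ^ T     ≡⟨ cong (λ c → a * c ^ T) (m+[n∸m]≡n a≤b) ⟩
  a * b ^ T                 ≤⟨ *-monoʳ-≤ a bT≤ ⟩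
  a * (2 * a ^ T)           ≡⟨ lem a (a ^ T) ⟩
  a ^ T * (a + a) ∎))
  where
  open ≤-Reasoning
  lem : ∀ a x → a * (2 * x) ≡ x * (a + a)
  lem = solve-∀

-- The l-th of the L = L′ + 1 monomials in Y, W of degree L′.
monomial : ℕ → ℕ → ℕ → ℕ → ℕ
monomial L′ Y W l = Y ^ l * W ^ (L′ ∸ l)

monomial-* : ∀ L′ Y W U V l → monomial L′ (Y * U) (W * V) l ≡ monomial L′ Y W l * monomial L′ U V l
monomial-* L′ Y W U V l = trans (cong₂ _*_ (*-^ Y U l) (*-^ W V (L′ ∸ l))) (lem (Y ^ l) (U ^ l) (W ^ (L′ ∸ l)) (V ^ (L′ ∸ l)))
  where
  lem : ∀ a b c d → a * b * (c * d) ≡ a * c * (b * d)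
  lem = solve-∀

monomial-^ : ∀ L′ Y W l x → monomial L′ Y W l ^ x ≡ monomial L′ (Y ^ x) (W ^ x) l
monomial-^ L′ Y W l x = trans (*-^ (Y ^ l) (W ^ (L′ ∸ l)) x) (cong₂ _*_ (commute Y l) (commute W (L′ ∸ l)))
  where
  commute : ∀ a m → (a ^ m) ^ x ≡ (a ^ x) ^ m
  commute a m = trans (^-*-assoc a m x) (trans (cong (a ^_) (*-comm m x)) (sym (^-*-assoc a x m)))

monomial-≤ : ∀ L′ Y W Z l → l ≤ L′ → Y ≤ Z → W ≤ Z → monomial L′ Y W l ≤ Z ^ L′
monomial-≤ L′ Y W Z l l≤L′ Y≤Z W≤Z = ≤-trans (*-mono-≤ (^-monoˡ-≤ l Y≤Z) (^-monoˡ-≤ (L′ ∸ l) W≤Z))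
  (≤-reflexive (trans (sym (^-distribˡ-+-* Z l (L′ ∸ l))) (cong (Z ^_) (m+[n∸m]≡n l≤L′))))

monomial-≥ : ∀ L′ Y W l → l ≤ L′ → W ≤ Y → W ^ L′ ≤ monomial L′ Y W l
monomial-≥ L′ Y W l l≤L′ W≤Y = ≤-trans (≤-reflexive (trans (cong (W ^_) (sym (m+[n∸m]≡n l≤L′))) (^-distribˡ-+-* W l (L′ ∸ l))))
  (*-monoˡ-≤ (W ^ (L′ ∸ l)) (^-monoˡ-≤ l W≤Y))

monomial-< : ∀ L′ Y W l l′ .{{_ : NonZero W}} → W < Y → l < l′ → l′ ≤ L′ → monomial L′ Y W l < monomial L′ Y W l′
monomial-< L′ Y W l l′ W<Y l<l′ l′≤L′ = begin-strict
  Y ^ l * W ^ (L′ ∸ l)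
    ≡⟨ cong (λ m → Y ^ l * W ^ m) split ⟩
  Y ^ l * W ^ (e + (L′ ∸ l′))
    ≡⟨ cong (Y ^ l *_) (^-distribˡ-+-* W e (L′ ∸ l′)) ⟩
  Y ^ l * (W ^ e * W ^ (L′ ∸ l′))
    <⟨ *-monoʳ-< (Y ^ l) {{m^n≢0 Y l {{Y≢0}}}} (*-monoˡ-< (W ^ (L′ ∸ l′)) {{m^n≢0 W (L′ ∸ l′)}} (^-monoˡ-< e {{>-nonZero (m<n⇒0<n∸m l<l′)}} W<Y)) ⟩
  Y ^ l * (Y ^ e * W ^ (L′ ∸ l′))
    ≡⟨ *-assoc (Y ^ l) (Y ^ e) _ ⟨
  Y ^ l * Y ^ e * W ^ (L′ ∸ l′)
    ≡⟨ cong (_* W ^ (L′ ∸ l′)) (trans (sym (^-distribˡ-+-* Y l e)) (cong (Y ^_) (m+[n∸m]≡n (<⇒≤ l<l′)))) ⟩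
  Y ^ l′ * W ^ (L′ ∸ l′) ∎
  where
  open ≤-Reasoning
  e = l′ ∸ l
  Y≢0 : NonZero Y
  Y≢0 = >-nonZero (≤-<-trans z≤n W<Y)
  split : L′ ∸ l ≡ e + (L′ ∸ l′)
  split = +-cancelˡ-≡ l _ _ (trans (m+[n∸m]≡n (≤-trans (<⇒≤ l<l′) l′≤L′))
    (trans (sym (m+[n∸m]≡n l′≤L′)) (trans (cong (_+ (L′ ∸ l′)) (sym (m+[n∸m]≡n (<⇒≤ l<l′)))) (+-assoc l e _))))

monomial≢0 : ∀ L′ Y W l .{{_ : NonZero Y}} .{{_ : NonZero W}} → monomial L′ Y W l ≢ 0
monomial≢0 L′ Y W l e = ≢-nonZero⁻¹ (monomial L′ Y W l) {{m*n≢0 (Y ^ l) (W ^ (L′ ∸ l)) {{m^n≢0 Y l}} {{m^n≢0 W (L′ ∸ l)}}}} e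

monomial-1 : ∀ L′ Y l → monomial L′ Y 1 l ≡ Y ^ l
monomial-1 L′ Y l = trans (cong (Y ^ l *_) (^-zeroˡ (L′ ∸ l))) (*-identityʳ _)

∣-^-sub : ∀ {m} a b → m ℤ∣.∣ (pos a -ᶻ pos b) → ∀ l → m ℤ∣.∣ (pos (a ^ l) -ᶻ pos (b ^ l))
∣-^-sub a b m∣ zero    = ℤ∣.divides 0ℤ refl
∣-^-sub {m} a b m∣ (suc l) = subst (m ℤ∣.∣_)
  (trans (lem (pos a) (pos b) (pos (a ^ l)) (pos (b ^ l))) (cong₂ _-ᶻ_ (sym (ℤP.pos-* a (a ^ l))) (sym (ℤP.pos-* b (b ^ l)))))
  (ℤ∣.∣m∣n⇒∣m+n (ℤ∣.∣n⇒∣m*n (pos a) (∣-^-sub a b m∣ l)) (ℤ∣.∣m⇒∣m*n (pos (b ^ l)) m∣))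
  where
  lem : ∀ a b x y → a *ᶻ (x -ᶻ y) +ᶻ (a -ᶻ b) *ᶻ y ≡ a *ᶻ x -ᶻ b *ᶻ y
  lem = ℤRS.solve-∀

∣-*-sub : ∀ {m} c a b → m ℤ∣.∣ (pos a -ᶻ pos b) → m ℤ∣.∣ (pos (c * a) -ᶻ pos (c * b))
∣-*-sub {m} c a b m∣ = subst (m ℤ∣.∣_)
  (trans (lem (pos c) (pos a) (pos b)) (cong₂ _-ᶻ_ (sym (ℤP.pos-* c a)) (sym (ℤP.pos-* c b)))) (ℤ∣.∣n⇒∣m*n (pos c) m∣)
  where
  lem : ∀ c a b → c *ᶻ (a -ᶻ b) ≡ c *ᶻ a -ᶻ c *ᶻ b
  lem = ℤRS.solve-∀

∣∸1⇒∣^∸1 : ∀ E Y .{{_ : NonZero Y}} → E ℕ∣.∣ Y ∸ 1 → ∀ l → E ℕ∣.∣ Y ^ l ∸ 1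
∣∸1⇒∣^∸1 E Y E∣ zero    = E ℕ∣.∣0
∣∸1⇒∣^∸1 E Y E∣ (suc l) = subst (E ℕ∣.∣_) eq (ℕ∣.∣m∣n⇒∣m+n (ℕ∣.∣n⇒∣m*n Y (∣∸1⇒∣^∸1 E Y E∣ l)) E∣)
  where
  eq : Y * (Y ^ l ∸ 1) + (Y ∸ 1) ≡ Y * Y ^ l ∸ 1
  eq = begin
    Y * (Y ^ l ∸ 1) + (Y ∸ 1)   ≡⟨ +-∸-assoc (Y * (Y ^ l ∸ 1)) (>-nonZero⁻¹ Y) ⟨
    Y * (Y ^ l ∸ 1) + Y ∸ 1     ≡⟨ cong (_∸ 1) (trans (cong (Y * (Y ^ l ∸ 1) +_) (sym (*-identityʳ Y))) (trans (sym (*-distribˡ-+ Y (Y ^ l ∸ 1) 1)) (cong (Y *_) (m∸n+n≡m (m^n>0 Y l))))) ⟩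
    Y * Y ^ l ∸ 1 ∎
    where open ≡-Reasoning

-- Specialisation to the powers of a single number.

module 2-adicPowers (L′ K : ℕ) .{{_ : NonZero K}} (Y E : ℕ) (U V X : ℕ → ℕ) (R S : ℕ)
  .{{_ : NonZero Y}} (1<Y : 1 < Y) (E∣Y∸1 : E ℕ∣.∣ Y ∸ 1) (U≢0 : ∀ t → NonZero (U t)) (V≢0 : ∀ t → NonZero (V t))
  (gap : ∀ t → X t + (S + suc L′) ≤ X (suc t)) (big : 2 ^ suc L′ * K < R * S)
  (M B I C Z : ℕ) .{{_ : NonZero M}}
  (M∣E : M ℕ∣.∣ E ^ (I ∸ K))
  (close : ∀ t → t < R → pos M ℤ∣.∣ (pos (U t) -ᶻ pos (V t * Y ^ X t)))
  (count : M ^ I < B ^ (suc L′ * K))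
  (bin≤C : ∀ t s k → t < R → s < S + suc L′ → k < K → bin (X t + s) k ≤ C)
  (U≤Z : ∀ t s → t < R → s < S + suc L′ → U t * Y ^ s ≤ Z) (V≤Z : ∀ t → t < R → V t ≤ Z)
  (size : suc L′ * K * (B * (C * Z ^ L′)) < M) where

  private
    d : ℕ → ℕ
    d l = Y ^ l ∸ 1

    1+d : ∀ l → 1 + d l ≡ Y ^ l
    1+d l = m+[n∸m]≡n (m^n>0 Y l)

    -- The power `ζ ^ l` of `ζ = U t / V t`, multiplied by `V t ^ L′`; this factor clears the
    -- denominator for all `l` at once, and being independent of `l` it can serve as `Ω`.
    ω : ℕ → ℕ → ℕ
    ω t l = monomial L′ (U t) (V t) l

    close′ : ∀ t l → t < R → l < suc L′ → pos M ℤ∣.∣ (pos (ω t l) -ᶻ pos (V t ^ L′ * (1 + d l) ^ X t))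
    close′ t l t<R (s≤s l≤L′) = subst₂ (λ a b → pos M ℤ∣.∣ (pos a -ᶻ pos b))
      (*-comm (V t ^ (L′ ∸ l)) (U t ^ l)) eq
      (∣-*-sub (V t ^ (L′ ∸ l)) (U t ^ l) ((V t * Y ^ X t) ^ l) (∣-^-sub (U t) (V t * Y ^ X t) (close t t<R) l))
      where
      open ≡-Reasoning
      lem : ∀ a b c → a * (b * c) ≡ (b * a) * c
      lem = solve-∀
      eq : V t ^ (L′ ∸ l) * (V t * Y ^ X t) ^ l ≡ V t ^ L′ * (1 + d l) ^ X t
      eq = begin
        V t ^ (L′ ∸ l) * (V t * Y ^ X t) ^ l             ≡⟨ cong (V t ^ (L′ ∸ l) *_) (*-^ (V t) (Y ^ X t) l) ⟩
        V t ^ (L′ ∸ l) * (V t ^ l * (Y ^ X t) ^ l)       ≡⟨ lem (V t ^ (L′ ∸ l)) (V t ^ l) _ ⟩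
        V t ^ l * V t ^ (L′ ∸ l) * (Y ^ X t) ^ l         ≡⟨ cong₂ _*_ (trans (sym (^-distribˡ-+-* (V t) l (L′ ∸ l))) (cong (V t ^_) (m+[n∸m]≡n l≤L′)))
                                                              (trans (^-*-assoc Y (X t) l) (trans (cong (Y ^_) (*-comm (X t) l)) (sym (^-*-assoc Y l (X t))))) ⟩
        V t ^ L′ * (Y ^ l) ^ X t                         ≡⟨ cong (λ m → V t ^ L′ * m ^ X t) (1+d l) ⟨
        V t ^ L′ * (1 + d l) ^ X t ∎

    auxCoef≤ : ∀ t s → t < R → s < S + suc L′ → ∀ l → l < suc L′ → ∀ k → k < K →
      bin (X t + s) k * (1 + d l) ^ s * ω t l ≤ C * Z ^ L′
    auxCoef≤ t s t<R s< l (s≤s l≤L′) k k<K = ≤-trans (≤-reflexive (begin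
        bin (X t + s) k * (1 + d l) ^ s * ω t l       ≡⟨ *-assoc (bin (X t + s) k) _ (ω t l) ⟩
        bin (X t + s) k * ((1 + d l) ^ s * ω t l)     ≡⟨ cong (λ m → bin (X t + s) k * (m ^ s * ω t l)) (trans (1+d l) (sym (monomial-1 L′ Y l))) ⟩
        bin (X t + s) k * (monomial L′ Y 1 l ^ s * ω t l) ≡⟨ cong (λ m → bin (X t + s) k * (m * ω t l)) (trans (monomial-^ L′ Y 1 l s) (cong (λ o → monomial L′ (Y ^ s) o l) (^-zeroˡ s))) ⟩
        bin (X t + s) k * (monomial L′ (Y ^ s) 1 l * ω t l) ≡⟨ cong (bin (X t + s) k *_) (sym (monomial-* L′ (Y ^ s) 1 (U t) (V t) l)) ⟩
        bin (X t + s) k * monomial L′ (Y ^ s * U t) (1 * V t) l ∎))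
      (*-mono-≤ (bin≤C t s k t<R s< k<K) (monomial-≤ L′ _ _ Z l l≤L′
        (≤-trans (≤-reflexive (*-comm (Y ^ s) (U t))) (U≤Z t s t<R s<)) (≤-trans (≤-reflexive (*-identityˡ (V t))) (V≤Z t t<R))))
      where open ≡-Reasoning

    d≢ : ∀ l l′ → l < l′ → l′ < suc L′ → d l ≢ d l′
    d≢ l l′ l<l′ _ e = <⇒≢ (^-monoʳ-< Y 1<Y l<l′) (trans (sym (1+d l)) (trans (cong suc e) (1+d l′)))

  impossible : ⊥
  impossible = 2-adic.impossible (suc L′) K d ω X R S
    (λ t l → monomial≢0 L′ (U t) (V t) l {{U≢0 t}} {{V≢0 t}}) d≢ gap big
    M E B I (C * Z ^ L′) (λ t → V t ^ L′) M∣E (λ l _ → ∣∸1⇒∣^∸1 E Y E∣Y∸1 l) close′ count auxCoef≤ size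

∣-∣-scale : ∀ c a b → ∣ pos (c * a) -ᶻ pos (c * b) ∣ ≡ c * ∣ pos a -ᶻ pos b ∣
∣-∣-scale c a b = trans (cong ∣_∣ (trans (cong₂ _-ᶻ_ (ℤP.pos-* c a) (ℤP.pos-* c b)) (lem (pos c) (pos a) (pos b))))
  (ℤP.∣i*j∣≡∣i∣*∣j∣ (pos c) (pos a -ᶻ pos b))
  where
  lem : ∀ c a b → c *ᶻ a -ᶻ c *ᶻ b ≡ c *ᶻ (a -ᶻ b)
  lem = ℤRS.solve-∀

module ArchimedeanPowers (L′ K : ℕ) .{{_ : NonZero K}} (Y W : ℕ) (U V X : ℕ → ℕ) (R S : ℕ)
  .{{_ : NonZero W}} (W<Y : W < Y) (U≢0 : ∀ t → NonZero (U t)) (V≢0 : ∀ t → NonZero (V t))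
  (gap : ∀ t → X t + (S + suc L′) ≤ X (suc t)) (big : 2 ^ suc L′ * K < R * S)
  (D β B J I C G M Z H xmax A A′ : ℕ)
  .{{_ : NonZero D}} .{{_ : NonZero β}} .{{_ : NonZero G}} .{{_ : NonZero H}} .{{_ : NonZero Z}} .{{_ : NonZero A}}
  (Y≈W : Y ^ (suc L′ * (D * β)) ≤ 2 * W ^ (suc L′ * (D * β)))
  (exp≤ : ∀ x → x ≤ xmax → (1 + D) ^ x ≤ J * D ^ x)
  (X≤ : ∀ t s → t < R → s < S + suc L′ → X t + s ≤ xmax)
  (bin≤C : ∀ x k → x ≤ xmax → k < K → bin x k ≤ C)
  (related : ∀ t → t < R → U t * W ^ X t * A ^ t ≡ V t * Y ^ X t * A′ ^ t)
  (near : ∀ m → m ≤ R * L′ → ∣ pos (A′ ^ m) -ᶻ pos (A ^ m) ∣ * H ≤ A ^ m)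
  (V≤Z : ∀ t s → t < R → s < S + suc L′ → V t * W ^ s ≤ Z)
  (class< : G * (suc L′ * K * (B * 2 ^ (I + K))) < M)
  (count : M ^ I < B ^ (suc L′ * K))
  (head-small : D ^ I * J * (4 * Z ^ L′) ≤ G)
  (tail-small : suc L′ * K * (B * (C * 2 ^ K * J)) * (4 * Z ^ L′) ≤ β ^ (I ∸ K))
  (error-small : suc L′ * K * (B * (C * J)) * (4 * Z ^ L′) ≤ H) where

  private
    T w : ℕ
    T = D * β
    w = W ^ L′

    instance
      Y≢0 : NonZero Y
      Y≢0 = >-nonZero (≤-<-trans z≤n W<Y)

      w≢0 : NonZero w
      w≢0 = m^n≢0 W L′

      Z^≢0 : NonZero (Z ^ L′)
      Z^≢0 = m^n≢0 Z L′

    d : ℕ → ℕ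
    d l = monomial L′ Y W l ∸ w

    w+d : ∀ l → l ≤ L′ → w + d l ≡ monomial L′ Y W l
    w+d l l≤L′ = m+[n∸m]≡n (monomial-≥ L′ Y W l l≤L′ (<⇒≤ W<Y))

    ω : ℕ → ℕ → ℕ
    ω t l = monomial L′ (U t) (V t) l

    -- As `W < Y`, the exponent `l * T` can be padded to the exponent `suc L′ * T` of `Y≈W`.
    power-close : ∀ l → l ≤ L′ → (Y ^ l) ^ T ≤ 2 * (W ^ l) ^ T
    power-close l l≤L′ = *-cancelʳ-≤ _ _ (W ^ (e * T)) {{m^n≢0 W (e * T)}} (begin
      (Y ^ l) ^ T * W ^ (e * T)     ≤⟨ *-mono-≤ (≤-reflexive (^-*-assoc Y l T)) (^-monoˡ-≤ (e * T) (<⇒≤ W<Y)) ⟩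
      Y ^ (l * T) * Y ^ (e * T)     ≡⟨ trans (sym (^-distribˡ-+-* Y (l * T) (e * T))) (cong (Y ^_) l+e) ⟩
      Y ^ (suc L′ * T)              ≤⟨ Y≈W ⟩
      2 * W ^ (suc L′ * T)          ≡⟨ cong (2 *_) (trans (cong (W ^_) (sym l+e)) (^-distribˡ-+-* W (l * T) (e * T))) ⟩
      2 * (W ^ (l * T) * W ^ (e * T)) ≡⟨ *-assoc 2 (W ^ (l * T)) (W ^ (e * T)) ⟨
      2 * W ^ (l * T) * W ^ (e * T) ≡⟨ cong (λ u → 2 * u * W ^ (e * T)) (^-*-assoc W l T) ⟨
      2 * (W ^ l) ^ T * W ^ (e * T) ∎)
      where
      open ≤-Reasoning
      e = suc L′ ∸ l
      l+e : l * T + e * T ≡ suc L′ * T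
      l+e = trans (sym (*-distribʳ-+ T l e)) (cong (_* T) (m+[n∸m]≡n (m≤n⇒m≤1+n l≤L′)))

    d-small : ∀ l → l < suc L′ → D * (β * d l) ≤ w
    d-small l (s≤s l≤L′) = begin
      D * (β * d l)
        ≡⟨ *-assoc D β (d l) ⟨
      T * (Y ^ l * W ^ e ∸ w)
        ≡⟨ cong (λ u → T * (Y ^ l * W ^ e ∸ u)) split ⟩
      T * (Y ^ l * W ^ e ∸ W ^ l * W ^ e)
        ≡⟨ cong (T *_) (*-distribʳ-∸ (W ^ e) (Y ^ l) (W ^ l)) ⟨
      T * ((Y ^ l ∸ W ^ l) * W ^ e)
        ≡⟨ *-assoc T _ _ ⟨
      T * (Y ^ l ∸ W ^ l) * W ^ e
        ≤⟨ *-monoˡ-≤ (W ^ e) (≤2^T⇒close (W ^ l) (Y ^ l) T {{m^n≢0 W l}} (^-monoˡ-≤ l (<⇒≤ W<Y)) (power-close l l≤L′)) ⟩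
      W ^ l * W ^ e
        ≡⟨ split ⟨
      w ∎
      where
      open ≤-Reasoning
      e = L′ ∸ l
      split : w ≡ W ^ l * W ^ e
      split = trans (cong (W ^_) (sym (m+[n∸m]≡n l≤L′))) (^-distribˡ-+-* W l e)

    -- By `related` the quotient of the two numbers compared is `(A′ / A) ^ (t * l)`, and `near`
    -- bounds its distance from 1.
    close : ∀ t l → t < R → l < suc L′ →
      ∣ pos (w ^ X t * ω t l) -ᶻ pos (V t ^ L′ * (w + d l) ^ X t) ∣ * H ≤ V t ^ L′ * (w + d l) ^ X t
    close t l t<R (s≤s l≤L′) = subst₂ (λ a b → ∣ pos a -ᶻ pos b ∣ * H ≤ b) (sym eq₁) (sym eq₂)
      (*-cancelˡ-≤ (A ^ (t * l)) {{m^n≢0 A (t * l)}} (begin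
        α * (∣ pos (z * r ^ l) -ᶻ pos (z * r′ ^ l) ∣ * H)
          ≡⟨ *-assoc α _ H ⟨
        α * ∣ pos (z * r ^ l) -ᶻ pos (z * r′ ^ l) ∣ * H
          ≡⟨ cong (_* H) (∣-∣-scale α _ _) ⟨
        ∣ pos (α * (z * r ^ l)) -ᶻ pos (α * (z * r′ ^ l)) ∣ * H
          ≡⟨ cong₂ (λ a b → ∣ pos a -ᶻ pos b ∣ * H) swapped (trans (*-comm α _) refl) ⟩
        ∣ pos (z * r′ ^ l * α′) -ᶻ pos (z * r′ ^ l * α) ∣ * H
          ≡⟨ cong (_* H) (∣-∣-scale (z * r′ ^ l) α′ α) ⟩
        z * r′ ^ l * ∣ pos α′ -ᶻ pos α ∣ * H
          ≡⟨ *-assoc (z * r′ ^ l) _ H ⟩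
        z * r′ ^ l * (∣ pos α′ -ᶻ pos α ∣ * H)
          ≤⟨ *-monoʳ-≤ (z * r′ ^ l) (near (t * l) (*-mono-≤ (<⇒≤ t<R) l≤L′)) ⟩
        z * r′ ^ l * α
          ≡⟨ *-comm _ α ⟩
        α * (z * r′ ^ l) ∎))
      where
      open ≤-Reasoning
      x = X t
      r  = U t * W ^ x
      r′ = V t * Y ^ x
      z  = (V t * W ^ x) ^ (L′ ∸ l)
      α  = A ^ (t * l)
      α′ = A′ ^ (t * l)
      lem : ∀ a b c → a * (b * c) ≡ b * (c * a)
      lem = solve-∀
      swapped : α * (z * r ^ l) ≡ z * r′ ^ l * α′
      swapped = trans (lem α z (r ^ l)) (trans (cong (z *_)
        (trans (cong (r ^ l *_) (sym (^-*-assoc A t l))) (trans (sym (*-^ r (A ^ t) l)) (trans (cong (_^ l) (related t t<R))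
          (trans (*-^ r′ (A′ ^ t) l) (cong (r′ ^ l *_) (^-*-assoc A′ t l))))))) (sym (*-assoc z (r′ ^ l) α′)))
      w^x : w ^ x ≡ (W ^ x) ^ l * (W ^ x) ^ (L′ ∸ l)
      w^x = trans (^-*-assoc W L′ x) (trans (cong (W ^_) (*-comm L′ x)) (trans (sym (^-*-assoc W x L′))
        (trans (cong ((W ^ x) ^_) (sym (m+[n∸m]≡n l≤L′))) (^-distribˡ-+-* (W ^ x) l (L′ ∸ l)))))
      lem₂ : ∀ a b c d → a * b * (c * d) ≡ d * b * (c * a)
      lem₂ = solve-∀
      eq₁ : w ^ x * ω t l ≡ z * r ^ l
      eq₁ = trans (cong (_* ω t l) w^x) (trans (lem₂ ((W ^ x) ^ l) ((W ^ x) ^ (L′ ∸ l)) (U t ^ l) (V t ^ (L′ ∸ l)))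
        (cong₂ _*_ (sym (*-^ (V t) (W ^ x) (L′ ∸ l))) (sym (*-^ (U t) (W ^ x) l))))
      lem₃ : ∀ a b c d → a * b * (c * d) ≡ b * d * (a * c)
      lem₃ = solve-∀
      eq₂ : V t ^ L′ * (w + d l) ^ x ≡ z * r′ ^ l
      eq₂ = trans (cong₂ _*_ (trans (cong (V t ^_) (sym (m+[n∸m]≡n l≤L′))) (^-distribˡ-+-* (V t) l (L′ ∸ l)))
          (trans (cong (_^ x) (w+d l l≤L′)) (monomial-^ L′ Y W l x)))
        (trans (lem₃ (V t ^ l) (V t ^ (L′ ∸ l)) ((Y ^ x) ^ l) ((W ^ x) ^ (L′ ∸ l)))
          (cong₂ _*_ (sym (*-^ (V t) (W ^ x) (L′ ∸ l))) (sym (*-^ (V t) (Y ^ x) l))))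

    Ω≤ : ∀ t s → t < R → s < S + suc L′ → V t ^ L′ * w ^ s ≤ Z ^ L′
    Ω≤ t s t<R s< = ≤-trans (≤-reflexive (trans (cong (V t ^ L′ *_) (trans (^-*-assoc W L′ s) (trans (cong (W ^_) (*-comm L′ s)) (sym (^-*-assoc W s L′)))))
      (sym (*-^ (V t) (W ^ s) L′)))) (^-monoˡ-≤ L′ (V≤Z t s t<R s<))

    d≢ : ∀ l l′ → l < l′ → l′ < suc L′ → d l ≢ d l′
    d≢ l l′ l<l′ (s≤s l′≤L′) e = <⇒≢ (monomial-< L′ Y W l l′ W<Y l<l′ l′≤L′)
      (trans (sym (w+d l (≤-trans (<⇒≤ l<l′) l′≤L′))) (trans (cong (w +_) e) (w+d l′ l′≤L′)))

  impossible : ⊥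
  impossible = Archimedean.impossible (suc L′) K w d ω X R S
    (λ t l → monomial≢0 L′ (U t) (V t) l {{U≢0 t}} {{V≢0 t}}) d≢ gap big
    D β B J I C G M (Z ^ L′) H xmax (λ t → V t ^ L′)
    d-small exp≤ X≤ bin≤C close Ω≤ class< count head-small tail-small error-small

-- Explicit powers of 2 and bounds for `(1 + 1 / D) ^ x`.

-- Opaque, so that the huge literal powers below are never computed.
opaque
  pw : ℕ → ℕ
  pw n = 2 ^ n

  pw≡2^ : ∀ n → pw n ≡ 2 ^ n
  pw≡2^ n = refl

pw-+ : ∀ m n → pw (m + n) ≡ pw m * pw n
pw-+ m n = trans (pw≡2^ (m + n)) (trans (^-distribˡ-+-* 2 m n) (sym (cong₂ _*_ (pw≡2^ m) (pw≡2^ n))))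

pw-^ : ∀ m n → pw m ^ n ≡ pw (m * n)
pw-^ m n = trans (cong (_^ n) (pw≡2^ m)) (trans (^-*-assoc 2 m n) (sym (pw≡2^ (m * n))))

pw-mono-≤ : ∀ {m n} → m ≤ n → pw m ≤ pw n
pw-mono-≤ {m} {n} m≤n = subst₂ _≤_ (sym (pw≡2^ m)) (sym (pw≡2^ n)) (^-monoʳ-≤ 2 m≤n)

pw-mono-< : ∀ {m n} → m < n → pw m < pw n
pw-mono-< {m} {n} m<n = subst₂ _<_ (sym (pw≡2^ m)) (sym (pw≡2^ n)) (^-monoʳ-< 2 (s≤s (s≤s z≤n)) m<n)

instance
  pw≢0 : ∀ {n} → NonZero (pw n)
  pw≢0 {n} = subst NonZero (sym (pw≡2^ n)) (m^n≢0 2 n)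

n≤pw : ∀ n → n ≤ pw n
n≤pw n = subst (n ≤_) (sym (pw≡2^ n)) (n≤2^n n)
  where
  n≤2^n : ∀ n → n ≤ 2 ^ n
  n≤2^n zero    = z≤n
  n≤2^n (suc n) = ≤-trans (+-mono-≤ (m^n>0 2 n) (n≤2^n n)) (≤-reflexive (cong (2 ^ n +_) (sym (+-identityʳ (2 ^ n)))))

infixl 7 _⊠_
_⊠_ : ∀ {x y m n} → x ≤ pw m → y ≤ pw n → x * y ≤ pw (m + n)
_⊠_ {m = m} {n} x≤ y≤ = ≤-trans (*-mono-≤ x≤ y≤) (≤-reflexive (sym (pw-+ m n)))

2* : ∀ n → 2 * pw n ≡ pw (suc n)
2* n = trans (cong (_* pw n) (sym (pw≡2^ 1))) (sym (pw-+ 1 n))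

-- The reciprocal of Bernoulli's inequality `(1 - 1 / (1 + D)) ^ j ≥ 1 - j / (1 + D)`, an upper
-- bound for `(1 + 1 / D) ^ j`.
pow-half : ∀ D j → j ≤ D → (1 + D) ^ j * (1 + D ∸ j) ≤ (1 + D) * D ^ j
pow-half D zero    _   = ≤-reflexive (*-comm 1 (1 + D))
pow-half D (suc j) j<D = begin
  (1 + D) * (1 + D) ^ j * (D ∸ j)       ≡⟨ lem (1 + D) ((1 + D) ^ j) (D ∸ j) ⟩
  (1 + D) ^ j * ((1 + D) * (D ∸ j))     ≤⟨ *-monoʳ-≤ ((1 + D) ^ j) step ⟩
  (1 + D) ^ j * ((1 + D ∸ j) * D)       ≡⟨ *-assoc ((1 + D) ^ j) _ D ⟨
  (1 + D) ^ j * (1 + D ∸ j) * D         ≤⟨ *-monoˡ-≤ D (pow-half D j (<⇒≤ j<D)) ⟩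
  (1 + D) * D ^ j * D                   ≡⟨ trans (*-assoc (1 + D) (D ^ j) D) (cong ((1 + D) *_) (*-comm (D ^ j) D)) ⟩
  (1 + D) * (D * D ^ j) ∎
  where
  open ≤-Reasoning
  lem : ∀ a b c → a * b * c ≡ b * (a * c)
  lem = solve-∀
  step : (1 + D) * (D ∸ j) ≤ (1 + D ∸ j) * D
  step = begin
    (D ∸ j) + D * (D ∸ j) ≤⟨ +-monoˡ-≤ (D * (D ∸ j)) (m∸n≤m D j) ⟩
    D + D * (D ∸ j)       ≡⟨ cong (D +_) (*-comm D (D ∸ j)) ⟩
    suc (D ∸ j) * D       ≡⟨ cong (_* D) (+-∸-assoc 1 (<⇒≤ j<D)) ⟨
    (1 + D ∸ j) * D ∎

-- For `D = 2 * j` the bound of `pow-half` is `(1 + 2 j) / (1 + j)`, which is below 2.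
exp-2 : ∀ j .{{_ : NonZero j}} → (1 + 2 * j) ^ j ≤ 2 * (2 * j) ^ j
exp-2 j = *-cancelʳ-≤ _ _ (suc j) (begin
  (1 + 2 * j) ^ j * suc j            ≡⟨ cong ((1 + 2 * j) ^ j *_) (sym (trans (cong (_∸ j) (lem j)) (m+n∸n≡m (suc j) j))) ⟩
  (1 + 2 * j) ^ j * (1 + 2 * j ∸ j)  ≤⟨ pow-half (2 * j) j (m≤n*m j 2) ⟩
  (1 + 2 * j) * (2 * j) ^ j          ≤⟨ *-monoˡ-≤ ((2 * j) ^ j) (≤-trans (n≤1+n _) (≤-reflexive (lem₂ j))) ⟩
  2 * suc j * (2 * j) ^ j            ≡⟨ lem₃ (suc j) ((2 * j) ^ j) ⟩
  2 * (2 * j) ^ j * suc j ∎)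
  where
  open ≤-Reasoning
  lem : ∀ j → 1 + 2 * j ≡ suc j + j
  lem = solve-∀
  lem₂ : ∀ j → suc (1 + 2 * j) ≡ 2 * suc j
  lem₂ = solve-∀
  lem₃ : ∀ a b → 2 * a * b ≡ 2 * b * a
  lem₃ = solve-∀

exp-bound : ∀ D j k x → .{{_ : NonZero D}} → .{{_ : NonZero j}} → D ≡ 2 * j → x ≤ k * j → (1 + D) ^ x ≤ 2 ^ k * D ^ x
exp-bound D j k x refl x≤ = *-cancelʳ-≤ _ _ (D ^ e) {{m^n≢0 D e}} (begin
  (1 + D) ^ x * D ^ e         ≤⟨ *-monoʳ-≤ ((1 + D) ^ x) (^-monoˡ-≤ e (n≤1+n D)) ⟩
  (1 + D) ^ x * (1 + D) ^ e   ≡⟨ trans (sym (^-distribˡ-+-* (1 + D) x e)) (cong ((1 + D) ^_) x+e) ⟩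
  (1 + D) ^ (j * k)           ≡⟨ ^-*-assoc (1 + D) j k ⟨
  ((1 + D) ^ j) ^ k           ≤⟨ ^-monoˡ-≤ k (exp-2 j) ⟩
  (2 * D ^ j) ^ k             ≡⟨ *-^ 2 (D ^ j) k ⟩
  2 ^ k * (D ^ j) ^ k         ≡⟨ cong (2 ^ k *_) (trans (^-*-assoc D j k) (trans (cong (D ^_) (sym x+e)) (^-distribˡ-+-* D x e))) ⟩
  2 ^ k * (D ^ x * D ^ e)     ≡⟨ *-assoc (2 ^ k) _ _ ⟨
  2 ^ k * D ^ x * D ^ e ∎)
  where
  open ≤-Reasoning
  e = k * j ∸ x
  x+e : x + e ≡ j * k
  x+e = trans (m+[n∸m]≡n x≤) (*-comm k j)

bin-*-^≤ : ∀ D x k → bin x k * D ^ (x ∸ k) ≤ (1 + D) ^ x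
bin-*-^≤ D x       zero    = ≤-trans (≤-reflexive (*-identityˡ (D ^ x))) (^-monoˡ-≤ x (n≤1+n D))
bin-*-^≤ D zero    (suc k) = z≤n
bin-*-^≤ D (suc x) (suc k) = begin
  (bin x k + bin x (suc k)) * D ^ (x ∸ k)              ≡⟨ *-distribʳ-+ (D ^ (x ∸ k)) (bin x k) _ ⟩
  bin x k * D ^ (x ∸ k) + bin x (suc k) * D ^ (x ∸ k)  ≤⟨ +-mono-≤ (bin-*-^≤ D x k) second ⟩
  (1 + D) ^ x + D * (1 + D) ^ x ∎
  where
  open ≤-Reasoning
  lem : ∀ b d e → b * (d * e) ≡ d * (b * e)
  lem = solve-∀
  second : bin x (suc k) * D ^ (x ∸ k) ≤ D * (1 + D) ^ x
  second with k <? x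
  ... | yes k<x = ≤-trans (≤-reflexive (trans (cong (λ m → bin x (suc k) * D ^ m) (+-∸-assoc 1 k<x)) (lem (bin x (suc k)) D (D ^ (x ∸ suc k)))))
                    (*-monoʳ-≤ D (bin-*-^≤ D x (suc k)))
  ... | no k≮x rewrite n<k⇒bin≡0 x (suc k) (s≤s (≮⇒≥ k≮x)) = z≤n

-- A single term of the binomial expansion of `(1 + D) ^ x`. The trivial bound `2 ^ x` would be
-- useless here, because `x` may be as large as `2 ^ 806 * K` while `k < K`.
bin-bound : ∀ D J x k .{{_ : NonZero D}} → (1 + D) ^ x ≤ J * D ^ x → bin x k ≤ D ^ k * J
bin-bound D J x k le with k ≤? x
... | no k≰x rewrite n<k⇒bin≡0 x k (≰⇒> k≰x) = z≤n
... | yes k≤x = *-cancelʳ-≤ _ _ (D ^ (x ∸ k)) {{m^n≢0 D (x ∸ k)}} (≤-trans (bin-*-^≤ D x k) (≤-trans le (≤-reflexive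
    (trans (cong (J *_) (trans (cong (D ^_) (sym (m+[n∸m]≡n k≤x))) (^-distribˡ-+-* D k (x ∸ k)))) (lem J (D ^ k) (D ^ (x ∸ k)))))))
  where
  lem : ∀ J a b → J * (a * b) ≡ a * J * b
  lem = solve-∀

-- The numerical parameters.

-- Everything is a power 2^(K c): coefficients of the auxiliary polynomial are below 2^(1000 K),
-- there are 256 K of them against I = 16 K conditions, and the points lie on the curve z = β^x
-- up to an error 2^(-2000 K), 2-adic or (relatively) real.
module Parameters (L′ : ℕ) (L′≡255 : L′ ≡ 255) (K : ℕ) (8≤K : 8 ≤ K) where

  pwK : ℕ → ℕ
  pwK c = pw (K * c)

  instance
    K≢0 : NonZero K
    K≢0 = >-nonZero (≤-trans (s≤s z≤n) 8≤K)

  pwK-mono : ∀ {m n} → m ≤ n → pwK m ≤ pwK n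
  pwK-mono m≤n = pw-mono-≤ (*-monoʳ-≤ K m≤n)

  pwK-mono-< : ∀ {m n} → m < n → pwK m < pwK n
  pwK-mono-< m<n = pw-mono-< (*-monoʳ-< K m<n)

  infixl 7 _⊡_
  _⊡_ : ∀ {x y m n} → x ≤ pwK m → y ≤ pwK n → x * y ≤ pwK (m + n)
  _⊡_ {x} {y} {m} {n} x≤ y≤ = ≤-trans (x≤ ⊠ y≤) (≤-reflexive (cong pw (sym (*-distribˡ-+ K m n))))

  pwK-^ : ∀ c i → pwK c ^ (K * i) ≡ pw (K * K * (c * i))
  pwK-^ c i = trans (pw-^ (K * c) (K * i)) (cong pw (lem K c i))
    where
    lem : ∀ K c i → K * c * (K * i) ≡ K * K * (c * i)
    lem = solve-∀

  2^K≤ : 2 ^ K ≤ pwK 1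
  2^K≤ = ≤-reflexive (trans (sym (pw≡2^ K)) (cong pw (sym (*-identityʳ K))))

  L : ℕ
  L = suc L′

  L≡pw8 : L ≡ pw 8
  L≡pw8 = trans (cong suc L′≡255) (sym (pw≡2^ 8))

  -- One `pwK 1` pays for `L = 2 ^ 8`, as `8 ≤ K`, the other for `K ≤ 2 ^ K`.
  LK≤ : L * K ≤ pwK 2
  LK≤ = (≤-trans (≤-reflexive L≡pw8) (pw-mono-≤ (≤-trans 8≤K (≤-reflexive (sym (*-identityʳ K))))))
    ⊡ (≤-trans (n≤pw K) (pw-mono-≤ (≤-reflexive (sym (*-identityʳ K)))))

  LK≡ : L * K ≡ K * 256
  LK≡ = trans (cong (λ l → suc l * K) L′≡255) (*-comm 256 K)

  count : ∀ c c′ → c * 16 < c′ * 256 → pwK c ^ (K * 16) < pwK c′ ^ (L * K)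
  count c c′ lt = subst₂ _<_ (sym (pwK-^ c 16)) (trans (sym (pwK-^ c′ 256)) (cong (pwK c′ ^_) (sym LK≡)))
    (pw-mono-< (*-monoʳ-< (K * K) {{m*n≢0 K K}} lt))

  4Q≤ : ∀ {Q} → Q ≤ pwK 2 → 4 * Q ≤ pwK 3
  4Q≤ {Q} Q≤ = ≤-trans (≤-reflexive (cong (_* Q) (sym (pw≡2^ 2)))) (pw-mono-≤ {2} (≤-trans (≤-trans (s≤s (s≤s z≤n)) 8≤K) (≤-reflexive (sym (*-identityʳ K)))) ⊡ Q≤)

  size : ∀ {Q} → Q ≤ pwK 2 → L * K * (pwK 1000 * (pwK 808 * Q)) < pwK 2000
  size Q≤ = ≤-<-trans (LK≤ ⊡ (≤-refl ⊡ (≤-refl {pwK 808} ⊡ Q≤))) (pwK-mono-< (≤ᵇ⇒≤ 1813 2000 _))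

  gain-exponent : K * 16 ∸ K ≡ K * 15
  gain-exponent = trans (cong (K * 16 ∸_) (sym (*-identityʳ K))) (sym (*-distribˡ-∸ K 16 1))

  gain : pw 512 ^ (K * 16 ∸ K) ≡ pwK 7680
  gain = trans (cong (pw 512 ^_) gain-exponent) (trans (pw-^ 512 (K * 15)) (cong pw (trans (*-comm 512 (K * 15)) (*-assoc K 15 512))))

  modulus∣gain : pwK 2000 ℕ∣.∣ pw 512 ^ (K * 16 ∸ K)
  modulus∣gain = subst (pwK 2000 ℕ∣.∣_) (trans (sym (pw-+ (K * 5680) (K * 2000))) (trans (cong pw (sym (*-distribˡ-+ K 5680 2000))) (sym gain)))
    (ℕ∣.n∣m*n (pwK 5680))

  2^I+K≤ : 2 ^ (K * 16 + K) ≤ pwK 17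
  2^I+K≤ = ≤-reflexive (trans (sym (pw≡2^ (K * 16 + K))) (cong pw (trans (cong (K * 16 +_) (sym (*-identityʳ K))) (sym (*-distribˡ-+ K 16 1)))))

  -- The precision 13000 has to exceed the `16 * 807 + 4` of `head-small`, and 14100 has to exceed
  -- `13000 + 1019`; the number of classes is still affordable, as `16 * 14100 < 256 * 1000`.
  class< : pwK 13000 * (L * K * (pwK 1000 * 2 ^ (K * 16 + K))) < pwK 14100
  class< = ≤-<-trans (≤-refl {pwK 13000} ⊡ (LK≤ ⊡ (≤-refl {pwK 1000} ⊡ 2^I+K≤))) (pwK-mono-< (≤ᵇ⇒≤ 14020 14100 _))

  pw807^ : pw 807 ^ (K * 16) ≤ pwK 12912
  pw807^ = ≤-reflexive (trans (pw-^ 807 (K * 16)) (cong pw (trans (*-comm 807 (K * 16)) (*-assoc K 16 807))))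

  head-small : ∀ {Q} → Q ≤ pwK 2 → pw 807 ^ (K * 16) * 2 ^ K * (4 * Q) ≤ pwK 13000
  head-small Q≤ = ≤-trans (pw807^ ⊡ 2^K≤ ⊡ 4Q≤ Q≤) (pwK-mono (≤ᵇ⇒≤ 12916 13000 _))

  tail-small : ∀ {Q} → Q ≤ pwK 2 → L * K * (pwK 1000 * (pwK 808 * 2 ^ K * 2 ^ K)) * (4 * Q) ≤ pw 512 ^ (K * 16 ∸ K)
  tail-small Q≤ = ≤-trans (LK≤ ⊡ (≤-refl {pwK 1000} ⊡ (≤-refl {pwK 808} ⊡ 2^K≤ ⊡ 2^K≤)) ⊡ 4Q≤ Q≤)
    (≤-trans (pwK-mono (≤ᵇ⇒≤ 1815 7680 _)) (≤-reflexive (sym gain)))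

  error-small : ∀ {Q} → Q ≤ pwK 2 → L * K * (pwK 1000 * (pwK 808 * 2 ^ K)) * (4 * Q) ≤ pwK 2000
  error-small Q≤ = ≤-trans (LK≤ ⊡ (≤-refl {pwK 1000} ⊡ (≤-refl {pwK 808} ⊡ 2^K≤)) ⊡ 4Q≤ Q≤) (pwK-mono (≤ᵇ⇒≤ 1814 2000 _))

  xmax : ℕ
  xmax = K * pw 806

  -- Since 2 ^ 807 is twice 2 ^ 806, every stretch of `pw 806` in the exponent costs a factor 2 by
  -- `exp-2`, and there are at most `K` stretches.
  exp≤ : ∀ x → x ≤ xmax → (1 + pw 807) ^ x ≤ 2 ^ K * pw 807 ^ x
  exp≤ x = exp-bound (pw 807) (pw 806) K x (sym (2* 806))

  bin≤ : ∀ x k → x ≤ xmax → k < K → bin x k ≤ pwK 808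
  bin≤ x k x≤ k<K = ≤-trans (bin-bound (pw 807) (2 ^ K) x k (exp≤ x x≤))
    (≤-trans (*-monoˡ-≤ (2 ^ K) (^-monoʳ-≤ (pw 807) (<⇒≤ k<K)))
      (≤-reflexive (trans (pw-^ 807 K) (cong pw (*-comm 807 K))) ⊡ 2^K≤))

-- The interpolation points.

module Points (q u : ℕ) .{{_ : NonZero u}} where

  -- `X t` is the least integer above `t q / u`, and `δ t` is the excess of `u * X t` over `t * q`.
  -- Rounding up makes this excess nonnegative, so that `y ^ (u * X t)` is `(y ^ q) ^ t` times a
  -- small power of `y`.
  X δ : ℕ → ℕ
  X t = suc ((t * q) div u)
  δ t = u ∸ (t * q) mod u

  δ≤u : ∀ t → δ t ≤ u
  δ≤u t = m∸n≤m u ((t * q) mod u)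

  u*X≡ : ∀ t → u * X t ≡ t * q + δ t
  u*X≡ t = begin
    u * suc Q                 ≡⟨ *-comm u (suc Q) ⟩
    u + Q * u                 ≡⟨ cong (_+ Q * u) (m+[n∸m]≡n (<⇒≤ (m%n<n (t * q) u))) ⟨
    r + δ t + Q * u           ≡⟨ lem r (δ t) (Q * u) ⟩
    r + Q * u + δ t           ≡⟨ cong (_+ δ t) (m≡m%n+[m/n]*n (t * q) u) ⟨
    t * q + δ t ∎
    where
    open ≡-Reasoning
    Q = (t * q) div u
    r = (t * q) mod u
    lem : ∀ a b c → a + b + c ≡ a + c + b
    lem = solve-∀

  X-gap : ∀ g → u * g ≤ q → ∀ t → X t + g ≤ X (suc t)
  X-gap g ug≤q t = s≤s (begin
    (t * q) div u + g                 ≡⟨ cong ((t * q) div u +_) (m*n/n≡m g u) ⟨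
    (t * q) div u + (g * u) div u     ≡⟨ +-distrib-/-∣ʳ (t * q) (ℕ∣.divides g refl) ⟨
    (t * q + g * u) div u             ≤⟨ /-monoˡ-≤ u (≤-trans (+-monoʳ-≤ (t * q) (≤-trans (≤-reflexive (*-comm g u)) ug≤q)) (≤-reflexive (+-comm (t * q) q))) ⟩
    (suc t * q) div u ∎)
    where open ≤-Reasoning

  X≤ : ∀ R t → t ≤ R * u → X t ≤ suc (R * q)
  X≤ R t t≤ = s≤s (begin
    (t * q) div u         ≤⟨ /-monoˡ-≤ u (*-monoˡ-≤ q t≤) ⟩
    (R * u * q) div u     ≡⟨ cong (_div u) (lem R u q) ⟩
    (R * q * u) div u     ≡⟨ m*n/n≡m (R * q) u ⟩
    R * q ∎)
    where
    open ≤-Reasoning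
    lem : ∀ R u q → R * u * q ≡ R * q * u
    lem = solve-∀

pow≤pw : ∀ {a h} → a ≤ pw h → ∀ t → a ^ t ≤ pw (h * t)
pow≤pw {a} {h} a≤ t = ≤-trans (^-monoˡ-≤ t a≤) (≤-reflexive (pw-^ h t))

≤-pw* : ∀ {m n} P → m ≤ n → pw m * P ≤ pw n * P
≤-pw* P m≤n = *-monoˡ-≤ P (pw-mono-≤ m≤n)

double : ∀ {x y} n P → x ≤ pw n * P → y ≤ pw n * P → x + y ≤ pw (suc n) * P
double n P x≤ y≤ = ≤-trans (+-mono-≤ x≤ y≤) (≤-reflexive (trans (lem (pw n) P) (cong (_* P) (2* n))))
  where
  lem : ∀ a P → a * P + a * P ≡ 2 * a * P
  lem = solve-∀

-- The ratio `1 + κ / G` is at most `1 + 1 / D`, to which `pow-half` applies.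
power-of-sum : ∀ D G κ m .{{_ : NonZero D}} → κ * D ≤ G → m ≤ D →
  (G + κ) ^ m * (1 + D ∸ m) ≤ (1 + D) * G ^ m
power-of-sum D G κ m κD≤G m≤D = *-cancelˡ-≤ (D ^ m) {{m^n≢0 D m}} (begin
  D ^ m * ((G + κ) ^ m * (1 + D ∸ m))   ≡⟨ trans (sym (*-assoc (D ^ m) _ _)) (cong (_* (1 + D ∸ m)) (sym (*-^ D (G + κ) m))) ⟩
  (D * (G + κ)) ^ m * (1 + D ∸ m)       ≤⟨ *-monoˡ-≤ (1 + D ∸ m) (^-monoˡ-≤ m base) ⟩
  ((1 + D) * G) ^ m * (1 + D ∸ m)       ≡⟨ cong (_* (1 + D ∸ m)) (*-^ (1 + D) G m) ⟩
  (1 + D) ^ m * G ^ m * (1 + D ∸ m)     ≡⟨ lem ((1 + D) ^ m) (G ^ m) (1 + D ∸ m) ⟩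
  (1 + D) ^ m * (1 + D ∸ m) * G ^ m     ≤⟨ *-monoˡ-≤ (G ^ m) (pow-half D m m≤D) ⟩
  (1 + D) * D ^ m * G ^ m               ≡⟨ lem₂ (1 + D) (D ^ m) (G ^ m) ⟩
  D ^ m * ((1 + D) * G ^ m) ∎)
  where
  open ≤-Reasoning
  lem : ∀ a b c → a * b * c ≡ a * c * b
  lem = solve-∀
  lem₂ : ∀ a b c → a * b * c ≡ b * (a * c)
  lem₂ = solve-∀
  base : D * (G + κ) ≤ (1 + D) * G
  base = ≤-trans (≤-reflexive (trans (*-distribˡ-+ D G κ) (cong (D * G +_) (*-comm D κ)))) (≤-trans (+-monoʳ-≤ (D * G) κD≤G) (≤-reflexive (+-comm (D * G) G)))

-- The relative difference is at most `(1 + D) / (1 + D - m) - 1 = m / (1 + D - m)`, and `m * suc H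
-- ≤ D` makes this at most `1 / H`.
powers-near : ∀ D G κ m H .{{_ : NonZero D}} → κ * D ≤ G → m * suc H ≤ D →
  ((G + κ) ^ m ∸ G ^ m) * H ≤ G ^ m
powers-near D G κ zero      H κD≤G _   = z≤n
powers-near D G κ m@(suc _) H κD≤G m≤D = *-cancelˡ-≤ m (begin
  m * ((Nᵐ ∸ Gᵐ) * H)        ≡⟨ lem m (Nᵐ ∸ Gᵐ) H ⟩
  (Nᵐ ∸ Gᵐ) * (m * H)        ≤⟨ *-monoʳ-≤ (Nᵐ ∸ Gᵐ) mH≤ ⟩
  (Nᵐ ∸ Gᵐ) * e              ≡⟨ *-distribʳ-∸ e Nᵐ Gᵐ ⟩
  Nᵐ * e ∸ Gᵐ * e            ≤⟨ ∸-monoˡ-≤ (Gᵐ * e) (power-of-sum D G κ m κD≤G m≤D′) ⟩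
  (1 + D) * Gᵐ ∸ Gᵐ * e      ≡⟨ cong ((1 + D) * Gᵐ ∸_) (*-comm Gᵐ e) ⟩
  (1 + D) * Gᵐ ∸ e * Gᵐ      ≡⟨ *-distribʳ-∸ Gᵐ (1 + D) e ⟨
  (1 + D ∸ e) * Gᵐ           ≡⟨ cong (_* Gᵐ) (m∸[m∸n]≡n (m≤n⇒m≤1+n m≤D′)) ⟩
  m * Gᵐ ∎)
  where
  open ≤-Reasoning
  Nᵐ = (G + κ) ^ m
  Gᵐ = G ^ m
  e = 1 + D ∸ m
  m≤D′ : m ≤ D
  m≤D′ = ≤-trans (m≤m*n m (suc H)) m≤D
  mH≤ : m * H ≤ e
  mH≤ = m+n≤o⇒m≤o∸n (m * H) (≤-trans (≤-reflexive (trans (+-comm (m * H) m) (sym (*-suc m H)))) (m≤n⇒m≤1+n m≤D))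
  lem : ∀ m a H → m * (a * H) ≡ a * (m * H)
  lem = solve-∀

-- The parameters attached to a solution, and the two contradictions for it.

-- With h ≈ q / (2^1330 u) the choice of R and S balances the cost h R of a and b against the cost
-- Λ u S of y; K is larger than both by a factor 2^525 and R S > 2^256 K, while K is still
-- smaller than q Λ by a constant factor.
module Setup (L′ : ℕ) (L′≡255 : L′ ≡ 255) (q u h Λ : ℕ)
  .{{_ : NonZero u}} .{{_ : NonZero h}} .{{_ : NonZero Λ}}
  (q≤ : q ≤ u * h * pw 1330) (≤q : u * h * pw 1330 ≤ 2 * q) where

  P K R S : ℕ
  P = h * Λ * u
  K = pw 1307 * P
  R = pw 782 * Λ * u
  S = pw 782 * h

  instance
    hΛ≢0 : NonZero (h * Λ)
    hΛ≢0 = m*n≢0 h Λ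
    P≢0 : NonZero P
    P≢0 = m*n≢0 (h * Λ) u
    uΛ≢0 : NonZero (u * Λ)
    uΛ≢0 = m*n≢0 u Λ

  8≤K : 8 ≤ K
  8≤K = ≤-trans (≤-reflexive (sym (pw≡2^ 3))) (≤-trans (pw-mono-≤ (≤ᵇ⇒≤ 3 1307 _)) (m≤m*n (pw 1307) P))

  open Parameters L′ L′≡255 K 8≤K public
  open Points q u public

  S+L≤ : S + L ≤ pw 783 * h
  S+L≤ = double 782 h ≤-refl (≤-trans (≤-reflexive L≡pw8) (≤-trans (pw-mono-≤ (≤ᵇ⇒≤ 8 782 _)) (m≤m*n (pw 782) h)))

  -- Consecutive `X t` are about `q / u` apart, which exceeds `S` by a factor of at least `2 ^ 547`;
  -- so the blocks do not overlap.
  uS≤q : u * (S + L) ≤ q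
  uS≤q = *-cancelˡ-≤ 2 (begin
    2 * (u * (S + L))         ≤⟨ *-monoʳ-≤ 2 (*-monoʳ-≤ u S+L≤) ⟩
    2 * (u * (pw 783 * h))    ≡⟨ lem (pw 783) u h ⟩
    u * h * (2 * pw 783)      ≤⟨ *-monoʳ-≤ (u * h) (≤-trans (≤-reflexive (2* 783)) (pw-mono-≤ (≤ᵇ⇒≤ 784 1330 _))) ⟩
    u * h * pw 1330           ≤⟨ ≤q ⟩
    2 * q ∎)
    where
    open ≤-Reasoning
    lem : ∀ p u h → 2 * (u * (p * h)) ≡ u * h * (2 * p)
    lem = solve-∀

  gap : ∀ t → X t + (S + L) ≤ X (suc t)
  gap = X-gap (S + L) uS≤q

  R*S≡ : R * S ≡ pw 1564 * P
  R*S≡ = trans (lem (pw 782) Λ u h) (cong (_* P) (sym (pw-+ 782 782)))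
    where
    lem : ∀ p Λ u h → p * Λ * u * (p * h) ≡ p * p * (h * Λ * u)
    lem = solve-∀

  -- Here `1564 = 256 + 1307 + 1`: the two sides differ by a factor 2. This determines the exponent
  -- 782 of `R` and `S`.
  big : 2 ^ L * K < R * S
  big = subst₂ _<_ (trans (cong (_* P) (pw-+ 256 1307)) (trans (*-assoc (pw 256) (pw 1307) P) (cong (_* K) (trans (pw≡2^ 256) (cong (λ l → 2 ^ suc l) (sym L′≡255))))))
    (sym R*S≡) (*-monoˡ-< P (pw-mono-< (≤ᵇ⇒≤ 1564 1564 _)))

  -- The equality `783 + 1330 = 1307 + 806` is the origin of the exponent 806 in `xmax`, and hence
  -- of `D = pw 807`.
  X+s≤ : ∀ t s → t < R → s < S + L → X t + s ≤ xmax
  X+s≤ t s t<R s< = begin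
    X t + s                          ≤⟨ +-monoˡ-≤ s (X≤ (pw 782 * Λ) t (<⇒≤ t<R)) ⟩
    suc (pw 782 * Λ * q) + s         ≡⟨ +-suc (pw 782 * Λ * q) s ⟨
    pw 782 * Λ * q + suc s           ≤⟨ +-mono-≤ (≤-reflexive (*-assoc (pw 782) Λ q)) s<q ⟩
    pw 782 * (Λ * q) + pw 782 * (Λ * q) ≡⟨ lem (pw 782) (Λ * q) ⟩
    2 * pw 782 * (Λ * q)             ≡⟨ cong (_* (Λ * q)) (2* 782) ⟩
    pw 783 * (Λ * q)                 ≤⟨ *-monoʳ-≤ (pw 783) (*-monoʳ-≤ Λ q≤) ⟩
    pw 783 * (Λ * (u * h * pw 1330)) ≡⟨ lem₂ (pw 783) Λ u h (pw 1330) ⟩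
    pw 783 * pw 1330 * P             ≡⟨ cong (_* P) (trans (sym (pw-+ 783 1330)) (pw-+ 1307 806)) ⟩
    pw 1307 * pw 806 * P             ≡⟨ lem₃ (pw 1307) (pw 806) P ⟩
    K * pw 806 ∎
    where
    open ≤-Reasoning
    s<q : suc s ≤ pw 782 * (Λ * q)
    s<q = ≤-trans s< (≤-trans (m≤n*m (S + L) u) (≤-trans uS≤q (≤-trans (m≤n*m q Λ) (m≤n*m (Λ * q) (pw 782)))))
    lem : ∀ a b → a * b + a * b ≡ 2 * a * b
    lem = solve-∀
    lem₂ : ∀ a Λ u h b → a * (Λ * (u * h * b)) ≡ a * b * (h * Λ * u)
    lem₂ = solve-∀
    lem₃ : ∀ a b P → a * b * P ≡ a * P * b
    lem₃ = solve-∀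

  -- `pw z` will bound the numerators and the denominators of the rationals `ζ`. The gap between 790
  -- and 1307 keeps even its `L′`-th power below `2 ^ K`.
  z : ℕ
  z = pw 790 * P

  z*L′≤K : z * L′ ≤ K
  z*L′≤K = begin
    pw 790 * P * L′     ≤⟨ *-monoʳ-≤ (pw 790 * P) (≤-trans (n≤1+n L′) (≤-reflexive L≡pw8)) ⟩
    pw 790 * P * pw 8   ≡⟨ lem (pw 790) P (pw 8) ⟩
    pw 790 * pw 8 * P   ≡⟨ cong (_* P) (pw-+ 790 8) ⟨
    pw 798 * P          ≤⟨ ≤-pw* P (≤ᵇ⇒≤ 798 1307 _) ⟩
    K ∎
    where
    open ≤-Reasoning
    lem : ∀ a P b → a * P * b ≡ a * b * P
    lem = solve-∀

  Z^L′≤ : pw z ^ L′ ≤ pwK 2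
  Z^L′≤ = ≤-trans (≤-reflexive (pw-^ z L′)) (pw-mono-≤ (≤-trans z*L′≤K (m≤m*n K 2)))

  ht≤ : ∀ {t} → t < R → h * t ≤ pw 782 * P
  ht≤ t<R = ≤-trans (*-monoʳ-≤ h (<⇒≤ t<R)) (≤-reflexive (lem h (pw 782) Λ u))
    where
    lem : ∀ h p Λ u → h * (p * Λ * u) ≡ p * (h * Λ * u)
    lem = solve-∀

  y-exponent : ∀ t s → s < S + L → Λ * (δ t + u * s) ≤ pw 783 * P
  y-exponent t s s< = begin
    Λ * (δ t + u * s)         ≤⟨ *-monoʳ-≤ Λ (+-monoˡ-≤ (u * s) (δ≤u t)) ⟩
    Λ * (u + u * s)           ≡⟨ cong (Λ *_) (*-suc u s) ⟨
    Λ * (u * suc s)           ≤⟨ *-monoʳ-≤ Λ (*-monoʳ-≤ u (≤-trans s< S+L≤)) ⟩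
    Λ * (u * (pw 783 * h))    ≡⟨ lem Λ u (pw 783) h ⟩
    pw 783 * P ∎
    where
    open ≤-Reasoning
    lem : ∀ Λ u p h → Λ * (u * (p * h)) ≡ p * (h * Λ * u)
    lem = solve-∀

  module TwoAdic (a b y Mx : ℕ) .{{_ : NonZero a}} .{{_ : NonZero b}} (1<y : 1 < y)
    (a≤ : a ≤ pw h) (b≤ : b ≤ pw h) (y≤ : y ≤ pw Λ)
    (E∣ : pw 512 ℕ∣.∣ y ^ u ∸ 1) (K≤ : K * 2002 ≤ Mx)
    (M∣ : pos (pw Mx) ℤ∣.∣ (pos b -ᶻ pos (a * y ^ q))) where

    private
      instance
        y≢0 : NonZero y
        y≢0 = >-nonZero (<-trans (s≤s z≤n) 1<y)
        y^u≢0 : NonZero (y ^ u)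
        y^u≢0 = m^n≢0 y u

      U V : ℕ → ℕ
      U t = b ^ t * y ^ δ t
      V t = a ^ t

      M∣′ : pos (pwK 2000) ℤ∣.∣ (pos b -ᶻ pos (a * y ^ q))
      M∣′ = ℤ∣.∣-trans (ℤ∣.∣ᵤ⇒∣ (subst (pwK 2000 ℕ∣.∣_) (trans (sym (pw-+ (Mx ∸ K * 2000) (K * 2000))) (cong pw (m∸n+n≡m (≤-trans (*-monoʳ-≤ K (≤ᵇ⇒≤ 2000 2002 _)) K≤)))) (ℕ∣.n∣m*n (pw (Mx ∸ K * 2000))))) M∣

      V*Y^X : ∀ t → V t * (y ^ u) ^ X t ≡ y ^ δ t * (a * y ^ q) ^ t
      V*Y^X t = begin
        a ^ t * (y ^ u) ^ X t             ≡⟨ cong (a ^ t *_) (trans (^-*-assoc y u (X t)) (trans (cong (y ^_) (u*X≡ t)) (^-distribˡ-+-* y (t * q) (δ t)))) ⟩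
        a ^ t * (y ^ (t * q) * y ^ δ t)   ≡⟨ cong (λ e → a ^ t * (e * y ^ δ t)) (trans (cong (y ^_) (*-comm t q)) (sym (^-*-assoc y q t))) ⟩
        a ^ t * ((y ^ q) ^ t * y ^ δ t)   ≡⟨ lem (a ^ t) ((y ^ q) ^ t) (y ^ δ t) ⟩
        y ^ δ t * (a ^ t * (y ^ q) ^ t)   ≡⟨ cong (y ^ δ t *_) (*-^ a (y ^ q) t) ⟨
        y ^ δ t * (a * y ^ q) ^ t ∎
        where
        open ≡-Reasoning
        lem : ∀ a b c → a * (b * c) ≡ c * (a * b)
        lem = solve-∀

      close : ∀ t → t < R → pos (pwK 2000) ℤ∣.∣ (pos (U t) -ᶻ pos (V t * (y ^ u) ^ X t))
      close t _ = subst₂ (λ c e → pos (pwK 2000) ℤ∣.∣ (pos c -ᶻ pos e)) (*-comm (y ^ δ t) (b ^ t)) (sym (V*Y^X t))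
        (∣-*-sub (y ^ δ t) (b ^ t) ((a * y ^ q) ^ t) (∣-^-sub b (a * y ^ q) M∣′ t))

      U≤ : ∀ t s → t < R → s < S + L → U t * (y ^ u) ^ s ≤ pw z
      U≤ t s t<R s< = begin
        b ^ t * y ^ δ t * (y ^ u) ^ s          ≡⟨ trans (*-assoc (b ^ t) _ _) (cong (b ^ t *_) (trans (cong (y ^ δ t *_) (^-*-assoc y u s)) (sym (^-distribˡ-+-* y (δ t) (u * s))))) ⟩
        b ^ t * y ^ (δ t + u * s)              ≤⟨ pow≤pw {h = h} b≤ t ⊠ pow≤pw {h = Λ} y≤ (δ t + u * s) ⟩
        pw (h * t + Λ * (δ t + u * s))         ≤⟨ pw-mono-≤ (≤-trans (double 783 P (≤-trans (ht≤ t<R) (≤-pw* P (≤ᵇ⇒≤ 782 783 _))) (y-exponent t s s<)) (≤-pw* P (≤ᵇ⇒≤ 784 790 _))) ⟩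
        pw z ∎
        where open ≤-Reasoning

    impossible : ⊥
    impossible = 2-adicPowers.impossible L′ K (y ^ u) (pw 512) U V X R S
      (≤-trans 1<y (≤-trans (≤-reflexive (sym (^-identityʳ y))) (^-monoʳ-≤ y (>-nonZero⁻¹ u))))
      E∣ (λ t → m*n≢0 (b ^ t) (y ^ δ t) {{m^n≢0 b t}} {{m^n≢0 y (δ t)}}) (λ t → m^n≢0 a t) gap big
      (pwK 2000) (pwK 1000) (K * 16) (pwK 808) (pw z) modulus∣gain close
      (count 2000 1000 (≤ᵇ⇒≤ 32001 256000 _)) (λ t s k t<R s< → bin≤ (X t + s) k (X+s≤ t s t<R s<)) U≤
      (λ t t<R → ≤-trans (pow≤pw {h = h} a≤ t) (pw-mono-≤ (≤-trans (ht≤ t<R) (≤-pw* P (≤ᵇ⇒≤ 782 790 _)))))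
      (size Z^L′≤)

  module Arch (a b y g ν κ v w₀ Mx : ℕ) .{{_ : NonZero a}} .{{_ : NonZero b}} .{{_ : NonZero y}} .{{_ : NonZero g}} .{{_ : NonZero κ}}
    .{{_ : NonZero q}}
    (a≤ : a ≤ pw h) (b≤ : b ≤ pw h) (y≤ : y ≤ pw Λ) (g≤ : g ≤ pw 3)
    (eq : a * y ^ q ≡ b * (g ^ ν + κ)) (κ≤ : κ * pw Mx ≤ g ^ ν) (K≤ : K * 2002 ≤ Mx)
    (v≤ : v * pw 1330 ≤ q) (up : u * ν ≤ w₀ * q + v) (down : w₀ * q ≤ u * ν + v)
    (w₀≤ : w₀ ≤ pw 2 * (u * Λ)) where

    private
      G N : ℕ
      G = g ^ ν
      N = G + κ

      instance
        G≢0 : NonZero G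
        G≢0 = m^n≢0 g ν
        N≢0 : NonZero N
        N≢0 = >-nonZero (≤-trans (>-nonZero⁻¹ G) (m≤m+n G κ))
        Y≢0 : NonZero (y ^ u)
        Y≢0 = m^n≢0 y u
        W≢0 : NonZero (g ^ w₀)
        W≢0 = m^n≢0 g w₀

      G<N : G < N
      G<N = m<m+n G (>-nonZero⁻¹ κ)

      R*L′≤ : R * L′ ≤ pwK 1
      R*L′≤ = begin
        R * L′                 ≤⟨ *-monoʳ-≤ R (≤-trans (n≤1+n L′) (≤-reflexive L≡pw8)) ⟩
        pw 782 * Λ * u * pw 8  ≡⟨ lem (pw 782) Λ u (pw 8) ⟩
        pw 782 * pw 8 * (Λ * u) ≡⟨ cong (_* (Λ * u)) (pw-+ 782 8) ⟨
        pw 790 * (Λ * u)       ≤⟨ *-monoʳ-≤ (pw 790) (≤-trans (m≤n*m (Λ * u) h) (≤-reflexive (sym (*-assoc h Λ u)))) ⟩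
        pw 790 * P             ≤⟨ ≤-pw* P (≤ᵇ⇒≤ 790 1307 _) ⟩
        K                      ≡⟨ *-identityʳ K ⟨
        K * 1                  ≤⟨ n≤pw (K * 1) ⟩
        pwK 1 ∎
        where
        open ≤-Reasoning
        lem : ∀ p Λ u q → p * Λ * u * q ≡ p * q * (Λ * u)
        lem = solve-∀

      near : ∀ m → m ≤ R * L′ → (N ^ m ∸ G ^ m) * pwK 2000 ≤ G ^ m
      near m m≤ = powers-near (pw Mx) G κ m (pwK 2000) κ≤ (≤-trans (≤-trans m≤ R*L′≤ ⊡ suc≤) (pw-mono-≤ K≤))
        where
        suc≤ : suc (pwK 2000) ≤ pwK 2001
        suc≤ = pwK-mono-< {2000} {2001} ≤-refl

      ∣-∣≡∸ : ∀ {c e} → e ≤ c → ∣ pos c -ᶻ pos e ∣ ≡ c ∸ e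
      ∣-∣≡∸ {c} {e} e≤c = cong ∣_∣ (trans (ℤP.[+m]-[+n]≡m⊖n c e) (ℤP.⊖-≥ e≤c))

      nearᴺ : ∀ m → m ≤ R * L′ → ∣ pos (G ^ m) -ᶻ pos (N ^ m) ∣ * pwK 2000 ≤ N ^ m
      nearᴺ m m≤ = ≤-trans (≤-reflexive (cong (_* pwK 2000) (trans (ℤP.∣i-j∣≡∣j-i∣ (pos (G ^ m)) (pos (N ^ m))) (∣-∣≡∸ G^≤N^))))
        (≤-trans (near m m≤) G^≤N^)
        where
        G^≤N^ : G ^ m ≤ N ^ m
        G^≤N^ = ^-monoˡ-≤ m (m≤m+n G κ)

      nearᴳ : ∀ m → m ≤ R * L′ → ∣ pos (N ^ m) -ᶻ pos (G ^ m) ∣ * pwK 2000 ≤ G ^ m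
      nearᴳ m m≤ = ≤-trans (≤-reflexive (cong (_* pwK 2000) (∣-∣≡∸ (^-monoˡ-≤ m (m≤m+n G κ))))) (near m m≤)

      v≤uh : v ≤ u * h
      v≤uh = *-cancelʳ-≤ v (u * h) (pw 1330) (≤-trans v≤ q≤)

      -- A bound for the distance of `ν * t` from `w₀ * X t`: the error `v` of Dirichlet's
      -- approximation contributes at most `R * h`, because `v ≤ u * h`, and the rounding in `X t`
      -- at most `w₀`.
      E₀ : ℕ
      E₀ = R * h + w₀

      th≤Rh : ∀ {t} → t < R → t * h ≤ R * h
      th≤Rh t<R = *-monoˡ-≤ h (<⇒≤ t<R)

      w₀X≤ : ∀ t → t < R → w₀ * X t ≤ ν * t + E₀
      w₀X≤ t t<R = ≤-trans (*-cancelˡ-≤ u (begin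
        u * (w₀ * X t)                     ≡⟨ lem u w₀ (X t) ⟩
        w₀ * (u * X t)                     ≡⟨ cong (w₀ *_) (u*X≡ t) ⟩
        w₀ * (t * q + δ t)                 ≤⟨ *-monoʳ-≤ w₀ (+-monoʳ-≤ (t * q) (δ≤u t)) ⟩
        w₀ * (t * q + u)                   ≡⟨ lem₂ w₀ t q u ⟩
        t * (w₀ * q) + w₀ * u              ≤⟨ +-monoˡ-≤ (w₀ * u) (*-monoʳ-≤ t (≤-trans down (+-monoʳ-≤ (u * ν) v≤uh))) ⟩
        t * (u * ν + u * h) + w₀ * u       ≡⟨ lem₃ t u ν h w₀ ⟩
        u * (ν * t + (t * h + w₀)) ∎)) (+-monoʳ-≤ (ν * t) (+-monoˡ-≤ w₀ (th≤Rh t<R)))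
        where
        open ≤-Reasoning
        lem : ∀ u w x → u * (w * x) ≡ w * (u * x)
        lem = solve-∀
        lem₂ : ∀ w t q u → w * (t * q + u) ≡ t * (w * q) + w * u
        lem₂ = solve-∀
        lem₃ : ∀ t u n h w → t * (u * n + u * h) + w * u ≡ u * (n * t + (t * h + w))
        lem₃ = solve-∀

      νt≤ : ∀ t → t < R → ν * t ≤ w₀ * X t + E₀
      νt≤ t t<R = *-cancelˡ-≤ u (begin
        u * (ν * t)                        ≡⟨ lem u ν t ⟩
        t * (u * ν)                        ≤⟨ *-monoʳ-≤ t (≤-trans up (+-monoʳ-≤ (w₀ * q) v≤uh)) ⟩
        t * (w₀ * q + u * h)               ≡⟨ lem₂ t w₀ q u h ⟩
        w₀ * (t * q) + u * (t * h)         ≤⟨ +-mono-≤ (*-monoʳ-≤ w₀ (≤-trans (m≤m+n (t * q) (δ t)) (≤-reflexive (sym (u*X≡ t)))))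
                                                (*-monoʳ-≤ u (≤-trans (th≤Rh t<R) (m≤m+n (R * h) w₀))) ⟩
        w₀ * (u * X t) + u * E₀            ≡⟨ lem₃ w₀ u (X t) E₀ ⟩
        u * (w₀ * X t + E₀) ∎)
        where
        open ≤-Reasoning
        lem : ∀ u n t → u * (n * t) ≡ t * (u * n)
        lem = solve-∀
        lem₂ : ∀ t w q u h → t * (w * q + u * h) ≡ w * (t * q) + u * (t * h)
        lem₂ = solve-∀
        lem₃ : ∀ w u x e → w * (u * x) + u * e ≡ u * (w * x + e)
        lem₃ = solve-∀

      -- The exponent `ν * t - w₀ * X t` of `g` in `ζ` can have either sign; the shift by `E₀`,
      -- compensated in `V`, keeps it natural.
      E : ℕ → ℕ
      E t = ν * t + E₀ ∸ w₀ * X t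

      E≤ : ∀ t → t < R → E t ≤ E₀ + E₀
      E≤ t t<R = m≤n+o⇒m∸n≤o (ν * t + E₀) (w₀ * X t) (≤-trans (+-monoˡ-≤ E₀ (νt≤ t t<R)) (≤-reflexive (+-assoc (w₀ * X t) E₀ E₀)))

      U V : ℕ → ℕ
      U t = b ^ t * y ^ δ t * g ^ E t
      V t = a ^ t * g ^ E₀

      U≢0 : ∀ t → NonZero (U t)
      U≢0 t = m*n≢0 (b ^ t * y ^ δ t) (g ^ E t) {{m*n≢0 (b ^ t) (y ^ δ t) {{m^n≢0 b t}} {{m^n≢0 y (δ t)}}}} {{m^n≢0 g (E t)}}

      V≢0 : ∀ t → NonZero (V t)
      V≢0 t = m*n≢0 (a ^ t) (g ^ E₀) {{m^n≢0 a t}} {{m^n≢0 g E₀}}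

      related : ∀ t → t < R → U t * (g ^ w₀) ^ X t * N ^ t ≡ V t * (y ^ u) ^ X t * G ^ t
      related t t<R = begin
        b ^ t * y ^ δ t * g ^ E t * (g ^ w₀) ^ X t * N ^ t
          ≡⟨ cong (_* N ^ t) (trans (*-assoc (b ^ t * y ^ δ t) _ _) (cong (b ^ t * y ^ δ t *_) g-part)) ⟩
        b ^ t * y ^ δ t * (G ^ t * g ^ E₀) * N ^ t
          ≡⟨ lem (b ^ t) (y ^ δ t) (G ^ t) (g ^ E₀) (N ^ t) ⟩
        b ^ t * N ^ t * (g ^ E₀ * y ^ δ t * G ^ t)
          ≡⟨ cong (_* (g ^ E₀ * y ^ δ t * G ^ t)) (trans (sym (*-^ b N t)) (trans (cong (_^ t) (sym eq)) (*-^ a (y ^ q) t))) ⟩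
        a ^ t * (y ^ q) ^ t * (g ^ E₀ * y ^ δ t * G ^ t)
          ≡⟨ lem₂ (a ^ t) ((y ^ q) ^ t) (g ^ E₀) (y ^ δ t) (G ^ t) ⟩
        a ^ t * g ^ E₀ * ((y ^ q) ^ t * y ^ δ t) * G ^ t
          ≡⟨ cong (λ e → a ^ t * g ^ E₀ * e * G ^ t) y-part ⟨
        a ^ t * g ^ E₀ * (y ^ u) ^ X t * G ^ t ∎
        where
        open ≡-Reasoning
        g-part : g ^ E t * (g ^ w₀) ^ X t ≡ G ^ t * g ^ E₀
        g-part = begin
          g ^ E t * (g ^ w₀) ^ X t      ≡⟨ cong (g ^ E t *_) (^-*-assoc g w₀ (X t)) ⟩
          g ^ E t * g ^ (w₀ * X t)      ≡⟨ ^-distribˡ-+-* g (E t) (w₀ * X t) ⟨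
          g ^ (E t + w₀ * X t)          ≡⟨ cong (g ^_) (m∸n+n≡m (w₀X≤ t t<R)) ⟩
          g ^ (ν * t + E₀)              ≡⟨ ^-distribˡ-+-* g (ν * t) E₀ ⟩
          g ^ (ν * t) * g ^ E₀          ≡⟨ cong (_* g ^ E₀) (^-*-assoc g ν t) ⟨
          G ^ t * g ^ E₀ ∎
        y-part : (y ^ u) ^ X t ≡ (y ^ q) ^ t * y ^ δ t
        y-part = begin
          (y ^ u) ^ X t                 ≡⟨ ^-*-assoc y u (X t) ⟩
          y ^ (u * X t)                 ≡⟨ cong (y ^_) (trans (u*X≡ t) (cong (_+ δ t) (*-comm t q))) ⟩
          y ^ (q * t + δ t)             ≡⟨ ^-distribˡ-+-* y (q * t) (δ t) ⟩
          y ^ (q * t) * y ^ δ t         ≡⟨ cong (_* y ^ δ t) (^-*-assoc y q t) ⟨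
          (y ^ q) ^ t * y ^ δ t ∎
        lem : ∀ b y G e N → b * y * (G * e) * N ≡ b * N * (e * y * G)
        lem = solve-∀
        lem₂ : ∀ a y e d G → a * y * (e * d * G) ≡ a * e * (y * d) * G
        lem₂ = solve-∀

      E₀≤ : E₀ ≤ pw 783 * P
      E₀≤ = double 782 P (≤-reflexive (lem (pw 782) Λ u h))
        (≤-trans w₀≤ (≤-trans (≤-pw* (u * Λ) (≤ᵇ⇒≤ 2 782 _)) (*-monoʳ-≤ (pw 782) (≤-trans (m≤n*m (u * Λ) h) (≤-reflexive (lem₂ h u Λ))))))
        where
        lem : ∀ p Λ u h → p * Λ * u * h ≡ p * (h * Λ * u)
        lem = solve-∀
        lem₂ : ∀ h u Λ → h * (u * Λ) ≡ h * Λ * u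
        lem₂ = solve-∀

      w₀s≤ : ∀ s → s < S + L → w₀ * s ≤ pw 785 * P
      w₀s≤ s s< = begin
        w₀ * s                           ≤⟨ *-mono-≤ w₀≤ (≤-trans (<⇒≤ s<) S+L≤) ⟩
        pw 2 * (u * Λ) * (pw 783 * h)    ≡⟨ lem (pw 2) u Λ (pw 783) h ⟩
        pw 2 * pw 783 * P                ≡⟨ cong (_* P) (pw-+ 2 783) ⟨
        pw 785 * P ∎
        where
        open ≤-Reasoning
        lem : ∀ a u Λ b h → a * (u * Λ) * (b * h) ≡ a * b * (h * Λ * u)
        lem = solve-∀

      3*≤ : ∀ {x} n → x ≤ pw n * P → 3 * x ≤ pw (2 + n) * P
      3*≤ {x} n x≤ = ≤-trans (*-mono-≤ (≤-trans (s≤s (s≤s (s≤s z≤n))) (≤-reflexive (sym (pw≡2^ 2)))) x≤)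
        (≤-reflexive (trans (sym (*-assoc (pw 2) (pw n) P)) (cong (_* P) (sym (pw-+ 2 n)))))

      V≤ : ∀ t s → t < R → s < S + L → V t * (g ^ w₀) ^ s ≤ pw z
      V≤ t s t<R s< = begin
        a ^ t * g ^ E₀ * (g ^ w₀) ^ s    ≡⟨ trans (*-assoc (a ^ t) _ _) (cong (a ^ t *_) (trans (cong (g ^ E₀ *_) (^-*-assoc g w₀ s)) (sym (^-distribˡ-+-* g E₀ (w₀ * s))))) ⟩
        a ^ t * g ^ (E₀ + w₀ * s)        ≤⟨ pow≤pw {h = h} a≤ t ⊠ pow≤pw {h = 3} g≤ (E₀ + w₀ * s) ⟩
        pw (h * t + 3 * (E₀ + w₀ * s))   ≤⟨ pw-mono-≤ (≤-trans (double 788 P (≤-trans (ht≤ t<R) (≤-pw* P (≤ᵇ⇒≤ 782 788 _)))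
                                              (3*≤ 786 (double 785 P (≤-trans E₀≤ (≤-pw* P (≤ᵇ⇒≤ 783 785 _))) (w₀s≤ s s<)))) (≤-pw* P (≤ᵇ⇒≤ 789 790 _))) ⟩
        pw z ∎
        where open ≤-Reasoning

      U≤ : ∀ t s → t < R → s < S + L → U t * (y ^ u) ^ s ≤ pw z
      U≤ t s t<R s< = begin
        b ^ t * y ^ δ t * g ^ E t * (y ^ u) ^ s   ≡⟨ lem (b ^ t) (y ^ δ t) (g ^ E t) ((y ^ u) ^ s) ⟩
        b ^ t * (y ^ δ t * (y ^ u) ^ s) * g ^ E t ≡⟨ cong (λ e → b ^ t * e * g ^ E t) (trans (cong (y ^ δ t *_) (^-*-assoc y u s)) (sym (^-distribˡ-+-* y (δ t) (u * s)))) ⟩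
        b ^ t * y ^ (δ t + u * s) * g ^ E t       ≤⟨ pow≤pw {h = h} b≤ t ⊠ pow≤pw {h = Λ} y≤ (δ t + u * s) ⊠ pow≤pw {h = 3} g≤ (E t) ⟩
        pw (h * t + Λ * (δ t + u * s) + 3 * E t)  ≤⟨ pw-mono-≤ (≤-trans (double 786 P
                                                       (≤-trans (double 783 P (≤-trans (ht≤ t<R) (≤-pw* P (≤ᵇ⇒≤ 782 783 _))) (y-exponent t s s<)) (≤-pw* P (≤ᵇ⇒≤ 784 786 _)))
                                                       (3*≤ 784 (≤-trans (E≤ t t<R) (double 783 P E₀≤ E₀≤)))) (≤-pw* P (≤ᵇ⇒≤ 787 790 _))) ⟩
        pw z ∎
        where
        open ≤-Reasoning
        lem : ∀ b y g s → b * y * g * s ≡ b * (y * s) * g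
        lem = solve-∀

      -- `pw ξ` bounds the ratio of `(y ^ u) ^ q` and `(g ^ w₀) ^ q` in both directions: `h * u`
      -- comes from `a` or `b`, `u` from `N ≤ 2 * G`, and `3 * v` from `g ^ v`. `T₃` is the exponent
      -- at which `ArchimedeanPowers` asks for closeness.
      ξ T₃ : ℕ
      ξ = h * u + u + 3 * v
      T₃ = L * (pw 807 * pw 512)

      T₃≡ : T₃ ≡ pw 1327
      T₃≡ = trans (cong₂ _*_ L≡pw8 (sym (pw-+ 807 512))) (sym (pw-+ 8 1319))

      -- Since `1330 = 1327 + 3`, there is a factor 8 to absorb the shares `2 + 2 + 3` of the three
      -- summands of `ξ`.
      ξT₃≤q : ξ * T₃ ≤ q
      ξT₃≤q = *-cancelʳ-≤ (ξ * T₃) q (pw 3) (begin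
        ξ * T₃ * pw 3                       ≡⟨ trans (cong (λ t → ξ * t * pw 3) T₃≡) (trans (*-assoc ξ (pw 1327) (pw 3)) (cong (ξ *_) (sym (pw-+ 1327 3)))) ⟩
        ξ * pw 1330                         ≡⟨ lem h u v (pw 1330) ⟩
        u * h * pw 1330 + u * pw 1330 + 3 * (v * pw 1330)
          ≤⟨ +-mono-≤ (+-mono-≤ ≤q (≤-trans (*-monoˡ-≤ (pw 1330) (m≤m*n u h)) ≤q)) (*-monoʳ-≤ 3 v≤) ⟩
        2 * q + 2 * q + 3 * q               ≤⟨ m≤m+n _ q ⟩
        2 * q + 2 * q + 3 * q + q           ≡⟨ lem₂ q ⟩
        q * 8                               ≡⟨ cong (q *_) (pw≡2^ 3) ⟨
        q * pw 3 ∎)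
        where
        open ≤-Reasoning
        lem : ∀ h u v T → (h * u + u + 3 * v) * T ≡ u * h * T + u * T + 3 * (v * T)
        lem = solve-∀
        lem₂ : ∀ q → 2 * q + 2 * q + 3 * q + q ≡ q * 8
        lem₂ = solve-∀

      -- One raises to the power `T₃` and extracts the `q`-th root, using `pw ξ ^ T₃ ≤ 2 ^ q`.
      comparable : ∀ A B → A ^ q ≤ pw ξ * B ^ q → A ^ T₃ ≤ 2 * B ^ T₃
      comparable A B A≤ = ^-cancelʳ-≤ q (begin
        (A ^ T₃) ^ q             ≡⟨ commute A ⟩
        (A ^ q) ^ T₃             ≤⟨ ^-monoˡ-≤ T₃ A≤ ⟩
        (pw ξ * B ^ q) ^ T₃      ≡⟨ *-^ (pw ξ) (B ^ q) T₃ ⟩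
        pw ξ ^ T₃ * (B ^ q) ^ T₃ ≤⟨ *-mono-≤ (≤-trans (≤-reflexive (pw-^ ξ T₃)) (≤-trans (pw-mono-≤ ξT₃≤q) (≤-reflexive (pw≡2^ q)))) (≤-reflexive (sym (commute B))) ⟩
        2 ^ q * (B ^ T₃) ^ q     ≡⟨ *-^ 2 (B ^ T₃) q ⟨
        (2 * B ^ T₃) ^ q ∎)
        where
        open ≤-Reasoning
        commute : ∀ A → (A ^ T₃) ^ q ≡ (A ^ q) ^ T₃
        commute A = trans (^-*-assoc A T₃ q) (trans (cong (A ^_) (*-comm T₃ q)) (sym (^-*-assoc A q T₃)))

      Y^q≡ : (y ^ u) ^ q ≡ (y ^ q) ^ u
      Y^q≡ = trans (^-*-assoc y u q) (trans (cong (y ^_) (*-comm u q)) (sym (^-*-assoc y q u)))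

      G≤D : κ ≤ G
      G≤D = ≤-trans (m≤m*n κ (pw Mx)) κ≤

      Y^q≤ : (y ^ u) ^ q ≤ pw ξ * (g ^ w₀) ^ q
      Y^q≤ = begin
        (y ^ u) ^ q                              ≡⟨ Y^q≡ ⟩
        (y ^ q) ^ u                              ≤⟨ ^-monoˡ-≤ u (≤-trans (m≤n*m (y ^ q) a) (≤-reflexive eq)) ⟩
        (b * N) ^ u                              ≤⟨ ^-monoˡ-≤ u (*-monoʳ-≤ b (≤-trans (+-monoʳ-≤ G G≤D) (≤-reflexive (trans (cong (G +_) (sym (+-identityʳ G))) (cong (_* G) (sym (pw≡2^ 1))))))) ⟩
        (b * (pw 1 * G)) ^ u                     ≡⟨ trans (*-^ b _ u) (cong (b ^ u *_) (*-^ (pw 1) G u)) ⟩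
        b ^ u * (pw 1 ^ u * G ^ u)               ≡⟨ *-assoc (b ^ u) (pw 1 ^ u) (G ^ u) ⟨
        b ^ u * pw 1 ^ u * G ^ u                 ≤⟨ *-mono-≤ (pow≤pw {h = h} b≤ u ⊠ ≤-reflexive (trans (pw-^ 1 u) (cong pw (*-identityˡ u)))) G^u≤ ⟩
        pw (h * u + u) * (pw (3 * v) * (g ^ w₀) ^ q) ≡⟨ *-assoc (pw (h * u + u)) _ _ ⟨
        pw (h * u + u) * pw (3 * v) * (g ^ w₀) ^ q ≡⟨ cong (_* (g ^ w₀) ^ q) (pw-+ (h * u + u) (3 * v)) ⟨
        pw ξ * (g ^ w₀) ^ q ∎
        where
        open ≤-Reasoning
        G^u≤ : G ^ u ≤ pw (3 * v) * (g ^ w₀) ^ q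
        G^u≤ = begin
          (g ^ ν) ^ u              ≡⟨ trans (^-*-assoc g ν u) (cong (g ^_) (*-comm ν u)) ⟩
          g ^ (u * ν)              ≤⟨ ^-monoʳ-≤ g up ⟩
          g ^ (w₀ * q + v)         ≡⟨ ^-distribˡ-+-* g (w₀ * q) v ⟩
          g ^ (w₀ * q) * g ^ v     ≤⟨ *-mono-≤ (≤-reflexive (sym (^-*-assoc g w₀ q))) (pow≤pw {h = 3} g≤ v) ⟩
          (g ^ w₀) ^ q * pw (3 * v) ≡⟨ *-comm _ (pw (3 * v)) ⟩
          pw (3 * v) * (g ^ w₀) ^ q ∎

      W^q≤ : (g ^ w₀) ^ q ≤ pw ξ * (y ^ u) ^ q
      W^q≤ = begin
        (g ^ w₀) ^ q              ≡⟨ ^-*-assoc g w₀ q ⟩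
        g ^ (w₀ * q)              ≤⟨ ^-monoʳ-≤ g down ⟩
        g ^ (u * ν + v)           ≡⟨ trans (^-distribˡ-+-* g (u * ν) v) (cong (_* g ^ v) (trans (cong (g ^_) (*-comm u ν)) (sym (^-*-assoc g ν u)))) ⟩
        G ^ u * g ^ v             ≤⟨ *-mono-≤ G^u≤ (pow≤pw {h = 3} g≤ v) ⟩
        pw (h * u) * (y ^ u) ^ q * pw (3 * v) ≡⟨ lem (pw (h * u)) _ (pw (3 * v)) ⟩
        pw (h * u) * pw (3 * v) * (y ^ u) ^ q ≡⟨ cong (_* (y ^ u) ^ q) (pw-+ (h * u) (3 * v)) ⟨
        pw (h * u + 3 * v) * (y ^ u) ^ q ≤⟨ *-monoˡ-≤ ((y ^ u) ^ q) (pw-mono-≤ (+-monoˡ-≤ (3 * v) (m≤m+n (h * u) u))) ⟩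
        pw ξ * (y ^ u) ^ q ∎
        where
        open ≤-Reasoning
        lem : ∀ a b c → a * b * c ≡ a * c * b
        lem = solve-∀
        G^u≤ : G ^ u ≤ pw (h * u) * (y ^ u) ^ q
        G^u≤ = begin
          G ^ u                   ≤⟨ ^-monoˡ-≤ u (≤-trans (m≤m+n G κ) (m≤n*m N b)) ⟩
          (b * N) ^ u             ≡⟨ cong (_^ u) eq ⟨
          (a * y ^ q) ^ u         ≡⟨ *-^ a (y ^ q) u ⟩
          a ^ u * (y ^ q) ^ u     ≤⟨ *-mono-≤ (pow≤pw {h = h} a≤ u) (≤-reflexive (sym Y^q≡)) ⟩
          pw (h * u) * (y ^ u) ^ q ∎

      -- If y^u = g^w₀ the closeness at the single point t = 1 is already absurd.
      Y≢W : y ^ u ≢ g ^ w₀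
      Y≢W Y≡W = <⇒≱ pwz< (*-cancelˡ-≤ G (begin
        G * pwK 2000                       ≤⟨ *-monoˡ-≤ (pwK 2000) G≤ ⟩
        U 1 * κ * pwK 2000                 ≡⟨ *-assoc (U 1) κ _ ⟩
        U 1 * (κ * pwK 2000)               ≤⟨ *-monoʳ-≤ (U 1) (≤-trans (*-monoʳ-≤ κ (pw-mono-≤ (≤-trans (*-monoʳ-≤ K (≤ᵇ⇒≤ 2000 2002 _)) K≤))) κ≤) ⟩
        U 1 * G                            ≤⟨ *-monoˡ-≤ G U₁≤ ⟩
        pw z * G                           ≡⟨ *-comm (pw z) G ⟩
        G * pw z ∎))
        where
        open ≤-Reasoning
        1<R : 1 < R
        1<R = ≤-trans (≤-trans (≤-reflexive (sym (pw≡2^ 1))) (pw-mono-≤ (≤ᵇ⇒≤ 1 782 _))) (≤-trans (m≤m*n (pw 782) (Λ * u) {{m*n≢0 Λ u}}) (≤-reflexive (sym (*-assoc (pw 782) Λ u))))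
        0<S+L : 0 < S + L
        0<S+L = ≤-trans (s≤s z≤n) (m≤n+m L S)
        U₁≤ : U 1 ≤ pw z
        U₁≤ = ≤-trans (≤-reflexive (sym (*-identityʳ (U 1)))) (U≤ 1 0 1<R 0<S+L)
        pwz< : pw z < pwK 2000
        pwz< = pw-mono-< (≤-<-trans (*-monoˡ-≤ P (pw-mono-≤ (≤ᵇ⇒≤ 790 1307 _))) (m<m*n K 2000 (≤ᵇ⇒≤ 2 2000 _)))
        lem : ∀ u x n → u * x * n ≡ x * (u * n)
        lem = solve-∀
        UN≡VG : U 1 * N ≡ V 1 * G
        UN≡VG = *-cancelˡ-≡ _ _ ((g ^ w₀) ^ X 1) {{m^n≢0 (g ^ w₀) (X 1)}} (trans (sym (lem (U 1) _ N)) (trans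
          (trans (cong (U 1 * (g ^ w₀) ^ X 1 *_) (sym (^-identityʳ N))) (trans (related 1 1<R)
            (trans (cong (V 1 * (y ^ u) ^ X 1 *_) (^-identityʳ G)) (cong (λ A → V 1 * A ^ X 1 * G) Y≡W)))) (lem (V 1) _ G)))
        -- As integers, `U 1` and `V 1` then differ by at least 1, so that `G ≤ U 1 * κ`; but
        -- `U 1 ≤ pw z`, while `κ` is smaller than `G` by more than that factor.
        U<V : U 1 < V 1
        U<V = *-cancelʳ-< G (U 1) (V 1) (<-≤-trans (*-monoʳ-< (U 1) {{U≢0 1}} G<N) (≤-reflexive UN≡VG))
        G≤ : G ≤ U 1 * κ
        G≤ = +-cancelˡ-≤ (U 1 * G) _ _ (begin
          U 1 * G + G      ≡⟨ +-comm (U 1 * G) G ⟩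
          suc (U 1) * G    ≤⟨ *-monoˡ-≤ G U<V ⟩
          V 1 * G          ≡⟨ UN≡VG ⟨
          U 1 * (G + κ)    ≡⟨ *-distribˡ-+ (U 1) G κ ⟩
          U 1 * G + U 1 * κ ∎)

      count′ : pwK 14100 ^ (K * 16) < pwK 1000 ^ (L * K)
      count′ = count 14100 1000 (≤ᵇ⇒≤ 225601 256000 _)

      module W<Y (W<Y : g ^ w₀ < y ^ u) = ArchimedeanPowers L′ K (y ^ u) (g ^ w₀) U V X R S
        W<Y U≢0 V≢0 gap big (pw 807) (pw 512) (pwK 1000) (2 ^ K) (K * 16) (pwK 808) (pwK 13000) (pwK 14100) (pw z) (pwK 2000) xmax N G
        (comparable _ _ Y^q≤) exp≤ X+s≤ bin≤ related nearᴺ V≤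
        class< count′ (head-small Z^L′≤) (tail-small Z^L′≤) (error-small Z^L′≤)

      -- Here `1 / β` and `1 / ζ` replace `β` and `ζ`, as the increments `d l` are natural numbers;
      -- accordingly `U` and `V`, and `N` and `G`, change places.
      module Y<W (Y<W : y ^ u < g ^ w₀) = ArchimedeanPowers L′ K (g ^ w₀) (y ^ u) V U X R S
        Y<W V≢0 U≢0 gap big (pw 807) (pw 512) (pwK 1000) (2 ^ K) (K * 16) (pwK 808) (pwK 13000) (pwK 14100) (pw z) (pwK 2000) xmax G N
        (comparable _ _ W^q≤) exp≤ X+s≤ bin≤ (λ t t<R → sym (related t t<R)) nearᴳ U≤
        class< count′ (head-small Z^L′≤) (tail-small Z^L′≤) (error-small Z^L′≤)

    impossible : ⊥
    impossible with <-cmp (y ^ u) (g ^ w₀)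
    ... | tri< Y<W _ _ = Y<W.impossible Y<W
    ... | tri≈ _ Y≡W _ = Y≢W Y≡W
    ... | tri> _ _ W<Y = W<Y.impossible W<Y

-- Logarithms, Dirichlet's theorem, powers of odd numbers, and the equation over the naturals.

log-bounds : ∀ y → 1 ≤ y → Σ ℕ λ k → 2 ^ k ≤ y × y < 2 ^ suc k
log-bounds (suc zero)      _ = 0 , s≤s z≤n , s≤s (s≤s z≤n)
log-bounds (suc y@(suc _)) _ with log-bounds y (s≤s z≤n)
... | k , lo , hi with suc y <? 2 ^ suc k
...   | yes lt = k , m≤n⇒m≤1+n lo , lt
...   | no ¬lt = suc k , ≮⇒≥ ¬lt , ≤-<-trans hi (^-monoʳ-< 2 (s≤s (s≤s z≤n)) (n<1+n (suc k)))

height-bound : ∀ H → 1 ≤ H → H ≤ pw (suc ⌊log₂ H ⌋)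
height-bound H 1≤H with log-bounds H 1≤H
... | k , lo , hi = ≤-trans (<⇒≤ hi) (≤-trans (≤-reflexive (sym (pw≡2^ (suc k))))
  (pw-mono-≤ (s≤s (≤-trans (≤-reflexive (sym (⌊log₂[2^n]⌋≡n k))) (⌊log₂⌋-mono-≤ lo)))))

div-≡⇒≤ : ∀ a b m .{{_ : NonZero m}} → a div m ≡ b div m → a ≤ b + m
div-≡⇒≤ a b m eq = begin
  a                        ≡⟨ m≡m%n+[m/n]*n a m ⟩
  a mod m + a div m * m    ≤⟨ +-mono-≤ (<⇒≤ (m%n<n a m)) (≤-reflexive (cong (_* m) eq)) ⟩
  m + b div m * m          ≤⟨ +-monoʳ-≤ m (≤-trans (m≤n+m _ (b mod m)) (≤-reflexive (sym (m≡m%n+[m/n]*n b m)))) ⟩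
  m + b                    ≡⟨ +-comm m b ⟩
  b + m ∎
  where open ≤-Reasoning

-- The witness v is ∣ u ν - w q ∣.
dirichlet : ∀ ν q T .{{_ : NonZero q}} .{{_ : NonZero T}} →
  Σ ℕ λ u → Σ ℕ λ w → Σ ℕ λ v → 1 ≤ u × u ≤ T × v * T ≤ q × u * ν ≤ w * q + v × w * q ≤ u * ν + v
dirichlet ν q T with FP.pigeonhole (n<1+n T) bucket
  where
  bucket : Fin (suc T) → Fin T
  -- The fractional parts of `i ν / q` for the `T + 1` values of `i` are put into `T` intervals of
  -- length `1 / T`.
  bucket i = fromℕ< (m<n*o⇒m/o<n {((toℕ i * ν) mod q) * T} {T} {q} (≤-trans (*-monoˡ-< T (m%n<n (toℕ i * ν) q)) (≤-reflexive (*-comm q T))))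
... | i , j , i<j , same = u , w , ∣ r j - r i ∣ , m<n⇒0<n∸m i<j , ≤-trans (m∸n≤m (toℕ j) (toℕ i)) (FP.toℕ≤pred[n] j) ,
    v≤ (≤-total (r i) (r j)) , up (≤-total (r i) (r j)) , down (≤-total (r i) (r j))
  where
  r Q : Fin (suc T) → ℕ
  r i = (toℕ i * ν) mod q
  Q i = (toℕ i * ν) div q
  u = toℕ j ∸ toℕ i
  w = Q j ∸ Q i
  buckets : (r i * T) div q ≡ (r j * T) div q
  buckets = trans (sym (FP.toℕ-fromℕ< _)) (trans (cong toℕ same) (FP.toℕ-fromℕ< _))
  balance : r j + w * q ≡ r i + u * ν
  balance = +-cancelʳ-≡ (Q i * q) _ _ (begin
    r j + w * q + Q i * q        ≡⟨ +-assoc (r j) _ _ ⟩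
    r j + (w * q + Q i * q)      ≡⟨ cong (r j +_) (trans (sym (*-distribʳ-+ q w (Q i))) (cong (_* q) (m∸n+n≡m (/-monoˡ-≤ q (*-monoˡ-≤ ν (<⇒≤ i<j)))))) ⟩
    r j + Q j * q                ≡⟨ m≡m%n+[m/n]*n (toℕ j * ν) q ⟨
    toℕ j * ν                    ≡⟨ cong (_* ν) (m∸n+n≡m (<⇒≤ i<j)) ⟨
    (u + toℕ i) * ν              ≡⟨ *-distribʳ-+ ν u (toℕ i) ⟩
    u * ν + toℕ i * ν            ≡⟨ cong (u * ν +_) (m≡m%n+[m/n]*n (toℕ i * ν) q) ⟩
    u * ν + (r i + Q i * q)      ≡⟨ lem (u * ν) (r i) (Q i * q) ⟩
    r i + u * ν + Q i * q ∎)
    where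
    open ≡-Reasoning
    lem : ∀ a b c → a + (b + c) ≡ b + a + c
    lem = solve-∀
  v≤ : r i ≤ r j ⊎ r j ≤ r i → ∣ r j - r i ∣ * T ≤ q
  v≤ (inj₁ le) = ≤-trans (≤-reflexive (trans (cong (_* T) (m≤n⇒∣n-m∣≡n∸m le)) (*-distribʳ-∸ T (r j) (r i)))) (m≤n+o⇒m∸n≤o _ _ (div-≡⇒≤ (r j * T) (r i * T) q (sym buckets)))
  v≤ (inj₂ ge) = ≤-trans (≤-reflexive (trans (cong (_* T) (m≤n⇒∣m-n∣≡n∸m ge)) (*-distribʳ-∸ T (r i) (r j)))) (m≤n+o⇒m∸n≤o _ _ (div-≡⇒≤ (r i * T) (r j * T) q buckets))
  up : r i ≤ r j ⊎ r j ≤ r i → u * ν ≤ w * q + ∣ r j - r i ∣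
  up (inj₁ le) = +-cancelˡ-≤ (r i) _ _ (≤-reflexive (begin
    r i + u * ν                    ≡⟨ balance ⟨
    r j + w * q                    ≡⟨ cong (_+ w * q) (m+[n∸m]≡n le) ⟨
    r i + (r j ∸ r i) + w * q      ≡⟨ lem (r i) (r j ∸ r i) (w * q) ⟩
    r i + (w * q + (r j ∸ r i))    ≡⟨ cong (λ v → r i + (w * q + v)) (m≤n⇒∣n-m∣≡n∸m le) ⟨
    r i + (w * q + ∣ r j - r i ∣) ∎))
    where
    open ≡-Reasoning
    lem : ∀ a b c → a + b + c ≡ a + (c + b)
    lem = solve-∀
  up (inj₂ ge) = ≤-trans (+-cancelˡ-≤ (r j) _ _ (≤-trans (+-monoˡ-≤ (u * ν) ge) (≤-reflexive (sym balance)))) (m≤m+n _ _)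
  down : r i ≤ r j ⊎ r j ≤ r i → w * q ≤ u * ν + ∣ r j - r i ∣
  down (inj₁ le) = ≤-trans (+-cancelˡ-≤ (r i) _ _ (≤-trans (+-monoˡ-≤ (w * q) le) (≤-reflexive balance))) (m≤m+n _ _)
  down (inj₂ ge) = +-cancelˡ-≤ (r j) _ _ (≤-reflexive (begin
    r j + w * q                    ≡⟨ balance ⟩
    r i + u * ν                    ≡⟨ cong (_+ u * ν) (m+[n∸m]≡n ge) ⟨
    r j + (r i ∸ r j) + u * ν      ≡⟨ lem (r j) (r i ∸ r j) (u * ν) ⟩
    r j + (u * ν + (r i ∸ r j))    ≡⟨ cong (λ v → r j + (u * ν + v)) (m≤n⇒∣m-n∣≡n∸m ge) ⟨
    r j + (u * ν + ∣ r j - r i ∣) ∎))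
    where
    open ≡-Reasoning
    lem : ∀ a b c → a + b + c ≡ a + (c + b)
    lem = solve-∀

-- Squaring `1 + 2 ^ suc e * c` gains one more factor 2.
odd-power : ∀ r e → Σ ℕ λ c → (1 + 2 * r) ^ (2 ^ e) ≡ 1 + 2 ^ suc e * c
odd-power r zero    = r , *-identityʳ _
odd-power r (suc e) with odd-power r e
... | c , eq = c + 2 ^ e * (c * c) , (begin
  (1 + 2 * r) ^ (2 * 2 ^ e)                  ≡⟨ trans (cong ((1 + 2 * r) ^_) (*-comm 2 (2 ^ e))) (sym (^-*-assoc (1 + 2 * r) (2 ^ e) 2)) ⟩
  ((1 + 2 * r) ^ 2 ^ e) ^ 2                  ≡⟨ cong (_^ 2) eq ⟩
  (1 + 2 * 2 ^ e * c) ^ 2                    ≡⟨ lem (2 ^ e) c ⟩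
  1 + 2 * (2 * 2 ^ e) * (c + 2 ^ e * (c * c)) ∎)
  where
  open ≡-Reasoning
  lem : ∀ x c → (1 + 2 * x * c) * ((1 + 2 * x * c) * 1) ≡ 1 + 2 * (2 * x) * (c + x * (c * c))
  lem = solve-∀

odd-power-∣ : ∀ r e → pw e ℕ∣.∣ (1 + 2 * r) ^ pw e ∸ 1
odd-power-∣ r e with odd-power r e
... | c , eq = subst₂ (λ a p → a ℕ∣.∣ (1 + 2 * r) ^ p ∸ 1) (sym (pw≡2^ e)) (sym (pw≡2^ e))
  (ℕ∣.divides (2 * c) (trans (cong (_∸ 1) eq) (lem (2 ^ e) c)))
  where
  lem : ∀ x c → 2 * x * c ≡ 2 * c * x
  lem = solve-∀

-- Modulo 2 the product is `b`, so one factor 2 can be split off from `b` and cancelled at a time.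
odd-cofactor : ∀ q b r → 2 ^ q ℕ∣.∣ b * (1 + 2 * r) → 2 ^ q ℕ∣.∣ b
odd-cofactor zero    b r _ = ℕ∣.1∣ b
odd-cofactor (suc q) b r d with ℕ∣.∣m+n∣m⇒∣n {2} {2 * (b * r)} {b}
    (subst (2 ℕ∣.∣_) (lem b r) (ℕ∣.∣-trans (ℕ∣.m∣m*n (2 ^ q)) d)) (ℕ∣.m∣m*n (b * r))
  where
  lem : ∀ b r → b * (1 + 2 * r) ≡ 2 * (b * r) + b
  lem = solve-∀
... | ℕ∣.divides b′ refl = subst (2 ^ suc q ℕ∣.∣_) (*-comm 2 b′) (ℕ∣.*-monoʳ-∣ 2 (odd-cofactor q b′ r
  (ℕ∣.*-cancelˡ-∣ 2 (subst (2 ^ suc q ℕ∣.∣_) (lem b′ (1 + 2 * r)) d))))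
  where
  lem : ∀ b n → b * 2 * n ≡ 2 * (b * n)
  lem = solve-∀

even⊎odd : ∀ y → (2 ℕ∣.∣ y) ⊎ (Σ ℕ λ r → y ≡ 1 + 2 * r)
even⊎odd zero = inj₁ (2 ℕ∣.∣0)
even⊎odd (suc y) with even⊎odd y
... | inj₁ (ℕ∣.divides r eq) = inj₂ (r , cong suc (trans eq (*-comm r 2)))
... | inj₂ (r , eq) = inj₁ (ℕ∣.divides (suc r) (trans (cong suc eq) (lem r)))
  where
  lem : ∀ r → suc (1 + 2 * r) ≡ suc r * 2
  lem = solve-∀

ℕ-equation : ∀ A N Y → (pos N ℚ./ 1) ≡ A ℚ.* (pos Y ℚ./ 1) → ∣ ℚ.↥ A ∣ * Y ≡ ℚ.↧ₙ A * N
ℕ-equation A@(ℚ.mkℚ i d-1 _) N Y eq = begin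
  ∣ ℚ.↥ A ∣ * Y                       ≡⟨ ∣i*pos∣ (ℚ.↥ A) Y ⟨
  ∣ ℚ.↥ A *ᶻ pos Y ∣                  ≡⟨ cong ∣_∣ (ℤP.*-identityʳ (ℚ.↥ A *ᶻ pos Y)) ⟨
  ∣ (ℚ.↥ A *ᶻ pos Y) *ᶻ 1ℤ ∣          ≡⟨ cong ∣_∣ (ℚᵘP.drop-*≡* cross) ⟨
  ∣ pos N *ᶻ pos (ℚ.↧ₙ A * 1) ∣      ≡⟨ ∣i*pos∣ (pos N) (ℚ.↧ₙ A * 1) ⟩
  N * (ℚ.↧ₙ A * 1)                    ≡⟨ trans (cong (N *_) (*-identityʳ (ℚ.↧ₙ A))) (*-comm N (ℚ.↧ₙ A)) ⟩
  ℚ.↧ₙ A * N ∎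
  where
  open ≡-Reasoning
  cross : ℚᵘ.mkℚᵘ (pos N) 0 ℚᵘ.≃ ℚ.toℚᵘ A ℚᵘ.* ℚᵘ.mkℚᵘ (pos Y) 0
  cross = ℚᵘP.≃-trans (ℚᵘP.≃-sym (ℚP.toℚᵘ-fromℚᵘ (ℚᵘ.mkℚᵘ (pos N) 0)))
    (ℚᵘP.≃-trans (ℚP.toℚᵘ-cong eq) (ℚᵘP.≃-trans (ℚP.toℚᵘ-homo-* A (pos Y ℚ./ 1))
      (ℚᵘP.*-congˡ {ℚ.toℚᵘ A} (ℚP.toℚᵘ-fromℚᵘ (ℚᵘ.mkℚᵘ (pos Y) 0)))))

-- The contradiction for a solution with large exponent.

module Contradiction (L′ : ℕ) (L′≡255 : L′ ≡ 255) (q a b y hA k : ℕ)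
  .{{_ : NonZero a}} .{{_ : NonZero b}} (a≤ : a ≤ pw hA) (b≤ : b ≤ pw hA)
  (1≤k : 1 ≤ k) (2^k≤y : pw k ≤ y) (y≤ : y ≤ pw (suc k))
  (large : pw 2990 * suc hA ≤ q) where

  private
    Λ : ℕ
    Λ = suc k

    instance
      q≢0 : NonZero q
      q≢0 = >-nonZero (≤-trans (>-nonZero⁻¹ (pw 2990 * suc hA) {{m*n≢0 (pw 2990) (suc hA)}}) large)
      y≢0 : NonZero y
      y≢0 = >-nonZero (≤-trans (>-nonZero⁻¹ (pw k)) 2^k≤y)

    pw2990≤q : pw 2990 ≤ q
    pw2990≤q = ≤-trans (m≤m*n (pw 2990) (suc hA)) large

    hA≤q : hA ≤ q
    hA≤q = ≤-trans (n≤1+n hA) (≤-trans (m≤n*m (suc hA) (pw 2990)) large)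

    4hA≤ : 4 * hA ≤ Λ * q
    4hA≤ = ≤-trans (*-mono-≤ (≤-trans (≤-reflexive (sym (pw≡2^ 2))) (pw-mono-≤ (≤ᵇ⇒≤ 2 2990 _))) (n≤1+n hA)) (≤-trans large (m≤n*m q Λ))

    1<y : 1 < y
    1<y = ≤-trans (≤-trans (≤-reflexive (sym (pw≡2^ 1))) (pw-mono-≤ 1≤k)) 2^k≤y

    pw-cancel-≤ : ∀ {m n} → pw m ≤ pw n → m ≤ n
    pw-cancel-≤ {m} {n} le with m ≤? n
    ... | yes m≤n = m≤n
    ... | no m≰n  = ⊥-elim (<⇒≱ (pw-mono-< (≰⇒> m≰n)) le)

  -- The size of `N` controls `k * q` up to the height `hA`, which `large` makes negligible, and
  -- `Λ ≤ 2 * k`. Thus a precision proportional to `log N` is one proportional to `Λ * q`.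
  Λq≤ : ∀ N x → a * y ^ q ≡ b * N → N ≤ pw x → Λ * q ≤ 4 * x
  Λq≤ N x eq N≤ = +-cancelˡ-≤ (Λ * q) _ _ (begin
    Λ * q + Λ * q           ≡⟨ lem Λ q ⟩
    2 * (Λ * q)             ≤⟨ *-monoʳ-≤ 2 (begin
      Λ * q                   ≤⟨ *-monoˡ-≤ q (+-monoˡ-≤ k 1≤k) ⟩
      (k + k) * q             ≡⟨ lem₂ k q ⟩
      2 * (k * q)             ≤⟨ *-monoʳ-≤ 2 kq≤ ⟩
      2 * (hA + x) ∎) ⟩
    2 * (2 * (hA + x))      ≡⟨ lem₃ hA x ⟩
    4 * hA + 4 * x          ≤⟨ +-monoˡ-≤ (4 * x) 4hA≤ ⟩
    Λ * q + 4 * x ∎)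
    where
    open ≤-Reasoning
    lem : ∀ l q → l * q + l * q ≡ 2 * (l * q)
    lem = solve-∀
    lem₂ : ∀ k q → (k + k) * q ≡ 2 * (k * q)
    lem₂ = solve-∀
    lem₃ : ∀ h x → 2 * (2 * (h + x)) ≡ 4 * h + 4 * x
    lem₃ = solve-∀
    kq≤ : k * q ≤ hA + x
    kq≤ = pw-cancel-≤ (begin
      pw (k * q)     ≡⟨ pw-^ k q ⟨
      pw k ^ q       ≤⟨ ^-monoˡ-≤ q 2^k≤y ⟩
      y ^ q          ≤⟨ m≤n*m (y ^ q) a ⟩
      a * y ^ q      ≡⟨ eq ⟩
      b * N          ≤⟨ b≤ ⊠ N≤ ⟩
      pw (hA + x) ∎)

  module Scale (u : ℕ) .{{_ : NonZero u}} (u≤ : u ≤ pw 1330) where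

    uT h : ℕ
    uT = u * pw 1330

    instance
      uT≢0 : NonZero uT
      uT≢0 = m*n≢0 u (pw 1330)

    h = suc (q div uT)

    uT≤pw : uT ≤ pw 2660
    uT≤pw = u≤ ⊠ ≤-refl {pw 1330}

    uhT≡ : u * h * pw 1330 ≡ uT + (q div uT) * uT
    uhT≡ = lem u (q div uT) (pw 1330)
      where
      lem : ∀ u d T → u * suc d * T ≡ u * T + d * (u * T)
      lem = solve-∀

    q≤ : q ≤ u * h * pw 1330
    q≤ = ≤-trans (≤-reflexive (m≡m%n+[m/n]*n q uT)) (≤-trans (+-monoˡ-≤ _ (<⇒≤ (m%n<n q uT))) (≤-reflexive (sym uhT≡)))

    ≤q : u * h * pw 1330 ≤ 2 * q
    ≤q = begin
      u * h * pw 1330            ≡⟨ uhT≡ ⟩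
      uT + (q div uT) * uT       ≤⟨ +-mono-≤ (≤-trans uT≤pw (≤-trans (pw-mono-≤ (≤ᵇ⇒≤ 2660 2990 _)) pw2990≤q))
                                      (≤-trans (m≤n+m _ (q mod uT)) (≤-reflexive (sym (m≡m%n+[m/n]*n q uT)))) ⟩
      q + q                      ≡⟨ cong (q +_) (+-identityʳ q) ⟨
      2 * q ∎
      where open ≤-Reasoning

    -- The product `u * pw 1330` can reach `pw 2660`, so the hypothesis `large` needs a constant of
    -- at least this order; the exponent 2990 leaves room.
    hA≤h : hA ≤ h
    hA≤h = *-cancelʳ-≤ hA h uT (begin
      hA * uT             ≤⟨ *-mono-≤ (n≤1+n hA) (≤-trans uT≤pw (pw-mono-≤ (≤ᵇ⇒≤ 2660 2990 _))) ⟩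
      suc hA * pw 2990    ≡⟨ *-comm (suc hA) (pw 2990) ⟩
      pw 2990 * suc hA    ≤⟨ large ⟩
      q                   ≤⟨ q≤ ⟩
      u * h * pw 1330     ≡⟨ lem u h (pw 1330) ⟩
      h * uT ∎)
      where
      open ≤-Reasoning
      lem : ∀ u h T → u * h * T ≡ h * (u * T)
      lem = solve-∀

    module St = Setup L′ L′≡255 q u h Λ q≤ ≤q

    -- As `P` is at most about `Λ q / 2 ^ 1329`, the exponents `8 + 1307 + 15 = 1330` leave
    -- `K * 2002` below the available precision.
    K≤ : ∀ Mx → Λ * q ≤ pw 7 * Mx → St.K * 2002 ≤ Mx
    K≤ Mx Λq≤ = *-cancelˡ-≤ (pw 8) (begin
      pw 8 * (St.K * 2002)                    ≤⟨ *-monoʳ-≤ (pw 8) (*-monoʳ-≤ St.K (≤-trans (≤ᵇ⇒≤ 2002 2048 _) (≤-trans (≤-reflexive (sym (pw≡2^ 11))) (pw-mono-≤ (≤ᵇ⇒≤ 11 15 _))))) ⟩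
      pw 8 * (pw 1307 * St.P * pw 15)         ≡⟨ lem (pw 8) (pw 1307) (h * Λ * u) (pw 15) ⟩
      pw 8 * (pw 1307 * pw 15) * (h * Λ * u)  ≡⟨ cong (_* (h * Λ * u)) (trans (cong (pw 8 *_) (sym (pw-+ 1307 15))) (sym (pw-+ 8 1322))) ⟩
      pw 1330 * (h * Λ * u)                   ≡⟨ lem₂ (pw 1330) h Λ u ⟩
      Λ * (u * h * pw 1330)                   ≤⟨ *-monoʳ-≤ Λ ≤q ⟩
      Λ * (2 * q)                             ≡⟨ lem₃ Λ q ⟩
      2 * (Λ * q)                             ≤⟨ *-monoʳ-≤ 2 Λq≤ ⟩
      2 * (pw 7 * Mx)                         ≡⟨ trans (sym (*-assoc 2 (pw 7) Mx)) (cong (_* Mx) (2* 7)) ⟩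
      pw 8 * Mx ∎)
      where
      open ≤-Reasoning
      lem : ∀ a b P c → a * (b * P * c) ≡ a * (b * c) * P
      lem = solve-∀
      lem₂ : ∀ T h l u → T * (h * l * u) ≡ l * (u * h * T)
      lem₂ = solve-∀
      lem₃ : ∀ l q → l * (2 * q) ≡ 2 * (l * q)
      lem₃ = solve-∀

  -- The hypothesis `ν ≤ 4 * suc Mx` says that the precision `Mx` is at least a fixed fraction of
  -- `log (g ^ ν)`, up to a constant; with `Λq≤` this makes it a fixed fraction of `Λ * q`.
  -- Dirichlet's theorem is applied to `ν / q` because `y ^ u` is near `g ^ (u ν / q)`, and this has
  -- to be near an integral power of `g`.
  archimedean : ∀ g ν κ Mx → pw 1 ≤ g → g ≤ pw 3 → .{{_ : NonZero κ}} →
    a * y ^ q ≡ b * (g ^ ν + κ) → κ * pw Mx ≤ g ^ ν → 1 ≤ ν → ν ≤ 4 * suc Mx → ⊥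
  archimedean g ν κ Mx 2≤g g≤ eq κ≤ 1≤ν ν≤ with dirichlet ν q (pw 1330)
  ... | u , w₀ , v , 1≤u , u≤ , v≤ , up , down = Sc.St.Arch.impossible a b y g ν κ v w₀ Mx
      (≤-trans a≤ (pw-mono-≤ Sc.hA≤h)) (≤-trans b≤ (pw-mono-≤ Sc.hA≤h)) y≤ g≤ eq κ≤ (Sc.K≤ Mx Λq≤Mx) v≤ up down w₀≤
    where
    instance
      u≢0 : NonZero u
      u≢0 = >-nonZero 1≤u
      g≢0 : NonZero g
      g≢0 = >-nonZero (≤-trans (>-nonZero⁻¹ (pw 1)) 2≤g)
    module Sc = Scale u u≤
    open ≤-Reasoning
    N : ℕ
    N = g ^ ν + κ
    N≤ : N ≤ pw (1 + 3 * ν)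
    N≤ = begin
      g ^ ν + κ                ≤⟨ +-monoʳ-≤ (g ^ ν) (≤-trans (m≤m*n κ (pw Mx)) κ≤) ⟩
      g ^ ν + g ^ ν            ≡⟨ cong (g ^ ν +_) (+-identityʳ (g ^ ν)) ⟨
      2 * g ^ ν                ≤⟨ ≤-reflexive (sym (pw≡2^ 1)) ⊠ pow≤pw {h = 3} g≤ ν ⟩
      pw (1 + 3 * ν) ∎
    Λq≤16ν : Λ * q ≤ 16 * ν
    Λq≤16ν = begin
      Λ * q              ≤⟨ Λq≤ N (1 + 3 * ν) eq N≤ ⟩
      4 * (1 + 3 * ν)    ≤⟨ *-monoʳ-≤ 4 (+-monoˡ-≤ (3 * ν) 1≤ν) ⟩
      4 * (ν + 3 * ν)    ≡⟨ lem ν ⟩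
      16 * ν ∎
      where
      lem : ∀ n → 4 * (n + 3 * n) ≡ 16 * n
      lem = solve-∀
    Λq≤64 : Λ * q ≤ 64 * suc Mx
    Λq≤64 = begin
      Λ * q              ≤⟨ Λq≤16ν ⟩
      16 * ν             ≤⟨ *-monoʳ-≤ 16 ν≤ ⟩
      16 * (4 * suc Mx)  ≡⟨ lem (suc Mx) ⟩
      64 * suc Mx ∎
      where
      lem : ∀ n → 16 * (4 * n) ≡ 64 * n
      lem = solve-∀
    1≤Mx : 1 ≤ Mx
    1≤Mx = s≤s⁻¹ (*-cancelˡ-< 64 1 (suc Mx) (≤-trans (≤-trans (≤ᵇ⇒≤ 65 128 _) (≤-trans (≤-reflexive (sym (pw≡2^ 7))) (≤-trans (pw-mono-≤ (≤ᵇ⇒≤ 7 2990 _)) pw2990≤q)))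
      (≤-trans (m≤n*m q Λ) Λq≤64)))
    Λq≤Mx : Λ * q ≤ pw 7 * Mx
    Λq≤Mx = begin
      Λ * q              ≤⟨ Λq≤64 ⟩
      64 * suc Mx        ≤⟨ *-monoʳ-≤ 64 (+-monoˡ-≤ Mx 1≤Mx) ⟩
      64 * (Mx + Mx)     ≡⟨ lem Mx ⟩
      128 * Mx           ≡⟨ cong (_* Mx) (pw≡2^ 7) ⟨
      pw 7 * Mx ∎
      where
      lem : ∀ n → 64 * (n + n) ≡ 128 * n
      lem = solve-∀
    ν≤2Λq : ν ≤ 2 * (Λ * q)
    ν≤2Λq = ≤-trans (pw-cancel-≤ (begin
      pw ν               ≡⟨ trans (cong pw (sym (*-identityˡ ν))) (sym (pw-^ 1 ν)) ⟩
      pw 1 ^ ν           ≤⟨ ^-monoˡ-≤ ν 2≤g ⟩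
      g ^ ν              ≤⟨ ≤-trans (m≤m+n (g ^ ν) κ) (m≤n*m N b) ⟩
      b * N              ≡⟨ eq ⟨
      a * y ^ q          ≤⟨ a≤ ⊠ pow≤pw {h = Λ} y≤ q ⟩
      pw (hA + Λ * q) ∎)) (≤-trans (+-monoˡ-≤ (Λ * q) (≤-trans hA≤q (m≤n*m q Λ))) (≤-reflexive (cong (Λ * q +_) (sym (+-identityʳ (Λ * q))))))
    w₀≤ : w₀ ≤ pw 2 * (u * Λ)
    w₀≤ = *-cancelʳ-≤ w₀ (pw 2 * (u * Λ)) q (begin
      w₀ * q                          ≤⟨ down ⟩
      u * ν + v                       ≤⟨ +-mono-≤ (*-monoʳ-≤ u ν≤2Λq) (≤-trans (m≤m*n v (pw 1330)) v≤) ⟩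
      u * (2 * (Λ * q)) + q           ≤⟨ +-monoʳ-≤ (u * (2 * (Λ * q))) (≤-trans (m≤n*m q (2 * (u * Λ)) {{m*n≢0 2 (u * Λ) {{_}} {{m*n≢0 u Λ}}}}) (≤-reflexive (lem u Λ q))) ⟩
      u * (2 * (Λ * q)) + 2 * (u * Λ * q) ≡⟨ lem₂ u Λ q ⟩
      4 * (u * Λ) * q                 ≡⟨ cong (λ c → c * (u * Λ) * q) (pw≡2^ 2) ⟨
      pw 2 * (u * Λ) * q ∎)
      where
      lem : ∀ u l q → 2 * (u * l) * q ≡ 2 * (u * l * q)
      lem = solve-∀
      lem₂ : ∀ u l q → u * (2 * (l * q)) + 2 * (u * l * q) ≡ 4 * (u * l) * q
      lem₂ = solve-∀

  module _ (m n : ℕ) (1≤m : 1 ≤ m) (1≤n : 1 ≤ n) (eq : a * y ^ q ≡ b * (2 ^ m + 6 ^ n + 1)) where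

    private
      N : ℕ
      N = 2 ^ m + 6 ^ n + 1

      6^≡ : ∀ n → 6 ^ n ≡ 2 ^ n * 3 ^ n
      6^≡ n = *-^ 2 3 n

      2≤pw3 : 2 ≤ pw 3
      2≤pw3 = ≤-trans (≤ᵇ⇒≤ 2 8 _) (≤-reflexive (sym (pw≡2^ 3)))

      6≤pw3 : 6 ≤ pw 3
      6≤pw3 = ≤-trans (≤ᵇ⇒≤ 6 8 _) (≤-reflexive (sym (pw≡2^ 3)))

      6^n≤ : 6 ^ n ≤ pw (3 * n)
      6^n≤ = pow≤pw {h = 3} 6≤pw3 n

    -- Here `κ ≤ 2 ^ (n + 1)` while `6 ^ n ≥ 4 ^ n`, which leaves the precision `n - 1`.
    m≤n-case : m ≤ n → ⊥
    m≤n-case m≤n = archimedean 6 n (2 ^ m + 1) (n ∸ 1) (≤-trans (≤-reflexive (pw≡2^ 1)) (≤ᵇ⇒≤ 2 6 _)) 6≤pw3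
      {{>-nonZero (≤-trans (s≤s z≤n) (m≤n+m 1 (2 ^ m)))}}
      (trans eq (cong (b *_) (lem (2 ^ m) (6 ^ n)))) κ≤ 1≤n (≤-trans (≤-reflexive (sym 1+[n∸1])) (m≤n*m (suc (n ∸ 1)) 4))
      where
      open ≤-Reasoning
      lem : ∀ a b → a + b + 1 ≡ b + (a + 1)
      lem = solve-∀
      1+[n∸1] : suc (n ∸ 1) ≡ n
      1+[n∸1] = m+[n∸m]≡n 1≤n
      κ≤ : (2 ^ m + 1) * pw (n ∸ 1) ≤ 6 ^ n
      κ≤ = begin
        (2 ^ m + 1) * pw (n ∸ 1)       ≤⟨ *-monoˡ-≤ (pw (n ∸ 1)) (+-mono-≤ (^-monoʳ-≤ 2 m≤n) (m^n>0 2 n)) ⟩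
        (2 ^ n + 2 ^ n) * pw (n ∸ 1)   ≡⟨ lem₂ (2 ^ n) (pw (n ∸ 1)) ⟩
        2 ^ n * (2 * pw (n ∸ 1))       ≡⟨ cong (2 ^ n *_) (trans (2* (n ∸ 1)) (trans (cong pw 1+[n∸1]) (pw≡2^ n))) ⟩
        2 ^ n * 2 ^ n                  ≤⟨ *-monoʳ-≤ (2 ^ n) (^-monoˡ-≤ n (≤ᵇ⇒≤ 2 3 _)) ⟩
        2 ^ n * 3 ^ n                  ≡⟨ 6^≡ n ⟨
        6 ^ n ∎
        where
        lem₂ : ∀ a p → (a + a) * p ≡ a * (2 * p)
        lem₂ = solve-∀

    -- As `6 ^ n ≤ 2 ^ (3 n)`, the remainder is at most `2 ^ (3 n + 1)`, and `3 n ≤ 3 m / 4` leaves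
    -- a precision of about `m / 4`.
    4n≤m-case : 4 * n ≤ m → ⊥
    4n≤m-case 4n≤m = archimedean 2 m (6 ^ n + 1) (m ∸ suc (3 * n)) (≤-reflexive (pw≡2^ 1)) 2≤pw3
      {{>-nonZero (≤-trans (s≤s z≤n) (m≤n+m 1 (6 ^ n)))}}
      (trans eq (cong (b *_) (+-assoc (2 ^ m) (6 ^ n) 1))) κ≤ 1≤m m≤
      where
      open ≤-Reasoning
      3n<m : suc (3 * n) ≤ m
      3n<m = ≤-trans (+-monoˡ-≤ (3 * n) 1≤n) 4n≤m
      Mx : ℕ
      Mx = m ∸ suc (3 * n)
      split : suc (3 * n) + Mx ≡ m
      split = m+[n∸m]≡n 3n<m
      κ≤ : (6 ^ n + 1) * pw Mx ≤ 2 ^ m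
      κ≤ = begin
        (6 ^ n + 1) * pw Mx              ≤⟨ *-monoˡ-≤ (pw Mx) (+-mono-≤ 6^n≤ (>-nonZero⁻¹ (pw (3 * n)))) ⟩
        (pw (3 * n) + pw (3 * n)) * pw Mx ≡⟨ cong (_* pw Mx) (trans (cong (pw (3 * n) +_) (sym (+-identityʳ _))) (2* (3 * n))) ⟩
        pw (suc (3 * n)) * pw Mx         ≡⟨ pw-+ (suc (3 * n)) Mx ⟨
        pw (suc (3 * n) + Mx)            ≡⟨ cong pw split ⟩
        pw m                             ≡⟨ pw≡2^ m ⟩
        2 ^ m ∎
      m≤ : m ≤ 4 * suc Mx
      m≤ = +-cancelˡ-≤ (3 * m) _ _ (begin
        3 * m + m                        ≡⟨ lem m ⟩
        4 * m                            ≡⟨ cong (4 *_) split ⟨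
        4 * (suc (3 * n) + Mx)           ≡⟨ lem₂ n Mx ⟩
        3 * (4 * n) + 4 * suc Mx         ≤⟨ +-monoˡ-≤ (4 * suc Mx) (*-monoʳ-≤ 3 4n≤m) ⟩
        3 * m + 4 * suc Mx ∎)
        where
        lem : ∀ m → 3 * m + m ≡ 4 * m
        lem = solve-∀
        lem₂ : ∀ n x → 4 * (suc (3 * n) + x) ≡ 3 * (4 * n) + 4 * suc x
        lem₂ = solve-∀

    half : ℕ
    half = 2 ^ (m ∸ 1) + 3 * 6 ^ (n ∸ 1)

    N≡1+2half : N ≡ 1 + 2 * half
    N≡1+2half = trans (cong₂ (λ i j → 2 ^ i + 6 ^ j + 1) (sym (m+[n∸m]≡n 1≤m)) (sym (m+[n∸m]≡n 1≤n))) (lem (2 ^ (m ∸ 1)) (6 ^ (n ∸ 1)))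
      where
      lem : ∀ a b → 2 * a + 6 * b + 1 ≡ 1 + 2 * (a + 3 * b)
      lem = solve-∀

    -- `N` is odd, so all of `2 ^ q` would have to divide `b`, although `b ≤ 2 ^ hA` and `hA < q`.
    y-not-even : ¬ 2 ℕ∣.∣ y
    y-not-even 2∣y = <⇒≱ hA<q (pw-cancel-≤ (≤-trans (≤-trans (≤-reflexive (pw≡2^ q)) (ℕ∣.∣⇒≤ 2^q∣b)) b≤))
      where
      ^-pres-∣ : ∀ i → 2 ^ i ℕ∣.∣ y ^ i
      ^-pres-∣ zero    = ℕ∣.∣-refl
      ^-pres-∣ (suc i) = ℕ∣.*-pres-∣ 2∣y (^-pres-∣ i)
      2^q∣b : 2 ^ q ℕ∣.∣ b
      2^q∣b = odd-cofactor q b half (subst (2 ^ q ℕ∣.∣_) (trans eq (cong (b *_) N≡1+2half)) (ℕ∣.∣n⇒∣m*n a (^-pres-∣ q)))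
      hA<q : hA < q
      hA<q = ≤-trans (m≤n*m (suc hA) (pw 2990)) large

    -- Both powers are divisible by `2 ^ n`, hence `a * y ^ q` is congruent to `b` modulo `2 ^ n`,
    -- and `m ≤ 4 * n` keeps `log N` proportional to `n`. As `y` is odd, `u = 2 ^ 512` brings
    -- `y ^ u` close enough to 1.
    middle-case : n ≤ m → m ≤ 4 * n → ⊥
    middle-case n≤m m≤4n with even⊎odd y
    ... | inj₁ 2∣y = y-not-even 2∣y
    ... | inj₂ (r , y≡) = Sc.St.TwoAdic.impossible a b y n 1<y (≤-trans a≤ (pw-mono-≤ Sc.hA≤h)) (≤-trans b≤ (pw-mono-≤ Sc.hA≤h)) y≤
        (subst (λ y → pw 512 ℕ∣.∣ y ^ pw 512 ∸ 1) (sym y≡) (odd-power-∣ r 512)) (Sc.K≤ n Λq≤n) divisible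
      where
      module Sc = Scale (pw 512) (pw-mono-≤ (≤ᵇ⇒≤ 512 1330 _))
      open ≤-Reasoning
      N≤ : N ≤ pw (2 + 4 * n)
      N≤ = begin
        2 ^ m + 6 ^ n + 1                 ≤⟨ +-mono-≤ (+-mono-≤ (≤-trans (≤-reflexive (sym (pw≡2^ m))) (pw-mono-≤ m≤4n)) (≤-trans 6^n≤ (pw-mono-≤ (*-monoˡ-≤ n (≤ᵇ⇒≤ 3 4 _))))) (>-nonZero⁻¹ (pw (4 * n))) ⟩
        pw (4 * n) + pw (4 * n) + pw (4 * n) ≤⟨ m≤m+n _ (pw (4 * n)) ⟩
        pw (4 * n) + pw (4 * n) + pw (4 * n) + pw (4 * n) ≡⟨ lem (pw (4 * n)) ⟩
        4 * pw (4 * n)                    ≡⟨ cong (_* pw (4 * n)) (pw≡2^ 2) ⟨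
        pw 2 * pw (4 * n)                 ≡⟨ pw-+ 2 (4 * n) ⟨
        pw (2 + 4 * n) ∎
        where
        lem : ∀ x → x + x + x + x ≡ 4 * x
        lem = solve-∀
      Λq≤n : Λ * q ≤ pw 7 * n
      Λq≤n = begin
        Λ * q              ≤⟨ Λq≤ N (2 + 4 * n) eq N≤ ⟩
        4 * (2 + 4 * n)    ≤⟨ *-monoʳ-≤ 4 (+-monoˡ-≤ (4 * n) (*-monoʳ-≤ 2 1≤n)) ⟩
        4 * (2 * n + 4 * n) ≤⟨ m≤m+n _ (104 * n) ⟩
        4 * (2 * n + 4 * n) + 104 * n ≡⟨ lem n ⟩
        128 * n            ≡⟨ cong (_* n) (pw≡2^ 7) ⟨
        pw 7 * n ∎
        where
        lem : ∀ n → 4 * (2 * n + 4 * n) + 104 * n ≡ 128 * n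
        lem = solve-∀
      D : ℕ
      D = 2 ^ (m ∸ n) + 3 ^ n
      N≡ : N ≡ 1 + D * 2 ^ n
      N≡ = trans (cong₂ (λ i j → i + j + 1) (trans (cong (2 ^_) (sym (m+[n∸m]≡n n≤m))) (^-distribˡ-+-* 2 n (m ∸ n))) (6^≡ n)) (lem (2 ^ n) (2 ^ (m ∸ n)) (3 ^ n))
        where
        lem : ∀ a x z → a * x + a * z + 1 ≡ 1 + (x + z) * a
        lem = solve-∀
      divisible : pos (pw n) ℤ∣.∣ (pos b -ᶻ pos (a * y ^ q))
      divisible = ℤ∣.divides (-ᶻ (pos b *ᶻ pos D)) (trans (cong (λ e → pos b -ᶻ pos e) (trans eq (cong (b *_) N≡)))
        (trans (cong (λ e → pos b -ᶻ e) (trans (ℤP.pos-* b _) (cong (pos b *ᶻ_) (trans (ℤP.pos-+ 1 (D * 2 ^ n)) (cong (1ℤ +ᶻ_) (ℤP.pos-* D (2 ^ n)))))))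
          (trans (lem (pos b) (pos D) (pos (2 ^ n))) (cong (λ p → (-ᶻ (pos b *ᶻ pos D)) *ᶻ pos p) (sym (pw≡2^ n))))))
        where
        lem : ∀ b d p → b -ᶻ b *ᶻ (1ℤ +ᶻ d *ᶻ p) ≡ (-ᶻ (b *ᶻ d)) *ᶻ p
        lem = ℤRS.solve-∀

    impossible : ⊥
    impossible with ≤-total m n
    ... | inj₁ m≤n = m≤n-case m≤n
    ... | inj₂ n≤m with ≤-total (4 * n) m
    ...   | inj₁ 4n≤m = 4n≤m-case 4n≤m
    ...   | inj₂ m≤4n = middle-case n≤m m≤4n

-- The bound in terms of the height.

exponent-bound : ∀ m n q y A → 1 ≤ m → 1 ≤ n → 2 ≤ y →
  ∣ ℚ.↥ A ∣ * y ^ q ≡ ℚ.↧ₙ A * (2 ^ m + 6 ^ n + 1) → q ≤ pw 3000 * (1 ⊔ log₂Height A)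
exponent-bound m n q y A 1≤m 1≤n 2≤y eq with q ≤? pw 3000 * (1 ⊔ log₂Height A) | log-bounds y (<⇒≤ 2≤y)
... | yes q≤ | _ = q≤
... | no q≰  | k , lo , hi = ⊥-elim
    (Contradiction.impossible 255 refl q ∣ ℚ.↥ A ∣ (ℚ.↧ₙ A) y (suc (log₂Height A)) k {{a≢0}}
      (≤-trans (m≤m⊔n ∣ ℚ.↥ A ∣ (ℚ.↧ₙ A)) H≤) (≤-trans (m≤n⊔m ∣ ℚ.↥ A ∣ (ℚ.↧ₙ A)) H≤)
      (1≤k k hi) (≤-trans (≤-reflexive (pw≡2^ k)) lo) (≤-trans (<⇒≤ hi) (≤-reflexive (sym (pw≡2^ (suc k))))) large m n 1≤m 1≤n eq)
  where
  open ≤-Reasoning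
  N : ℕ
  N = 2 ^ m + 6 ^ n + 1
  a≢0 : NonZero ∣ ℚ.↥ A ∣
  a≢0 = ≢-nonZero λ a≡0 → m<n⇒n≢0 {0} (≤-trans (≤-trans (s≤s z≤n) (m≤n+m 1 (2 ^ m + 6 ^ n))) (m≤n*m N (ℚ.↧ₙ A))) (trans (sym eq) (cong (_* y ^ q) a≡0))
  H≤ : heightℕ A ≤ pw (suc (log₂Height A))
  H≤ = height-bound (heightℕ A) (≤-trans (s≤s z≤n) (m≤n⊔m ∣ ℚ.↥ A ∣ (ℚ.↧ₙ A)))
  1≤k : ∀ k → y < 2 ^ suc k → 1 ≤ k
  1≤k zero    y<2 = ⊥-elim (<⇒≱ y<2 2≤y)
  1≤k (suc k) _   = s≤s z≤n
  ℓ : ℕ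
  ℓ = 1 ⊔ log₂Height A
  1≤ℓ : 1 ≤ ℓ
  1≤ℓ = m≤m⊔n 1 (log₂Height A)
  large : pw 2990 * suc (suc (log₂Height A)) ≤ q
  large = begin
    -- One `suc` makes up for the floor in the logarithm, the other is that of `suc hA`; both are
    -- absorbed by `1 ≤ ℓ`.
    pw 2990 * suc (suc (log₂Height A))  ≤⟨ *-monoʳ-≤ (pw 2990) (+-mono-≤ 1≤ℓ (+-mono-≤ 1≤ℓ (m≤n⊔m 1 (log₂Height A)))) ⟩
    pw 2990 * (ℓ + (ℓ + ℓ))             ≤⟨ *-monoʳ-≤ (pw 2990) (≤-trans (m≤m+n (ℓ + (ℓ + ℓ)) ℓ) (≤-trans (≤-reflexive (lem ℓ)) (*-monoˡ-≤ ℓ (≤-reflexive (sym (pw≡2^ 2)))))) ⟩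
    pw 2990 * (pw 2 * ℓ)                ≡⟨ trans (sym (*-assoc (pw 2990) (pw 2) ℓ)) (cong (_* ℓ) (sym (pw-+ 2990 2))) ⟩
    pw 2992 * ℓ                         ≤⟨ *-monoˡ-≤ ℓ (pw-mono-≤ (≤ᵇ⇒≤ 2992 3000 _)) ⟩
    pw 3000 * ℓ                         ≤⟨ <⇒≤ (≰⇒> q≰) ⟩
    q ∎
    where
    lem : ∀ l → l + (l + l) + l ≡ 4 * l
    lem = solve-∀

open import Data.Integer using (+_)

theorem5p3 : ∃ λ (c : ℕ) → (0 < c) ×
    ((m n q y : ℕ) (A : ℚ) → 1 ≤ m → 1 ≤ n → 1 ≤ q → 2 ≤ y → A ≢ 0ℚ →
    (+ (2 ^ m + 6 ^ n + 1)) / 1 ≡ A *ℚ ((+ (y ^ q)) / 1) →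
    q ≤ c * (1 ⊔ log₂Height A))
theorem5p3 = pw 3000 , >-nonZero⁻¹ (pw 3000) , λ m n q y A 1≤m 1≤n _ 2≤y _ eq →
  exponent-bound m n q y A 1≤m 1≤n 2≤y (ℕ-equation A (2 ^ m + 6 ^ n + 1) (y ^ q) eq)
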